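{- Let $p$ be prime, $a\ge1$, $q=p^a$, $n,d\ge1$. Let $\bar F\in\mathbf F_q[x]_d$ and let $X$ be the hypersurface in $\mathbf T^n_{\mathbf F_q}$ cut out by $\bar F$. Let $r,\lambda,\tau$ be positive integers with $\tau\ge\frac{\lambda}{(p-1)ar}$. Let $F\in\mathbf Z_q[x]_d$ be any lift of $\bar F$. Then $$|X(\mathbf F_{q^r})|\equiv(q^r-1)^n\sum_{s=0}^{\lambda+\tau-1}\alpha_s\operatorname{trace}(A_{F^s}^{ar})\pmod{p^\lambda},$$ where $\alpha_s=(-1)^s\sum_{t=0}^{\tau-1}\binom{ -\lambda}{t}\binom{\lambda}{s-t}\in\mathbf Z$, and $A_{F^s}^{ar}$ is regarded as a $\mathbf Z_q$-linear operator on $\mathbf Z_q[x]_{ds}$, with trace taken with respect to the monomial basis $\{x^w:w\in B_{ds}\}$ (for $s=0$, $\mathbf Z_q[x]_0=\mathbf Z_q$).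
   Context: For a ring $R$, $R[x]=R[x_0,\dots,x_n]$; $R[x]_k$ is the module of homogeneous polynomials of degree $k$, with basis $x^u=x_0^{u_0}\cdots x_n^{u_n}$ for $u\in B_k=\{u\in\mathbf N^{n+1}:u_0+\cdots+u_n=k\}$. For $G\in R[x]$ and $u\in\mathbf Z^{n+1}$, $G_u$ is the coefficient of $x^u$ (zero if some $u_i<0$). $\mathbf Z_q$ is the ring of Witt vectors of $\mathbf F_q$ (ring of integers of the unramified extension of $\mathbf Q_p$ of degree $a$), and $\phi:\mathbf Z_q\to\mathbf Z_q$ is the Frobenius automorphism lifting $u\mapsto u^p$ on $\mathbf F_q$. Define $\phi,\psi:\mathbf Z_q[x]\to\mathbf Z_q[x]$ by $\phi(G)=\sum_u\phi(G_u)x^{pu}$ and $\psi(G)=\sum_u\phi^{ -1}(G_{pu})x^u$. For homogeneous $H\in\mathbf Z_q[x]$, $A_H=\psi\circ T_{H^{p-1}}$ where $T_{H^{p-1}}$ is multiplication by $H^{p-1}$; $A_H$ is $\phi^{ -1}$-semilinear and maps $\mathbf Z_q[x]_k$ to itself for $H$ of degree $k$, so $A_H^{ar}$ is $\mathbf Z_q$-linear. $\mathbf T^n_{\mathbf F_q}=\{x_0\cdots x_n\ne0\}\subset\mathbf P^n_{\mathbf F_q}$ and $|X(\mathbf F_{q^r})|=\frac1{q^r-1}\#\{c\in(\mathbf F_{q^r}^*)^{n+1}:\bar F(c)=0\}$ ($\bar F=0$ allowed). -}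

module Defs where

open import Level using (Level; _⊔_) renaming (suc to lsuc)
open import Algebra.Bundles using (CommutativeRing)
open import Algebra.Morphism.Structures using (module RingMorphisms)
import Algebra.Properties.Semiring.Divisibility as Divisibility
import Algebra.Properties.Semiring.Exp as Exp
import Algebra.Properties.Semiring.Mult as Mult
open import Data.Fin.Base using (Fin)
import Data.Fin.Properties as Fin
open import Data.Integer.Base as ℤ using (ℤ; +_; -[1+_]; 0ℤ; 1ℤ; -1ℤ; _/ℕ_)
import Data.Integer.Properties as ℤ
open import Data.List.Base as List
  using (List; []; _∷_; upTo; allFin; filter; concatMap; cartesianProductWith; length)
open import Data.Nat.Base as ℕ
  using (ℕ; zero; suc; _≤_; _<_; _∸_; _/_; _!; NonZero)
import Data.Nat.Properties as ℕ
open import Data.Nat.Primality using (Prime; prime⇒nonZero)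
open import Data.Product.Base using (∃; proj₁; proj₂)
open import Data.Sum.Base using (inj₁; inj₂)
open import Data.Vec.Base as Vec using (Vec; []; _∷_)
open import Data.Vec.Properties using (≡-dec)
open import Function.Base using (_∘_)
open import Function.Bundles using (Inverse; Injection; _⇔_)
open import Function.Properties.Inverse using (Inverse⇒Injection)
open import Relation.Binary.Definitions using (Decidable)
open import Relation.Binary.PropositionalEquality as ≡ using (_≡_; _≢_; refl)
open import Relation.Nullary using (yes; no; contradiction)
open import Relation.Nullary.Decidable using (¬?; via-injection)

open CommutativeRing using () renaming (Carrier to ⟨_⟩)

choices : ∀ {a} {A : Set a} {m} → Vec (List A) m → List (Vec A m)
choices []         = [] ∷ []
choices (xs ∷ xss) = cartesianProductWith _∷_ xs (choices xss)

Exponent : ℕ → Set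
Exponent m = Vec ℕ m

below : ∀ {m} → Exponent m → List (Exponent m)
below w = choices (Vec.map (upTo ∘ suc) w)

B : (m k : ℕ) → List (Exponent m)
B m k = filter (λ u → Vec.sum u ℕ.≟ k) (below (Vec.replicate m k))

sumOver : ∀ {a c ℓ} {A : Set a} (R : CommutativeRing c ℓ) →
          List A → (A → ⟨ R ⟩) → ⟨ R ⟩
sumOver R xs f = List.foldr _+_ 0# (List.map f xs)
  where open CommutativeRing R

sumOver-zero : ∀ {a c ℓ} {A : Set a} (R : CommutativeRing c ℓ) (xs : List A)
               (f : A → ⟨ R ⟩) →
               (∀ x → CommutativeRing._≈_ R (f x) (CommutativeRing.0# R)) →
               CommutativeRing._≈_ R (sumOver R xs f) (CommutativeRing.0# R)
sumOver-zero R []       f f≈0 = CommutativeRing.refl R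
sumOver-zero R (x ∷ xs) f f≈0 =
  trans (+-cong (f≈0 x) (sumOver-zero R xs f f≈0)) (+-identityˡ 0#)
  where open CommutativeRing R

sum-∸ : ∀ {m} (w v : Exponent m) →
        Vec.sum w ≤ Vec.sum v ℕ.+ Vec.sum (Vec.zipWith _∸_ w v)
sum-∸ []      []      = ℕ.z≤n
sum-∸ (x ∷ w) (y ∷ v) = begin
  x ℕ.+ Vec.sum w
    ≤⟨ ℕ.+-mono-≤ (ℕ.m≤n+m∸n x y) (sum-∸ w v) ⟩
  (y ℕ.+ (x ∸ y)) ℕ.+ (Vec.sum v ℕ.+ Vec.sum (Vec.zipWith _∸_ w v))
    ≡⟨ ℕ-interchange y (x ∸ y) (Vec.sum v) _ ⟩
  (y ℕ.+ Vec.sum v) ℕ.+ ((x ∸ y) ℕ.+ Vec.sum (Vec.zipWith _∸_ w v)) ∎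
  where
  open ℕ.≤-Reasoning
  open import Algebra.Properties.CommutativeSemigroup ℕ.+-commutativeSemigroup
    renaming (interchange to ℕ-interchange)

sum-scale : ∀ {m} p .{{_ : NonZero p}} (u : Exponent m) →
            Vec.sum u ≤ Vec.sum (Vec.map (p ℕ.*_) u)
sum-scale p []      = ℕ.z≤n
sum-scale p (x ∷ u) = ℕ.+-mono-≤ (ℕ.m≤n*m x p) (sum-scale p u)

fromℕ : ∀ {c ℓ} (R : CommutativeRing c ℓ) → ℕ → ⟨ R ⟩
fromℕ R n = n × 1#
  where open CommutativeRing R ; open Mult semiring using (_×_)

fromℤ : ∀ {c ℓ} (R : CommutativeRing c ℓ) → ℤ → ⟨ R ⟩
fromℤ R (+ n)    = fromℕ R n
fromℤ R -[1+ n ] = - fromℕ R (suc n)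
  where open CommutativeRing R

-- x ≡ y modulo the ideal p^k R
_⊢_≈_mod_^_ : ∀ {c ℓ} (R : CommutativeRing c ℓ) →
              ⟨ R ⟩ → ⟨ R ⟩ → ℕ → ℕ → Set (c ⊔ ℓ)
R ⊢ x ≈ y mod p ^ k = (fromℕ R p ^ᴿ k) ∣ (x - y)
  where
  open CommutativeRing R
  open Divisibility semiring using (_∣_)
  open Exp semiring renaming (_^_ to _^ᴿ_)

IsRingHomomorphism : ∀ {c₁ ℓ₁ c₂ ℓ₂} (R : CommutativeRing c₁ ℓ₁) (S : CommutativeRing c₂ ℓ₂) →
                     (⟨ R ⟩ → ⟨ S ⟩) → Set (c₁ ⊔ ℓ₁ ⊔ ℓ₂)
IsRingHomomorphism R S = RingMorphisms.IsRingHomomorphism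
  (CommutativeRing.rawRing R) (CommutativeRing.rawRing S)

IsRingIsomorphism : ∀ {c₁ ℓ₁ c₂ ℓ₂} (R : CommutativeRing c₁ ℓ₁) (S : CommutativeRing c₂ ℓ₂) →
                    (⟨ R ⟩ → ⟨ S ⟩) → Set (c₁ ⊔ ℓ₁ ⊔ c₂ ⊔ ℓ₂)
IsRingIsomorphism R S = RingMorphisms.IsRingIsomorphism
  (CommutativeRing.rawRing R) (CommutativeRing.rawRing S)

-- A polynomial is its family of coefficients, together with a bound on
-- the degree.  Polynomials are compared through their coefficients
-- only; `bound` need not be optimal.
record Poly {c ℓ} (R : CommutativeRing c ℓ) (m : ℕ) : Set (c ⊔ ℓ) where
  open CommutativeRing R using (_≈_; 0#)
  field
    coeff  : Exponent m → ⟨ R ⟩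
    bound  : ℕ
    vanish : ∀ u → bound < Vec.sum u → coeff u ≈ 0#

open Poly public

module _ {c ℓ} {R : CommutativeRing c ℓ} {m : ℕ} where
  open CommutativeRing R renaming (refl to ≈-refl; trans to ≈-trans)

  Homogeneous : ℕ → Poly R m → Set ℓ
  Homogeneous d G = ∀ u → Vec.sum u ≢ d → coeff G u ≈ 0#

  monomial : Exponent m → Poly R m
  monomial w = record { coeff = δ ; bound = Vec.sum w ; vanish = δ-vanish }
    where
    δ : Exponent m → ⟨ R ⟩
    δ u with ≡-dec ℕ._≟_ u w
    ... | yes _ = 1#
    ... | no  _ = 0#

    δ-vanish : ∀ u → Vec.sum w < Vec.sum u → δ u ≈ 0#
    δ-vanish u lt with ≡-dec ℕ._≟_ u w
    ... | yes refl = contradiction lt (ℕ.<-irrefl refl)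
    ... | no  _    = ≈-refl

  infixl 7 _*ₚ_
  infixr 8 _^ₚ_

  _*ₚ_ : Poly R m → Poly R m → Poly R m
  G *ₚ H = record
    { coeff  = λ w → sumOver R (below w) (term w)
    ; bound  = bound G ℕ.+ bound H
    ; vanish = λ w lt → sumOver-zero R (below w) (term w) (term-zero w lt)
    }
    where
    term : Exponent m → Exponent m → ⟨ R ⟩
    term w v = coeff G v * coeff H (Vec.zipWith _∸_ w v)

    term-zero : ∀ w → bound G ℕ.+ bound H < Vec.sum w → ∀ v → term w v ≈ 0#
    term-zero w lt v with ℕ.≤-<-connex (Vec.sum v) (bound G)
    ... | inj₂ G<v = ≈-trans (*-congʳ (vanish G v G<v)) (zeroˡ _)
    ... | inj₁ v≤G = ≈-trans (*-congˡ (vanish H _ H<)) (zeroʳ _)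
      where
      H< : bound H < Vec.sum (Vec.zipWith _∸_ w v)
      H< = ℕ.+-cancelˡ-< (bound G) _ _
             (ℕ.<-≤-trans lt (ℕ.≤-trans (sum-∸ w v) (ℕ.+-monoˡ-≤ _ v≤G)))

  _^ₚ_ : Poly R m → ℕ → Poly R m
  G ^ₚ zero  = monomial (Vec.replicate m 0)
  G ^ₚ suc s = G *ₚ (G ^ₚ s)

  -- Trace, with respect to the basis x^w (w ∈ B m k), of the
  -- endomorphism of the homogeneous polynomials of degree k given by
  -- restricting L; meaningful when L is linear and preserves degree k.
  trace : ℕ → (Poly R m → Poly R m) → ⟨ R ⟩
  trace k L = sumOver R (B m k) λ w → coeff (L (monomial w)) w

-- The sum runs over all exponents of total degree ≤ bound G, outside
-- which the coefficients of G vanish.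
eval : ∀ {c₁ ℓ₁ c₂ ℓ₂} {R : CommutativeRing c₁ ℓ₁} (S : CommutativeRing c₂ ℓ₂) {m} →
       (⟨ R ⟩ → ⟨ S ⟩) → Poly R m → Vec (⟨ S ⟩) m → ⟨ S ⟩
eval S {m} f G x =
  sumOver S (concatMap (B m) (upTo (suc (bound G)))) λ u →
    f (coeff G u) * Vec.foldr _ _*_ 1# (Vec.zipWith _^_ x u)
  where open CommutativeRing S ; open Exp semiring using (_^_)

record FiniteField c ℓ (q : ℕ) : Set (lsuc (c ⊔ ℓ)) where
  field
    commutativeRing : CommutativeRing c ℓ
  open CommutativeRing commutativeRing public
  field
    1≉0     : 1# ≉ 0#
    inverse : ∀ x → x ≉ 0# → ∃ λ y → x * y ≈ 1#
    finite  : Inverse setoid (≡.setoid (Fin q))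

  _≈?_ : Decidable _≈_
  _≈?_ = via-injection (Inverse⇒Injection finite) Fin._≟_

  units : List Carrier
  units = filter (λ x → ¬? (x ≈? 0#)) (List.map (Inverse.from finite) (allFin q))

  q-1-nonZero : NonZero (q ∸ 1)
  q-1-nonZero = go q finite
    where
    go : ∀ N → Inverse setoid (≡.setoid (Fin N)) → NonZero (N ∸ 1)
    go zero          i with () ← Inverse.to i 0#
    go (suc zero)    i = contradiction
      (Injection.injective (Inverse⇒Injection i)
        (Fin1-unique (Inverse.to i 1#) (Inverse.to i 0#))) 1≉0
      where
      Fin1-unique : (x y : Fin 1) → x ≡ y
      Fin1-unique Fin.zero Fin.zero = ≡.refl
    go (suc (suc _)) _ = _

-- The number of K-points of the hypersurface F̄ = 0 in the torus
-- x₀⋯xₙ ≠ 0 of projective space, where F̄ has coefficients in R and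
-- ι : R → K.  For F̄ homogeneous the division is exact, since K^* acts
-- freely on the solutions.
torusPoints : ∀ {c₁ ℓ₁ c₂ ℓ₂ N} {R : CommutativeRing c₁ ℓ₁} (K : FiniteField c₂ ℓ₂ N) {m} →
              (⟨ R ⟩ → FiniteField.Carrier K) → Poly R m → ℕ
torusPoints {N = N} K {m} ι F̄ =
  (length (filter (λ x → eval commutativeRing ι F̄ x ≈? 0#)
                  (choices (Vec.replicate m units)))
    / (N ∸ 1)) {{q-1-nonZero}}
  where open FiniteField K

-- The ring of Witt vectors of a finite (hence perfect) field k of
-- characteristic p, i.e. the p-torsion-free, p-adically separated and
-- complete ring with residue ring W/pW ≅ k.  These properties determine
-- it up to unique isomorphism over k; for |k| = p^a it is the ring of
-- integers of the unramified extension of ℚ_p of degree a.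
record WittVectors (p : ℕ) {c ℓ q} (k : FiniteField c ℓ q) c′ ℓ′ : Set (c ⊔ ℓ ⊔ lsuc (c′ ⊔ ℓ′)) where
  private module k = FiniteField k
  field
    commutativeRing : CommutativeRing c′ ℓ′
  open CommutativeRing commutativeRing public
  field
    reduce            : Carrier → k.Carrier
    reduce-isRingHom  : IsRingHomomorphism commutativeRing k.commutativeRing reduce
    reduce-surjective : ∀ y → ∃ λ x → reduce x k.≈ y
    reduce-kernel     : ∀ x → (reduce x k.≈ k.0#) ⇔ (commutativeRing ⊢ x ≈ 0# mod p ^ 1)
    p-torsionFree     : ∀ x → fromℕ commutativeRing p * x ≈ 0# → x ≈ 0#
    p-separated       : ∀ x → (∀ i → commutativeRing ⊢ x ≈ 0# mod p ^ i) → x ≈ 0#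
    p-complete        : ∀ (x : ℕ → Carrier) →
                        (∀ i → commutativeRing ⊢ x (suc i) ≈ x i mod p ^ i) →
                        ∃ λ y → ∀ i → commutativeRing ⊢ y ≈ x i mod p ^ i

record Frobenius {p c ℓ q} {k : FiniteField c ℓ q} {c′ ℓ′} (W : WittVectors p k c′ ℓ′) :
                 Set (c ⊔ ℓ ⊔ c′ ⊔ ℓ′) where
  private
    module k = FiniteField k
    module W = WittVectors W
  open Exp k.semiring using (_^_)
  field
    φ                   : W.Carrier → W.Carrier
    φ-isRingIsomorphism : IsRingIsomorphism W.commutativeRing W.commutativeRing φ
    φ-lift              : ∀ x → W.reduce (φ x) k.≈ W.reduce x ^ p

  open RingMorphisms.IsRingIsomorphism φ-isRingIsomorphism public

  φ⁻¹ : W.Carrier → W.Carrier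
  φ⁻¹ y = proj₁ (surjective y)

  φ⁻¹-zero : ∀ {y} → y W.≈ W.0# → φ⁻¹ y W.≈ W.0#
  φ⁻¹-zero {y} y≈0 =
    injective (W.trans (proj₂ (surjective y) W.refl) (W.trans y≈0 (W.sym 0#-homo)))

module _ {p c ℓ q} {k : FiniteField c ℓ q} {c′ ℓ′} {W : WittVectors p k c′ ℓ′}
         (p-prime : Prime p) (Φ : Frobenius W) {m : ℕ} where
  private R = WittVectors.commutativeRing W
  open Frobenius Φ

  ψ : Poly R m → Poly R m
  ψ G = record
    { coeff  = λ u → φ⁻¹ (coeff G (Vec.map (p ℕ.*_) u))
    ; bound  = bound G
    ; vanish = λ u lt → φ⁻¹-zero (vanish G _ (ℕ.<-≤-trans lt (sum-scale p u)))
    }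
    where instance _ = prime⇒nonZero p-prime

  A : Poly R m → Poly R m → Poly R m
  A H G = ψ ((H ^ₚ (p ∸ 1)) *ₚ G)

fallingFactorial : ℤ → ℕ → ℤ
fallingFactorial x zero    = 1ℤ
fallingFactorial x (suc t) = fallingFactorial x t ℤ.* (x ℤ.- + t)

-- x(x-1)⋯(x-t+1)/t! for t ≥ 0 (the division is exact), and 0 for t < 0.
binomial : ℤ → ℤ → ℤ
binomial x (+ t)    = (fallingFactorial x t /ℕ (t !)) {{t ℕ.!≢0}}
binomial x -[1+ _ ] = 0ℤ

α : (l τ s : ℕ) → ℤ
α l τ s = (-1ℤ ℤ.^ s) ℤ.* sumOver ℤ.+-*-commutativeRing (upTo τ) λ t →
  binomial (ℤ.- (+ l)) (+ t) ℤ.* binomial (+ l) (+ s ℤ.- + t)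

{-# OPTIONS --safe #-}
module Submission where

-- Write Q = qʳ and let t be the Teichmüller character of the field with Q
-- elements.  Moving all ψ to the left, A_Hᵃʳ = ψᵃʳ ∘ T_G with
-- G = ∏_{i<ar} φⁱ(H)^(p-1), so its trace is the sum of the coefficients of G at
-- the exponents divisible by Q - 1; by orthogonality of characters
-- (Q - 1)ⁿ⁺¹ times this trace is the sum of the values of G at the Teichmüller
-- points t(x).  For H = Fˢ these values are yˢ, where y = ∏_{i<ar} φⁱ(F)(t(x))^(p-1)
-- is ≡ 1 mod p if F̄(x) ≠ 0 and divisible by p^((p-1)ar) if F̄(x) = 0.  Finally
-- ∑ αₛ yˢ = (1 - y)ˡ ∑_{t<τ} binomial(-l, t) (-y)ᵗ ≡ 1 mod y^τ, so modulo pˡ this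
-- polynomial is the indicator function of F̄(x) = 0.
--
-- The Teichmüller points live in the Witt vectors of length l of the larger
-- field K.  As a model of these we take the quotient of the monoid algebra
-- (Z_q/pˡ)[K] by the annihilator of f : K → Z_q/pˡ, the (l + 1)-fold
-- multiplicative convolution of a lift of the trace Tr : K → F_q.  The l-th
-- power of the kernel of the evaluation map (Z_q/pˡ)[K] → K annihilates f,
-- because an element of this kernel annihilates Tr; and Z_q/pˡ embeds in the
-- quotient, because f takes a unit value.  The congruence obtained in this way
-- is the image of the claimed one under φᵃʳ.

open import Defs
open import Level using (Level; _⊔_)
open import Algebra.Bundles using (CommutativeMonoid; CommutativeRing; RawRing)
open import Algebra.Core using (Op₂)
import Algebra.Morphism.Construct.Composition as Composition
import Algebra.Morphism.Construct.Identity as Identity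
open import Algebra.Morphism.Structures using (module RingMorphisms)
import Algebra.Properties.CommutativeMonoid.Sum as FinSum
import Algebra.Properties.CommutativeSemiring.Binomial as Binomial
import Algebra.Properties.CommutativeSemiring.Exp as Exp
import Algebra.Properties.Ring as RingProperties
import Algebra.Properties.Semiring.Divisibility as Divisibility
import Algebra.Properties.Semiring.Mult as Mult
import Algebra.Solver.Ring
open import Algebra.Solver.Ring.AlmostCommutativeRing using (_-Raw-AlmostCommutative⟶_; fromCommutativeRing)
open import Data.Fin.Base as Fin using (Fin; inject₁; toℕ)
open import Data.Fin.Permutation using (Permutation; permutation)
import Data.Fin.Properties as Fin
open import Data.Integer.Base as ℤ using (ℤ; +_; -[1+_]; 0ℤ; 1ℤ; -1ℤ; _/ℕ_)
import Data.Integer.Properties as ℤ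
import Data.Integer.Solver as ℤ
open import Data.List.Base as List
  using (List; []; _∷_; _++_; allFin; cartesianProductWith; concatMap; filter; length; map; upTo)
open import Data.List.Membership.Propositional using (_∈_; _∉_; find; lose)
open import Data.List.Membership.Propositional.Properties
  using (∈-allFin; ∈-cartesianProductWith⁺; ∈-cartesianProductWith⁻; ∈-concatMap⁺; ∈-concatMap⁻;
         ∈-filter⁺; ∈-filter⁻; ∈-upTo⁺; ∈-upTo⁻)
open import Data.List.Properties as List using (++-assoc; map-upTo; upTo-∷ʳ)
open import Data.List.Relation.Binary.Disjoint.Propositional using (Disjoint)
open import Data.List.Relation.Unary.All as All using (All; []; _∷_)
import Data.List.Relation.Unary.All.Properties as All
open import Data.List.Relation.Unary.AllPairs as AllPairs using (AllPairs; []; _∷_)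
import Data.List.Relation.Unary.AllPairs.Properties as AllPairs
open import Data.List.Relation.Unary.Any as Any using (Any; any?; here; there)
import Data.List.Relation.Unary.Any.Properties as Any
open import Data.List.Relation.Unary.Unique.Propositional using (Unique)
open import Data.List.Relation.Unary.Unique.Propositional.Properties
  using (allFin⁺; cartesianProductWith⁺; concat⁺; filter⁺; upTo⁺)
open import Data.Maybe.Base using (Maybe; just; nothing)
open import Data.Nat.Base as ℕ using (ℕ; zero; suc; _≤_; _<_; _∸_; _!; NonZero)
open import Data.Nat.Combinatorics using (_C_; k![n∸k]!∣n!; nCk≡n!/k![n-k]!; nCn≡1)
open import Data.Nat.DivMod
  using (_%_; _/_; m%n<n; m*n%n≡0; m*n/n≡m; m/n*n≡m; m≡m%n+[m/n]*n)
open import Data.Nat.Divisibility as ℕ using (_∣_; _∤_; divides)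
open import Data.Nat.GeneralisedArithmetic using (iterate)
open import Data.Nat.Primality using (Prime; euclidsLemma; prime⇒nonTrivial; prime⇒nonZero)
import Data.Nat.Properties as ℕ
open import Data.Product.Base using (_×_; _,_; proj₁; proj₂; ∃)
open import Data.Sum.Base using (_⊎_; inj₁; inj₂)
open import Data.Vec.Base as Vec using (Vec; []; _∷_)
open import Data.Vec.Properties using (∷-injective; ≡-dec)
open import Data.Vec.Relation.Binary.Pointwise.Inductive as Pointwise using (Pointwise; []; _∷_)
open import Function.Base using (_∘_; id)
open import Function.Bundles using (Equivalence; Inverse)
open import Relation.Binary.Definitions using (DecidableEquality; tri<; tri≈; tri>)
open import Relation.Binary.PropositionalEquality as ≡ using (_≡_; _≢_)
import Relation.Binary.Reasoning.Setoid as SetoidReasoning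
open import Relation.Nullary using (Dec; yes; no; ¬_; contradiction)
open import Relation.Nullary.Decidable using (¬?; decidable-stable)
open import Relation.Unary using (Decidable; Pred)

open CommutativeRing using () renaming (Carrier to ⟨_⟩)

-- Only Z_q is given, so a home for the Teichmüller points has to be built. It must carry a
-- homomorphism `j` from Z_q, a reduction `red` to K and a multiplicative section `t` of `red`;
-- products of l elements of the kernel of `red` must vanish, while `j x` may vanish only if pˡ
-- divides `x`. In the monoid algebra itself the kernel is not nilpotent, so a quotient is needed
-- that kills l-fold products and still spares Z_q/pˡ. The trace achieves both. Coefficients in F_q
-- are fixed by the q-power map, so an element of the kernel annihilates all conjugates at once, and
-- each convolution with a lift of Tr pays one factor p. A unit value survives because ∑ f(c) c⁻¹
-- modulo p is multiplicative under convolution, and for Tr orthogonality evaluates it to Q - 1. The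
-- image under φᵃʳ arises because every application of A_H brings one φ⁻¹; applying φᵃʳ clears them
-- all. It can be removed at the end since φ is bijective and fixes p. The factor Q - 1 between |X|
-- and the number of affine zeros cancels because it is a unit modulo p.

-- Integers in a commutative ring

module FromInteger {c ℓ} (R : CommutativeRing c ℓ) where
  open CommutativeRing R
  open SetoidReasoning setoid
  open Mult semiring using (×-homo-+; ×1-homo-*)
  open RingProperties ring using (-0#≈0#; -‿+-comm; -‿involutive; -‿distribˡ-*; -‿distribʳ-*)
  open import Algebra.Properties.CommutativeSemigroup +-commutativeSemigroup using (interchange)

  fromℕ-+ : ∀ m n → fromℕ R (m ℕ.+ n) ≈ fromℕ R m + fromℕ R n
  fromℕ-+ = ×-homo-+ 1#

  fromℕ-* : ∀ m n → fromℕ R (m ℕ.* n) ≈ fromℕ R m * fromℕ R n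
  fromℕ-* = ×1-homo-*

  fromℤ-⊖ : ∀ m n → fromℤ R (m ℤ.⊖ n) ≈ fromℕ R m - fromℕ R n
  fromℤ-⊖ zero    zero    = sym (-‿inverseʳ 0#)
  fromℤ-⊖ zero    (suc n) = sym (+-identityˡ _)
  fromℤ-⊖ (suc m) zero    = sym (trans (+-congˡ -0#≈0#) (+-identityʳ _))
  fromℤ-⊖ (suc m) (suc n) = begin
    fromℤ R (suc m ℤ.⊖ suc n)                        ≡⟨ ≡.cong (fromℤ R) (ℤ.[1+m]⊖[1+n]≡m⊖n m n) ⟩
    fromℤ R (m ℤ.⊖ n)                                ≈⟨ fromℤ-⊖ m n ⟩
    fromℕ R m - fromℕ R n                            ≈⟨ +-identityˡ _ ⟨
    0# + (fromℕ R m - fromℕ R n)                     ≈⟨ +-congʳ (-‿inverseʳ 1#) ⟨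
    (1# - 1#) + (fromℕ R m - fromℕ R n)              ≈⟨ interchange _ _ _ _ ⟩
    (1# + fromℕ R m) + (- 1# - fromℕ R n)            ≈⟨ +-congˡ (-‿+-comm _ _) ⟩
    (1# + fromℕ R m) - (1# + fromℕ R n)              ∎

  fromℤ-neg : ∀ i → fromℤ R (ℤ.- i) ≈ - fromℤ R i
  fromℤ-neg (+ zero)  = sym -0#≈0#
  fromℤ-neg (+ suc n) = refl
  fromℤ-neg -[1+ n ]  = sym (-‿involutive _)

  fromℤ-+ : ∀ i j → fromℤ R (i ℤ.+ j) ≈ fromℤ R i + fromℤ R j
  fromℤ-+ (+ m)    (+ n)    = fromℕ-+ m n
  fromℤ-+ (+ m)    -[1+ n ] = fromℤ-⊖ m (suc n)
  fromℤ-+ -[1+ m ] (+ n)    = trans (fromℤ-⊖ n (suc m)) (+-comm _ _)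
  fromℤ-+ -[1+ m ] -[1+ n ] = begin
    - fromℕ R (suc (suc (m ℕ.+ n)))              ≡⟨ ≡.cong (λ k → - fromℕ R k) (ℕ.+-suc (suc m) n) ⟨
    - fromℕ R (suc m ℕ.+ suc n)                  ≈⟨ -‿cong (fromℕ-+ (suc m) (suc n)) ⟩
    - (fromℕ R (suc m) + fromℕ R (suc n))        ≈⟨ -‿+-comm _ _ ⟨
    - fromℕ R (suc m) - fromℕ R (suc n)          ∎

  private
    fromℤ-*-neg : ∀ m n → fromℤ R (+ m ℤ.* -[1+ n ]) ≈ fromℕ R m * - fromℕ R (suc n)
    fromℤ-*-neg m n = begin
      fromℤ R (+ m ℤ.* ℤ.- + suc n)         ≡⟨ ≡.cong (fromℤ R) (ℤ.neg-distribʳ-* (+ m) (+ suc n)) ⟨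
      fromℤ R (ℤ.- (+ m ℤ.* + suc n))       ≡⟨ ≡.cong (λ i → fromℤ R (ℤ.- i)) (ℤ.pos-* m (suc n)) ⟨
      fromℤ R (ℤ.- + (m ℕ.* suc n))         ≈⟨ fromℤ-neg (+ (m ℕ.* suc n)) ⟩
      - fromℕ R (m ℕ.* suc n)               ≈⟨ -‿cong (fromℕ-* m (suc n)) ⟩
      - (fromℕ R m * fromℕ R (suc n))       ≈⟨ -‿distribʳ-* _ _ ⟩
      fromℕ R m * - fromℕ R (suc n)         ∎

  fromℤ-* : ∀ i j → fromℤ R (i ℤ.* j) ≈ fromℤ R i * fromℤ R j
  fromℤ-* (+ m)    (+ n)    = begin
    fromℤ R (+ m ℤ.* + n)    ≡⟨ ≡.cong (fromℤ R) (ℤ.pos-* m n) ⟨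
    fromℕ R (m ℕ.* n)        ≈⟨ fromℕ-* m n ⟩
    fromℕ R m * fromℕ R n    ∎
  fromℤ-* (+ m)    -[1+ n ] = fromℤ-*-neg m n
  fromℤ-* -[1+ m ] (+ n)    = begin
    fromℤ R (-[1+ m ] ℤ.* + n)       ≡⟨ ≡.cong (fromℤ R) (ℤ.*-comm -[1+ m ] (+ n)) ⟩
    fromℤ R (+ n ℤ.* -[1+ m ])       ≈⟨ fromℤ-*-neg n m ⟩
    fromℕ R n * - fromℕ R (suc m)    ≈⟨ *-comm _ _ ⟩
    - fromℕ R (suc m) * fromℕ R n    ∎
  fromℤ-* -[1+ m ] -[1+ n ] = begin
    fromℕ R (suc m ℕ.* suc n)                    ≈⟨ fromℕ-* (suc m) (suc n) ⟩
    fromℕ R (suc m) * fromℕ R (suc n)            ≈⟨ -‿involutive _ ⟨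
    - (- (fromℕ R (suc m) * fromℕ R (suc n)))    ≈⟨ -‿cong (-‿distribʳ-* _ _) ⟩
    - (fromℕ R (suc m) * - fromℕ R (suc n))      ≈⟨ -‿distribˡ-* _ _ ⟩
    - fromℕ R (suc m) * - fromℕ R (suc n)        ∎

  private
    integers : RawRing _ _
    integers = CommutativeRing.rawRing ℤ.+-*-commutativeRing

    morphism : integers -Raw-AlmostCommutative⟶ fromCommutativeRing R
    morphism = record
      { ⟦_⟧ = fromℤ R ; +-homo = fromℤ-+ ; *-homo = fromℤ-* ; -‿homo = fromℤ-neg
      ; 0-homo = refl ; 1-homo = +-identityʳ 1# }

    decide : ∀ i j → Maybe (fromℤ R i ≈ fromℤ R j)
    decide i j with i ℤ.≟ j
    ... | yes ≡.refl = just refl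
    ... | no _       = nothing

  -- Coefficients from ℤ have decidable equality, so normal forms can cancel terms such as `x - x`
  -- although equality in `R` need not be decidable.
  module Solver = Algebra.Solver.Ring integers (fromCommutativeRing R) morphism decide

-- Sums over lists

module Sums {c ℓ} (R : CommutativeRing c ℓ) where
  open CommutativeRing R
  open SetoidReasoning setoid
  open import Algebra.Properties.CommutativeSemigroup +-commutativeSemigroup using (interchange)

  -- The Iverson bracket: it turns filters and case distinctions into factors, so that sums with
  -- dependent conditions can be interchanged.
  [_] : ∀ {p} {P : Set p} → Dec P → Carrier
  [ yes _ ] = 1#
  [ no _ ]  = 0#

  []-yes : ∀ {p} {P : Set p} (d : Dec P) → P → [ d ] ≈ 1#
  []-yes (yes _) _ = refl
  []-yes (no ¬p) p = contradiction p ¬p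

  []-no : ∀ {p} {P : Set p} (d : Dec P) → ¬ P → [ d ] ≈ 0#
  []-no (yes p) ¬p = contradiction p ¬p
  []-no (no _)  _  = refl

  []-cong : ∀ {p q} {P : Set p} {Q : Set q} (d : Dec P) (e : Dec Q) →
            (P → Q) → (Q → P) → [ d ] ≈ [ e ]
  []-cong (yes p) e f g = sym ([]-yes e (f p))
  []-cong (no ¬p) e f g = sym ([]-no e (¬p ∘ g))

  private variable
    a b : Level
    X : Set a
    Y : Set b

  sum-cong-∈ : (xs : List X) {f g : X → Carrier} →
               (∀ {x} → x ∈ xs → f x ≈ g x) → sumOver R xs f ≈ sumOver R xs g
  sum-cong-∈ []       eq = refl
  sum-cong-∈ (x ∷ xs) eq = +-cong (eq (here ≡.refl)) (sum-cong-∈ xs (eq ∘ there))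

  sum-cong : (xs : List X) {f g : X → Carrier} →
             (∀ x → f x ≈ g x) → sumOver R xs f ≈ sumOver R xs g
  sum-cong xs eq = sum-cong-∈ xs λ {x} _ → eq x

  sum-zero-∈ : (xs : List X) {f : X → Carrier} →
               (∀ {x} → x ∈ xs → f x ≈ 0#) → sumOver R xs f ≈ 0#
  sum-zero-∈ xs eq = trans (sum-cong-∈ xs {g = λ _ → 0#} eq) (sumOver-zero R xs _ (λ _ → refl))

  sum-zero : (xs : List X) {f : X → Carrier} → (∀ x → f x ≈ 0#) → sumOver R xs f ≈ 0#
  sum-zero xs eq = sumOver-zero R xs _ eq

  sum-+ : (xs : List X) (f g : X → Carrier) →
          sumOver R xs (λ x → f x + g x) ≈ sumOver R xs f + sumOver R xs g
  sum-+ []       f g = sym (+-identityˡ _)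
  sum-+ (x ∷ xs) f g = trans (+-congˡ (sum-+ xs f g)) (interchange _ _ _ _)

  sum-*ˡ : (z : Carrier) (xs : List X) (f : X → Carrier) →
           z * sumOver R xs f ≈ sumOver R xs (λ x → z * f x)
  sum-*ˡ z []       f = zeroʳ z
  sum-*ˡ z (x ∷ xs) f = trans (distribˡ _ _ _) (+-congˡ (sum-*ˡ z xs f))

  sum-*ʳ : (z : Carrier) (xs : List X) (f : X → Carrier) →
           sumOver R xs f * z ≈ sumOver R xs (λ x → f x * z)
  sum-*ʳ z xs f = trans (*-comm _ _) (trans (sum-*ˡ z xs f) (sum-cong xs λ _ → *-comm _ _))

  sum-neg : (xs : List X) (f : X → Carrier) →
            - sumOver R xs f ≈ sumOver R xs (λ x → - f x)
  sum-neg []       f = RingProperties.-0#≈0# ring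
  sum-neg (x ∷ xs) f = trans (sym (RingProperties.-‿+-comm ring _ _)) (+-congˡ (sum-neg xs f))

  sum-++ : (xs ys : List X) (f : X → Carrier) →
           sumOver R (xs ++ ys) f ≈ sumOver R xs f + sumOver R ys f
  sum-++ []       ys f = sym (+-identityˡ _)
  sum-++ (x ∷ xs) ys f = trans (+-congˡ (sum-++ xs ys f)) (sym (+-assoc _ _ _))

  sum-map : (g : X → Y) (xs : List X) (f : Y → Carrier) →
            sumOver R (map g xs) f ≈ sumOver R xs (f ∘ g)
  sum-map g []       f = refl
  sum-map g (x ∷ xs) f = +-congˡ (sum-map g xs f)

  sum-product : ∀ {d} {D : Set d} (k : X → Y → D) (xs : List X) (ys : List Y) (f : D → Carrier) →
                sumOver R (cartesianProductWith k xs ys) f ≈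
                sumOver R xs λ x → sumOver R ys λ y → f (k x y)
  sum-product k []       ys f = refl
  sum-product k (x ∷ xs) ys f =
    trans (sum-++ (map (k x) ys) _ f) (+-cong (sum-map (k x) ys f) (sum-product k xs ys f))

  sum-comm : (xs : List X) (ys : List Y) (f : X → Y → Carrier) →
             sumOver R xs (λ x → sumOver R ys (f x)) ≈
             sumOver R ys (λ y → sumOver R xs λ x → f x y)
  sum-comm []       ys f = sym (sum-zero ys λ _ → refl)
  sum-comm (x ∷ xs) ys f =
    trans (+-congˡ (sum-comm xs ys f)) (sym (sum-+ ys (f x) _))

  sum-filter : ∀ {p} {P : Pred X p} (P? : Decidable P) (xs : List X) (f : X → Carrier) →
               sumOver R (filter P? xs) f ≈ sumOver R xs (λ x → [ P? x ] * f x)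
  sum-filter P? []       f = refl
  sum-filter P? (x ∷ xs) f with P? x
  ... | yes _ = +-cong (sym (*-identityˡ _)) (sum-filter P? xs f)
  ... | no _  = trans (sum-filter P? xs f) (trans (sym (+-identityˡ _)) (+-congʳ (sym (zeroˡ _))))

  sum-const : (xs : List X) (z : Carrier) → sumOver R xs (λ _ → z) ≈ fromℕ R (length xs) * z
  sum-const []       z = sym (zeroˡ z)
  sum-const (x ∷ xs) z =
    trans (+-cong (sym (*-identityˡ z)) (sum-const xs z)) (sym (distribʳ _ _ _))

  sum-upTo-first : ∀ n (f : ℕ → Carrier) →
                   sumOver R (upTo (suc n)) f ≈ f 0 + sumOver R (upTo n) (f ∘ suc)
  sum-upTo-first n f = +-congˡ (trans
    (reflexive (≡.cong (λ xs → sumOver R xs f) (≡.sym (map-upTo suc n)))) (sum-map suc (upTo n) f))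

  sum-upTo-last : ∀ n (f : ℕ → Carrier) →
                  sumOver R (upTo (suc n)) f ≈ sumOver R (upTo n) f + f n
  sum-upTo-last n f = trans (reflexive (≡.cong (λ xs → sumOver R xs f) (≡.sym (upTo-∷ʳ n))))
    (trans (sum-++ (upTo n) (n ∷ []) f) (+-congˡ (+-identityʳ _)))

  length-filter : ∀ {p} {P : Pred X p} (P? : Decidable P) (xs : List X) →
                  fromℕ R (length (filter P? xs)) ≈ sumOver R xs (λ x → [ P? x ])
  length-filter P? xs = begin
    fromℕ R (length (filter P? xs))            ≈⟨ *-identityʳ _ ⟨
    fromℕ R (length (filter P? xs)) * 1#       ≈⟨ sum-const (filter P? xs) 1# ⟨
    sumOver R (filter P? xs) (λ _ → 1#)        ≈⟨ sum-filter P? xs _ ⟩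
    sumOver R xs (λ x → [ P? x ] * 1#)         ≈⟨ sum-cong xs (λ _ → *-identityʳ _) ⟩
    sumOver R xs (λ x → [ P? x ])              ∎

  module _ {a} {X : Set a} (_≟_ : DecidableEquality X) where

    sum-δ-∉ : (xs : List X) (y : X) (f : X → Carrier) → y ∉ xs →
              sumOver R xs (λ x → [ x ≟ y ] * f x) ≈ 0#
    sum-δ-∉ xs y f y∉ = sum-zero-∈ xs λ {x} x∈ →
      trans (*-congʳ ([]-no (x ≟ y) λ { ≡.refl → y∉ x∈ })) (zeroˡ _)

    sum-δ : {xs : List X} (y : X) (f : X → Carrier) → Unique xs → y ∈ xs →
            sumOver R xs (λ x → [ x ≟ y ] * f x) ≈ f y
    sum-δ {xs = x ∷ xs} y f (x∉ ∷ _) (here ≡.refl) =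
      trans (+-cong (trans (*-congʳ ([]-yes (x ≟ x) ≡.refl)) (*-identityˡ _))
                    (sum-δ-∉ xs x f λ x∈ → All.lookup x∉ x∈ ≡.refl))
            (+-identityʳ _)
    sum-δ {xs = x ∷ xs} y f (x∉ ∷ u) (there y∈) =
      trans (+-cong (trans (*-congʳ ([]-no (x ≟ y) (All.lookup x∉ y∈))) (zeroˡ _))
                    (sum-δ y f u y∈))
            (+-identityˡ _)

    open import Data.List.Membership.DecPropositional _≟_ using (_∈?_)

    sum-δ-⊎ : {xs : List X} (y : X) (f : X → Carrier) → Unique xs → y ∈ xs ⊎ f y ≈ 0# →
              sumOver R xs (λ x → [ x ≟ y ] * f x) ≈ f y
    sum-δ-⊎ y f u (inj₁ y∈) = sum-δ y f u y∈
    sum-δ-⊎ {xs} y f u (inj₂ fy≈0) with y ∈? xs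
    ... | yes y∈ = sum-δ y f u y∈
    ... | no y∉  = trans (sum-δ-∉ xs y f y∉) (sym fy≈0)

    []-swap : (f : X → Carrier) (x y : X) → [ x ≟ y ] * f x ≈ [ y ≟ x ] * f y
    []-swap f x y with x ≟ y
    ... | yes ≡.refl = *-congʳ (sym ([]-yes (x ≟ x) ≡.refl))
    ... | no x≢y     = trans (zeroˡ _) (sym (trans (*-congʳ ([]-no (y ≟ x) (x≢y ∘ ≡.sym))) (zeroˡ _)))

    -- Both sides equal the double sum of `[ y ≟ x ] * f y`: an entry missing from the other list
    -- has value zero and is lost without harm, and the bracket is symmetric. No bijection between
    -- the lists is constructed.
    sum-support : {xs ys : List X} (f : X → Carrier) → Unique xs → Unique ys →
                  (∀ {x} → x ∈ xs → x ∈ ys ⊎ f x ≈ 0#) →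
                  (∀ {y} → y ∈ ys → y ∈ xs ⊎ f y ≈ 0#) →
                  sumOver R xs f ≈ sumOver R ys f
    sum-support {xs} {ys} f uxs uys xs⊆ys ys⊆xs = begin
      sumOver R xs f
        ≈⟨ sum-cong-∈ xs (λ {x} x∈ → sum-δ-⊎ x f uys (xs⊆ys x∈)) ⟨
      sumOver R xs (λ x → sumOver R ys λ y → [ y ≟ x ] * f y)
        ≈⟨ sum-comm xs ys _ ⟩
      sumOver R ys (λ y → sumOver R xs λ x → [ y ≟ x ] * f y)
        ≈⟨ sum-cong ys (λ y → sum-cong xs λ x → []-swap f y x) ⟩
      sumOver R ys (λ y → sumOver R xs λ x → [ x ≟ y ] * f x)
        ≈⟨ sum-cong-∈ ys (λ {y} y∈ → sum-δ-⊎ y f uxs (ys⊆xs y∈)) ⟩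
      sumOver R ys f ∎

module _ {c₁ ℓ₁ c₂ ℓ₂} (R : CommutativeRing c₁ ℓ₁) (S : CommutativeRing c₂ ℓ₂)
         {f : ⟨ R ⟩ → ⟨ S ⟩} (f-hom : IsRingHomomorphism R S f) where
  private
    module R = CommutativeRing R
    module S = CommutativeRing S
    module f = RingMorphisms.IsRingHomomorphism f-hom
  open import Algebra.Properties.Semiring.Exp R.semiring using () renaming (_^_ to _^ᴿ_)
  open import Algebra.Properties.Semiring.Exp S.semiring using () renaming (_^_ to _^ˢ_)

  sum-homo : ∀ {a} {X : Set a} (xs : List X) (g : X → R.Carrier) →
             f (sumOver R xs g) S.≈ sumOver S xs (f ∘ g)
  sum-homo []       g = f.0#-homo
  sum-homo (x ∷ xs) g = S.trans (f.+-homo _ _) (S.+-congˡ (sum-homo xs g))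

  ^-homo : ∀ x k → f (x ^ᴿ k) S.≈ f x ^ˢ k
  ^-homo x zero    = f.1#-homo
  ^-homo x (suc k) = S.trans (f.*-homo _ _) (S.*-congˡ (^-homo x k))

  fromℕ-homo : ∀ n → f (fromℕ R n) S.≈ fromℕ S n
  fromℕ-homo zero    = f.0#-homo
  fromℕ-homo (suc n) = S.trans (f.+-homo _ _) (S.+-cong f.1#-homo (fromℕ-homo n))

  fromℤ-homo : ∀ i → f (fromℤ R i) S.≈ fromℤ S i
  fromℤ-homo (ℤ.+ n)      = fromℕ-homo n
  fromℤ-homo ℤ.-[1+ n ] = S.trans (f.-‿homo _) (S.-‿cong (fromℕ-homo (suc n)))

-- Quotient rings and operator rings

module Congruence {c ℓ} (R : CommutativeRing c ℓ) (π : ⟨ R ⟩) where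
  open CommutativeRing R
  open Divisibility semiring using (_,_; ∣-respʳ; _∣0) renaming (_∣_ to _∣ᴿ_)
  open RingProperties ring using (-‿distribˡ-*; x≈y⇒x∙y⁻¹≈ε)
  open FromInteger.Solver R using (solve; _:=_; _:+_; _:*_; _:-_; :-_)

  ∣-+ : ∀ {x y} → π ∣ᴿ x → π ∣ᴿ y → π ∣ᴿ x + y
  ∣-+ (q , eq) (q′ , eq′) = (q + q′) , trans (distribʳ _ _ _) (+-cong eq eq′)

  ∣-*ˡ : ∀ {x} z → π ∣ᴿ x → π ∣ᴿ z * x
  ∣-*ˡ z (q , eq) = (z * q) , trans (*-assoc _ _ _) (*-congˡ eq)

  ∣-sum : ∀ {a} {X : Set a} (xs : List X) (f : X → Carrier) → (∀ x → π ∣ᴿ f x) → π ∣ᴿ sumOver R xs f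
  ∣-sum []       f h = π ∣0
  ∣-sum (x ∷ xs) f h = ∣-+ (h x) (∣-sum xs f h)

  infix 4 _∼_
  record _∼_ (x y : Carrier) : Set (c ⊔ ℓ) where
    constructor mk
    field
      ∣-difference : π ∣ᴿ x - y

  ∼-reflexive : ∀ {x y} → x ≈ y → x ∼ y
  ∼-reflexive eq = mk (∣-respʳ (sym (x≈y⇒x∙y⁻¹≈ε eq)) (π ∣0))

  private
    sym-lemma : ∀ x y → (- 1#) * (x - y) ≈ y - x
    sym-lemma x y = trans (sym (-‿distribˡ-* 1# _)) (trans (-‿cong (*-identityˡ _))
      (solve 2 (λ x y → :- (x :- y) := y :- x) refl x y))
    trans-lemma : ∀ x y z → (x - y) + (y - z) ≈ x - z
    trans-lemma = solve 3 (λ x y z → (x :- y) :+ (y :- z) := x :- z) refl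
    +-lemma : ∀ x x′ y y′ → (x - x′) + (y - y′) ≈ (x + y) - (x′ + y′)
    +-lemma = solve 4 (λ x x′ y y′ → (x :- x′) :+ (y :- y′) := (x :+ y) :- (x′ :+ y′)) refl
    *-lemma : ∀ x x′ y y′ → y * (x - x′) + x′ * (y - y′) ≈ x * y - x′ * y′
    *-lemma = solve 4 (λ x x′ y y′ → y :* (x :- x′) :+ x′ :* (y :- y′) := x :* y :- x′ :* y′) refl
    neg-lemma : ∀ x y → (- 1#) * (x - y) ≈ - x - - y
    neg-lemma x y = trans (sym-lemma x y) (solve 2 (λ x y → y :- x := (:- x) :- (:- y)) refl x y)

  ∼-sym : ∀ {x y} → x ∼ y → y ∼ x
  ∼-sym (mk h) = mk (∣-respʳ (sym-lemma _ _) (∣-*ˡ _ h))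

  ∼-trans : ∀ {x y z} → x ∼ y → y ∼ z → x ∼ z
  ∼-trans (mk h) (mk h′) = mk (∣-respʳ (trans-lemma _ _ _) (∣-+ h h′))

  ∼-+ : ∀ {x x′ y y′} → x ∼ x′ → y ∼ y′ → x + y ∼ x′ + y′
  ∼-+ (mk h) (mk h′) = mk (∣-respʳ (+-lemma _ _ _ _) (∣-+ h h′))

  ∼-* : ∀ {x x′ y y′} → x ∼ x′ → y ∼ y′ → x * y ∼ x′ * y′
  ∼-* (mk h) (mk h′) = mk (∣-respʳ (*-lemma _ _ _ _) (∣-+ (∣-*ˡ _ h) (∣-*ˡ _ h′)))

  ∼-neg : ∀ {x y} → x ∼ y → - x ∼ - y
  ∼-neg (mk h) = mk (∣-respʳ (neg-lemma _ _) (∣-*ˡ _ h))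

  quotientRing : CommutativeRing c (c ⊔ ℓ)
  quotientRing = record
    { Carrier = Carrier ; _≈_ = _∼_ ; _+_ = _+_ ; _*_ = _*_ ; -_ = -_ ; 0# = 0# ; 1# = 1#
    ; isCommutativeRing = record
      { isRing = record
        { +-isAbelianGroup = record
          { isGroup = record
            { isMonoid = record
              { isSemigroup = record
                { isMagma = record
                  { isEquivalence = record { refl = ∼-reflexive refl ; sym = ∼-sym ; trans = ∼-trans }
                  ; ∙-cong = ∼-+ }
                ; assoc = λ x y z → ∼-reflexive (+-assoc x y z) }
              ; identity = (λ x → ∼-reflexive (+-identityˡ x)) , λ x → ∼-reflexive (+-identityʳ x) }
            ; inverse = (λ x → ∼-reflexive (-‿inverseˡ x)) , λ x → ∼-reflexive (-‿inverseʳ x)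
            ; ⁻¹-cong = ∼-neg }
          ; comm = λ x y → ∼-reflexive (+-comm x y) }
        ; *-cong = ∼-*
        ; *-assoc = λ x y z → ∼-reflexive (*-assoc x y z)
        ; *-identity = (λ x → ∼-reflexive (*-identityˡ x)) , λ x → ∼-reflexive (*-identityʳ x)
        ; distrib = (λ x y z → ∼-reflexive (distribˡ x y z)) , λ x y z → ∼-reflexive (distribʳ x y z) }
      ; *-comm = λ x y → ∼-reflexive (*-comm x y) } }

  ∼0⇒∣ : ∀ {x} → x ∼ 0# → π ∣ᴿ x
  ∼0⇒∣ (mk h) = ∣-respʳ (trans (+-congˡ (RingProperties.-0#≈0# ring)) (+-identityʳ _)) h

  ∣⇒∼0 : ∀ {x} → π ∣ᴿ x → x ∼ 0#
  ∣⇒∼0 h = mk (∣-respʳ (sym (trans (+-congˡ (RingProperties.-0#≈0# ring)) (+-identityʳ _))) h)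

-- A list of pairs (a , u) stands for the formal sum ∑ a [u].
FormalSum : ∀ {c ℓ a} (R : CommutativeRing c ℓ) → Set a → Set (c ⊔ a)
FormalSum R X = List (⟨ R ⟩ × X)

module _ {c ℓ a} (R : CommutativeRing c ℓ) {X : Set a} (_∙_ : Op₂ X) where
  open CommutativeRing R using (_*_)

  convolve : FormalSum R X → FormalSum R X → FormalSum R X
  convolve = cartesianProductWith λ x y → proj₁ x * proj₁ y , proj₂ x ∙ proj₂ y

module Pairing {c₁ ℓ₁ c₂ ℓ₂} (R : CommutativeRing c₁ ℓ₁) (S : CommutativeRing c₂ ℓ₂)
               {f : ⟨ R ⟩ → ⟨ S ⟩} (f-hom : IsRingHomomorphism R S f) where
  private module R = CommutativeRing R
  open CommutativeRing S
  private module f = RingMorphisms.IsRingHomomorphism f-hom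
  open Sums S
  open SetoidReasoning setoid
  open import Algebra.Properties.CommutativeSemigroup *-commutativeSemigroup using (x∙yz≈y∙xz)

  -- The linear extension of `h` to formal sums. Depending on `h` it is the reduction to K, the
  -- action on a function, the value of a polynomial at a point, or a sum of selected coefficients.
  pair : ∀ {a} {X : Set a} → FormalSum R X → (X → Carrier) → Carrier
  pair P h = sumOver S P λ x → f (proj₁ x) * h (proj₂ x)

  private variable
    a b : Level
    X : Set a
    Y : Set b

  pair-cong : (P : FormalSum R X) {h k : X → Carrier} → (∀ u → h u ≈ k u) → pair P h ≈ pair P k
  pair-cong P eq = sum-cong P λ x → *-congˡ (eq (proj₂ x))

  pair-++ : (P Q : FormalSum R X) (h : X → Carrier) → pair (P ++ Q) h ≈ pair P h + pair Q h
  pair-++ P Q h = sum-++ P Q _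

  pair-*ˡ : ∀ z (P : FormalSum R X) (h : X → Carrier) → z * pair P h ≈ pair P (λ u → z * h u)
  pair-*ˡ z P h = trans (sum-*ˡ z P _) (sum-cong P λ x → x∙yz≈y∙xz _ _ _)

  pair-*ʳ : ∀ z (P : FormalSum R X) (h : X → Carrier) → pair P h * z ≈ pair P (λ u → h u * z)
  pair-*ʳ z P h = trans (sum-*ʳ z P _) (sum-cong P λ x → *-assoc _ _ _)

  pair-sum : (P : FormalSum R X) (ys : List Y) (h : Y → X → Carrier) →
             sumOver S ys (λ y → pair P (h y)) ≈ pair P (λ u → sumOver S ys λ y → h y u)
  pair-sum P ys h = trans (sum-comm ys P _) (sum-cong P λ x → sym (sum-*ˡ _ ys _))

  pair-comm : (P : FormalSum R X) (Q : FormalSum R Y) (h : X → Y → Carrier) →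
              pair P (λ u → pair Q (h u)) ≈ pair Q (λ v → pair P λ u → h u v)
  pair-comm P Q h = begin
    pair P (λ u → pair Q (h u))
      ≈⟨ sum-cong P (λ x → pair-*ˡ (f (proj₁ x)) Q (h (proj₂ x))) ⟩
    sumOver S P (λ x → pair Q λ v → f (proj₁ x) * h (proj₂ x) v)
      ≈⟨ pair-sum Q P _ ⟩
    pair Q (λ v → pair P λ u → h u v) ∎

  pair-convolve : (_∙_ : Op₂ X) (P Q : FormalSum R X) (h : X → Carrier) →
                  pair (convolve R _∙_ P Q) h ≈ pair P λ u → pair Q λ v → h (u ∙ v)
  pair-convolve _∙_ P Q h = trans (sum-product _ P Q _) (sum-cong P λ x → begin
    sumOver S Q (λ y → f (proj₁ x R.* proj₁ y) * h (proj₂ x ∙ proj₂ y))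
      ≈⟨ sum-cong Q (λ y → trans (*-congʳ (f.*-homo _ _)) (*-assoc _ _ _)) ⟩
    sumOver S Q (λ y → f (proj₁ x) * (f (proj₁ y) * h (proj₂ x ∙ proj₂ y)))
      ≈⟨ sum-*ˡ _ Q _ ⟨
    f (proj₁ x) * pair Q (λ v → h (proj₂ x ∙ v)) ∎)

  pair-neg : (P : FormalSum R X) (h : X → Carrier) →
             pair (map (λ x → R.- proj₁ x , proj₂ x) P) h ≈ - pair P h
  pair-neg P h = begin
    pair (map (λ x → R.- proj₁ x , proj₂ x) P) h        ≈⟨ sum-map _ P _ ⟩
    sumOver S P (λ x → f (R.- proj₁ x) * h (proj₂ x))
      ≈⟨ sum-cong P (λ x → trans (*-congʳ (f.-‿homo _)) (sym (RingProperties.-‿distribˡ-* ring _ _))) ⟩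
    sumOver S P (λ x → - (f (proj₁ x) * h (proj₂ x)))   ≈⟨ sum-neg P _ ⟨
    - pair P h ∎

  pair-single : (z : R.Carrier) (u : X) (h : X → Carrier) → pair ((z , u) ∷ []) h ≈ f z * h u
  pair-single z u h = +-identityʳ _

-- The monoid algebra R[M] acts on functions M → R by ([b]g)(c) = g (b c);
-- two elements are identified when they act in the same way on f, i.e. the
-- ring below is R[M]/Ann(f).
module Operators {c ℓ m ℓm} (R : CommutativeRing c ℓ) (M : CommutativeMonoid m ℓm)
                 (f : CommutativeMonoid.Carrier M → ⟨ R ⟩)
                 (f-cong : ∀ {u v} → CommutativeMonoid._≈_ M u v →
                           CommutativeRing._≈_ R (f u) (f v)) where
  private
    module R = CommutativeRing R
    module M = CommutativeMonoid M
  open M using (_∙_; ε)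
  open R using (_≈_; _+_; _*_; 0#; 1#)
  open Pairing R R (Identity.isRingHomomorphism R.rawRing R.refl) public
  open SetoidReasoning R.setoid

  Op : Set (c ⊔ m)
  Op = FormalSum R M.Carrier

  infix 4 _≋_
  record _≋_ (P Q : Op) : Set (c ⊔ m ⊔ ℓ) where
    constructor mk
    field
      same : ∀ z → pair P (λ u → f (u ∙ z)) ≈ pair Q (λ u → f (u ∙ z))

  infixl 7 _⊛_
  _⊛_ : Op → Op → Op
  _⊛_ = convolve R _∙_

  negate : Op → Op
  negate = map λ x → R.- proj₁ x , proj₂ x

  act-⊛ : (P Q : Op) (z : M.Carrier) →
          pair (P ⊛ Q) (λ u → f (u ∙ z)) ≈ pair P λ u → pair Q λ v → f (v ∙ (u ∙ z))
  act-⊛ P Q z = R.trans (pair-convolve _∙_ P Q _) (pair-cong P λ u → pair-cong Q λ v →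
    f-cong (M.trans (M.∙-congʳ (M.comm u v)) (M.assoc v u z)))

  ⊛-comm : ∀ P Q → P ⊛ Q ≋ Q ⊛ P
  ⊛-comm P Q = mk λ z → begin
    pair (P ⊛ Q) (λ u → f (u ∙ z))                ≈⟨ act-⊛ P Q z ⟩
    pair P (λ u → pair Q λ v → f (v ∙ (u ∙ z)))   ≈⟨ pair-comm P Q _ ⟩
    pair Q (λ v → pair P λ u → f (v ∙ (u ∙ z)))
      ≈⟨ pair-cong Q (λ v → pair-cong P λ u → f-cong
           (M.trans (M.sym (M.assoc v u z)) (M.trans (M.∙-congʳ (M.comm v u)) (M.assoc u v z)))) ⟩
    pair Q (λ v → pair P λ u → f (u ∙ (v ∙ z)))   ≈⟨ act-⊛ Q P z ⟨
    pair (Q ⊛ P) (λ u → f (u ∙ z))                ∎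

  ≋-trans : ∀ {P Q T} → P ≋ Q → Q ≋ T → P ≋ T
  ≋-trans (mk h) (mk k) = mk λ z → R.trans (h z) (k z)

  -- Equality is tested on all translates of `f`, so it may be used at `u ∙ z`; this is the fact
  -- that an annihilator is an ideal.
  ⊛-congˡ : ∀ P {Q Q′} → Q ≋ Q′ → P ⊛ Q ≋ P ⊛ Q′
  ⊛-congˡ P {Q} {Q′} (mk h) = mk λ z →
    R.trans (act-⊛ P Q z) (R.trans (pair-cong P λ u → h (u ∙ z)) (R.sym (act-⊛ P Q′ z)))

  ⊛-cong : ∀ {P P′ Q Q′} → P ≋ P′ → Q ≋ Q′ → P ⊛ Q ≋ P′ ⊛ Q′
  ⊛-cong {P} {P′} {Q} {Q′} h k =
    ≋-trans (⊛-congˡ P k) (≋-trans (⊛-comm P Q′) (≋-trans (⊛-congˡ Q′ h) (⊛-comm Q′ P′)))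

  ⊛-assoc : ∀ P Q T → (P ⊛ Q) ⊛ T ≋ P ⊛ (Q ⊛ T)
  ⊛-assoc P Q T = mk λ z → begin
    pair ((P ⊛ Q) ⊛ T) (λ u → f (u ∙ z))
      ≈⟨ act-⊛ (P ⊛ Q) T z ⟩
    pair (P ⊛ Q) (λ u → pair T λ w → f (w ∙ (u ∙ z)))
      ≈⟨ pair-convolve _∙_ P Q _ ⟩
    pair P (λ u → pair Q λ v → pair T λ w → f (w ∙ ((u ∙ v) ∙ z)))
      ≈⟨ pair-cong P (λ u → pair-cong Q λ v → pair-cong T λ w →
           f-cong (M.∙-congˡ (M.trans (M.∙-congʳ (M.comm u v)) (M.assoc v u z)))) ⟩
    pair P (λ u → pair Q λ v → pair T λ w → f (w ∙ (v ∙ (u ∙ z))))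
      ≈⟨ pair-cong P (λ u → act-⊛ Q T (u ∙ z)) ⟨
    pair P (λ u → pair (Q ⊛ T) λ v → f (v ∙ (u ∙ z)))
      ≈⟨ act-⊛ P (Q ⊛ T) z ⟨
    pair (P ⊛ (Q ⊛ T)) (λ u → f (u ∙ z)) ∎

  one : Op
  one = (1# , ε) ∷ []

  ⊛-identityˡ : ∀ P → one ⊛ P ≋ P
  ⊛-identityˡ P = mk λ z → begin
    pair (one ⊛ P) (λ u → f (u ∙ z))    ≈⟨ act-⊛ one P z ⟩
    pair one (λ u → pair P λ v → f (v ∙ (u ∙ z)))
      ≈⟨ pair-single 1# ε (λ u → pair P λ v → f (v ∙ (u ∙ z))) ⟩
    1# * pair P (λ v → f (v ∙ (ε ∙ z)))
      ≈⟨ R.trans (R.*-identityˡ _) (pair-cong P λ v → f-cong (M.∙-congˡ (M.identityˡ z))) ⟩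
    pair P (λ u → f (u ∙ z))            ∎

  ⊛-distribˡ : ∀ P Q T → P ⊛ (Q ++ T) ≋ (P ⊛ Q) ++ (P ⊛ T)
  ⊛-distribˡ P Q T = mk λ z → begin
    pair (P ⊛ (Q ++ T)) (λ u → f (u ∙ z))
      ≈⟨ R.trans (act-⊛ P (Q ++ T) z) (pair-cong P λ u → pair-++ Q T _) ⟩
    pair P (λ u → pair Q (λ v → f (v ∙ (u ∙ z))) + pair T λ v → f (v ∙ (u ∙ z)))
      ≈⟨ R.trans (Sums.sum-cong R P λ x → R.distribˡ _ _ _) (Sums.sum-+ R P _ _) ⟩
    pair P (λ u → pair Q λ v → f (v ∙ (u ∙ z))) + pair P (λ u → pair T λ v → f (v ∙ (u ∙ z)))
      ≈⟨ R.+-cong (act-⊛ P Q z) (act-⊛ P T z) ⟨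
    pair (P ⊛ Q) (λ u → f (u ∙ z)) + pair (P ⊛ T) (λ u → f (u ∙ z))
      ≈⟨ pair-++ (P ⊛ Q) (P ⊛ T) _ ⟨
    pair ((P ⊛ Q) ++ (P ⊛ T)) (λ u → f (u ∙ z)) ∎

  ++-cong : ∀ {P P′ Q Q′} → P ≋ P′ → Q ≋ Q′ → P ++ Q ≋ P′ ++ Q′
  ++-cong {P} {P′} {Q} {Q′} (mk h) (mk k) = mk λ z →
    R.trans (pair-++ P Q _) (R.trans (R.+-cong (h z) (k z)) (R.sym (pair-++ P′ Q′ _)))

  ++-comm : ∀ P Q → P ++ Q ≋ Q ++ P
  ++-comm P Q = mk λ z → R.trans (pair-++ P Q _) (R.trans (R.+-comm _ _) (R.sym (pair-++ Q P _)))

  negate-cong : ∀ {P Q} → P ≋ Q → negate P ≋ negate Q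
  negate-cong {P} {Q} (mk h) = mk λ z →
    R.trans (pair-neg P _) (R.trans (R.-‿cong (h z)) (R.sym (pair-neg Q _)))

  negate-inverseˡ : ∀ P → negate P ++ P ≋ []
  negate-inverseˡ P = mk λ z →
    R.trans (pair-++ (negate P) P _) (R.trans (R.+-congʳ (pair-neg P _)) (R.-‿inverseˡ _))

  ≋-reflexive : ∀ {P Q} → P ≡ Q → P ≋ Q
  ≋-reflexive ≡.refl = mk λ z → R.refl

  operatorRing : CommutativeRing (c ⊔ m) (c ⊔ m ⊔ ℓ)
  operatorRing = record
    { Carrier = Op ; _≈_ = _≋_ ; _+_ = _++_ ; _*_ = _⊛_ ; -_ = negate ; 0# = [] ; 1# = one
    ; isCommutativeRing = record
      { isRing = record
        { +-isAbelianGroup = record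
          { isGroup = record
            { isMonoid = record
              { isSemigroup = record
                { isMagma = record
                  { isEquivalence = record
                    { refl = mk λ z → R.refl
                    ; sym = λ (mk h) → mk λ z → R.sym (h z)
                    ; trans = ≋-trans }
                  ; ∙-cong = ++-cong }
                ; assoc = λ P Q T → ≋-reflexive (++-assoc P Q T) }
              ; identity = (λ P → ≋-reflexive ≡.refl) , λ P → ++-comm P [] }
            ; inverse = negate-inverseˡ ,
                        λ P → ≋-trans (++-comm P (negate P)) (negate-inverseˡ P)
            ; ⁻¹-cong = negate-cong }
          ; comm = ++-comm }
        ; *-cong = ⊛-cong
        ; *-assoc = ⊛-assoc
        ; *-identity = ⊛-identityˡ , λ P → ≋-trans (⊛-comm P one) (⊛-identityˡ P)
        ; distrib = ⊛-distribˡ , λ P Q T →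
            ≋-trans (⊛-comm (Q ++ T) P)
              (≋-trans (⊛-distribˡ P Q T) (++-cong (⊛-comm P Q) (⊛-comm P T))) }
      ; *-comm = ⊛-comm } }

-- Finite fields

module _ {c₁ ℓ₁ c₂ ℓ₂} (R : CommutativeRing c₁ ℓ₁) (S : CommutativeRing c₂ ℓ₂) where
  private
    module R = CommutativeRing R
    module S = CommutativeRing S
  open SetoidReasoning S.setoid

  ringHomomorphism : (f : R.Carrier → S.Carrier) →
                     (∀ {x y} → x R.≈ y → f x S.≈ f y) →
                     (∀ x y → f (x R.+ y) S.≈ f x S.+ f y) →
                     (∀ x y → f (x R.* y) S.≈ f x S.* f y) →
                     f R.1# S.≈ S.1# → IsRingHomomorphism R S f
  ringHomomorphism f f-cong f-+ f-* f-1 = record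
    { isSemiringHomomorphism = record
      { isNearSemiringHomomorphism = record
        { +-isMonoidHomomorphism = record
          { isMagmaHomomorphism = record
            { isRelHomomorphism = record { cong = f-cong }
            ; homo = f-+ }
          ; ε-homo = f-0 }
        ; *-homo = f-* }
      ; 1#-homo = f-1 }
    ; -‿homo = λ x → uniqueˡ-⁻¹ (f (R.- x)) (f x)
        (S.trans (S.sym (f-+ _ _)) (S.trans (f-cong (R.-‿inverseˡ x)) f-0)) }
    where
    open RingProperties S.ring using () renaming (+-cancelˡ to S-cancelˡ)
    open import Algebra.Properties.Group S.+-group using () renaming (inverseˡ-unique to uniqueˡ-⁻¹)
    f-0 : f R.0# S.≈ S.0#
    f-0 = S-cancelˡ (f R.0#) _ _ (begin
      f R.0# S.+ f R.0#   ≈⟨ f-+ R.0# R.0# ⟨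
      f (R.0# R.+ R.0#)   ≈⟨ f-cong (R.+-identityˡ R.0#) ⟩
      f R.0#              ≈⟨ S.+-identityʳ _ ⟨
      f R.0# S.+ S.0#     ∎)

-- A commutative monoid covers both uses: sums over the units in an arbitrary ring, and the product
-- of all units in `unit^[N-1]≈1`. Without a second operation, `guard` takes the place of
-- multiplication by a bracket.
module Folds {c ℓ} (M : CommutativeMonoid c ℓ) where
  open CommutativeMonoid M

  fold : ∀ {a} {X : Set a} → List X → (X → Carrier) → Carrier
  fold xs f = List.foldr _∙_ ε (map f xs)

  guard : ∀ {p} {P : Set p} → Dec P → Carrier → Carrier
  guard (yes _) x = x
  guard (no _)  x = ε

  guard-cong : ∀ {p q} {P : Set p} {Q : Set q} (d : Dec P) (e : Dec Q) {x y : Carrier} →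
               (P → Q) → (Q → P) → x ≈ y → guard d x ≈ guard e y
  guard-cong (yes p) (yes q) f g eq = eq
  guard-cong (yes p) (no ¬q) f g eq = contradiction (f p) ¬q
  guard-cong (no ¬p) (yes q) f g eq = contradiction (g q) ¬p
  guard-cong (no ¬p) (no ¬q) f g eq = refl

  fold-cong : ∀ {a} {X : Set a} (xs : List X) {f g : X → Carrier} →
              (∀ x → f x ≈ g x) → fold xs f ≈ fold xs g
  fold-cong []       eq = refl
  fold-cong (x ∷ xs) eq = ∙-cong (eq x) (fold-cong xs eq)

  fold-filter : ∀ {a p} {X : Set a} {P : Pred X p} (P? : Decidable P) (xs : List X) (f : X → Carrier) →
                fold (filter P? xs) f ≈ fold xs (λ x → guard (P? x) (f x))
  fold-filter P? []       f = refl
  fold-filter P? (x ∷ xs) f with P? x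
  ... | yes _ = ∙-congˡ (fold-filter P? xs f)
  ... | no _  = trans (fold-filter P? xs f) (sym (identityˡ _))

  open FinSum M using (sum)

  fold-allFin : ∀ {a} {X : Set a} n (h : Fin n → X) (f : X → Carrier) →
                fold (map h (allFin n)) f ≈ sum (f ∘ h)
  fold-allFin n h f = trans (reflexive (≡.cong (λ ys → fold ys f) (List.map-tabulate id h))) (go n h)
    where
    go : ∀ n (h : Fin n → _) → fold (List.tabulate h) f ≈ sum (f ∘ h)
    go zero    h = refl
    go (suc n) h = ∙-congˡ (go n (h ∘ Fin.suc))

module FiniteFieldProperties {c ℓ N} (K : FiniteField c ℓ N) where
  open FiniteField K hiding (zero)
  open SetoidReasoning setoid
  open Exp commutativeSemiring
  open RingProperties ring using (x≈y⇒x∙y⁻¹≈ε; x∙y⁻¹≈ε⇒x≈y; -‿distribʳ-*)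

  private
    to   = Inverse.to finite
    from = Inverse.from finite

  from-to : ∀ x → from (to x) ≈ x
  from-to x = Inverse.inverseʳ finite ≡.refl

  to-from : ∀ i → to (from i) ≡ i
  to-from i = Inverse.inverseˡ finite refl

  elements : List Carrier
  elements = map from (allFin N)

  *-≉0-cancelˡ : ∀ {x y} → x ≉ 0# → x * y ≈ 0# → y ≈ 0#
  *-≉0-cancelˡ {x} {y} x≉0 xy≈0 = let z , xz≈1 = inverse x x≉0 in begin
    y             ≈⟨ *-identityˡ y ⟨
    1# * y        ≈⟨ *-congʳ (trans (*-comm z x) xz≈1) ⟨
    z * x * y     ≈⟨ *-assoc z x y ⟩
    z * (x * y)   ≈⟨ *-congˡ xy≈0 ⟩
    z * 0#        ≈⟨ zeroʳ z ⟩
    0#            ∎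

  *-cancelˡ-≉0 : ∀ {x y z} → x ≉ 0# → x * y ≈ x * z → y ≈ z
  *-cancelˡ-≉0 {x} {y} {z} x≉0 eq = x∙y⁻¹≈ε⇒x≈y y z (*-≉0-cancelˡ x≉0 (begin
    x * (y - z)        ≈⟨ distribˡ x y (- z) ⟩
    x * y + x * - z    ≈⟨ +-congˡ (-‿distribʳ-* x z) ⟨
    x * y - x * z      ≈⟨ x≈y⇒x∙y⁻¹≈ε eq ⟩
    0#                 ∎))

  *-≉0 : ∀ {x y} → x ≉ 0# → y ≉ 0# → x * y ≉ 0#
  *-≉0 x≉0 y≉0 = y≉0 ∘ *-≉0-cancelˡ x≉0

  ^-≉0 : ∀ {x} k → x ≉ 0# → x ^ k ≉ 0#
  ^-≉0 zero    x≉0 = 1≉0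
  ^-≉0 (suc k) x≉0 = *-≉0 x≉0 (^-≉0 k x≉0)

  units-≉0 : All (_≉ 0#) units
  units-≉0 = All.all-filter (λ x → ¬? (x ≈? 0#)) elements

  elements-distinct : AllPairs _≉_ elements
  elements-distinct = AllPairs.map⁺ (AllPairs.map
    (λ i≢j eq → i≢j (≡.trans (≡.sym (to-from _)) (≡.trans (Inverse.to-cong finite eq) (to-from _))))
    (allFin⁺ N))

  private
    zero-∈ : Any (_≈ 0#) elements
    zero-∈ = Any.map⁺ (lose (∈-allFin (to 0#)) (from-to 0#))

    nonzero? : Decidable (_≉ 0#)
    nonzero? x = ¬? (x ≈? 0#)

    length-nonzero : ∀ {xs} → AllPairs _≉_ xs → Any (_≈ 0#) xs →
                     suc (length (filter nonzero? xs)) ≡ length xs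
    length-nonzero {x ∷ xs} (x≉xs ∷ _) (here x≈0) = ≡.cong (suc ∘ length) (≡.trans
      (List.filter-reject nonzero? (contradiction x≈0))
      (List.filter-all nonzero? (All.map (λ x≉y y≈0 → x≉y (trans x≈0 (sym y≈0))) x≉xs)))
    length-nonzero {x ∷ xs} (x≉xs ∷ distinct) (there any) with y , y∈ , y≈0 ← find any =
      ≡.trans (≡.cong (suc ∘ length) (List.filter-accept nonzero?
          λ x≈0 → All.lookup x≉xs y∈ (trans x≈0 (sym y≈0))))
        (≡.cong suc (length-nonzero distinct any))

  units-distinct : AllPairs _≉_ units
  units-distinct = AllPairs.filter⁺ _ elements-distinct

  length-elements : length elements ≡ N
  length-elements = ≡.trans (List.length-map from (allFin N)) (List.length-tabulate id)

  suc-length-units : suc (length units) ≡ N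
  suc-length-units = ≡.trans (length-nonzero elements-distinct zero-∈) length-elements

  length-units : length units ≡ N ∸ 1
  length-units = ≡.cong (_∸ 1) suc-length-units

  module _ {m ℓm} (M : CommutativeMonoid m ℓm) where
    private module M = CommutativeMonoid M
    open Folds M
    open FinSum M using (sum-permute; sum-cong-≋)

    private
      scale : ∀ u v → u * v ≈ 1# → (i : Fin N) → to (u * from (to (v * from i))) ≡ i
      scale u v uv≈1 i = ≡.trans (Inverse.to-cong finite (begin
        u * from (to (v * from i))   ≈⟨ *-congˡ (from-to _) ⟩
        u * (v * from i)             ≈⟨ *-assoc u v _ ⟨
        u * v * from i               ≈⟨ *-congʳ uv≈1 ⟩
        1# * from i                  ≈⟨ *-identityˡ _ ⟩
        from i                       ∎)) (to-from i)

      scaling : ∀ u v → u * v ≈ 1# → Permutation N N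
      scaling u v uv≈1 = permutation (λ i → to (u * from i)) (λ i → to (v * from i))
        (scale u v uv≈1) (scale v u (trans (*-comm v u) uv≈1))

    -- Multiplication by a unit permutes the field. The permutation is formed on the indices
    -- `Fin N`, where equality is propositional.
    fold-elements-scale : ∀ {f : Carrier → M.Carrier} → (∀ {x y} → x ≈ y → f x M.≈ f y) →
                          ∀ {u} → u ≉ 0# → fold elements (λ x → f (u * x)) M.≈ fold elements f
    fold-elements-scale {f} f-cong {u} u≉0 with v , uv≈1 ← inverse u u≉0 =
      M.trans (fold-allFin N from _)
        (M.trans (sum-cong-≋ {N} λ i → f-cong (sym (from-to (u * from i))))
          (M.trans (M.sym (sum-permute (f ∘ from) (scaling u v uv≈1))) (M.sym (fold-allFin N from f))))

    fold-units-scale : ∀ {f : Carrier → M.Carrier} → (∀ {x y} → x ≈ y → f x M.≈ f y) →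
                       ∀ {u} → u ≉ 0# → fold units (λ x → f (u * x)) M.≈ fold units f
    fold-units-scale {f} f-cong {u} u≉0 =
      M.trans (fold-filter _ elements _) (M.trans (fold-cong elements λ x →
          guard-cong (¬? (x ≈? 0#)) (¬? ((u * x) ≈? 0#))
            (*-≉0 u≉0) (λ ux≉0 x≈0 → ux≉0 (trans (*-congˡ x≈0) (zeroʳ u))) M.refl)
        (M.trans (fold-elements-scale
            (λ {x} {y} eq → guard-cong (¬? (x ≈? 0#)) (¬? (y ≈? 0#))
              (λ x≉0 → x≉0 ∘ trans eq) (λ y≉0 → y≉0 ∘ trans (sym eq)) (f-cong eq)) u≉0)
          (M.sym (fold-filter _ elements f))))

  -- Scaling by `u` permutes the units, so their product does not change when it is multiplied by
  -- one factor `u` for each of them; that product is cancelled.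
  unit^[N-1]≈1 : ∀ {u} → u ≉ 0# → u ^ (N ∸ 1) ≈ 1#
  unit^[N-1]≈1 {u} u≉0 = *-cancelˡ-≉0 (product-≉0 units-≉0) (begin
    product units * u ^ (N ∸ 1)        ≡⟨ ≡.cong (λ k → product units * u ^ k) length-units ⟨
    product units * u ^ length units   ≈⟨ scaled units ⟨
    fold units (u *_)                  ≈⟨ fold-units-scale *-commutativeMonoid id u≉0 ⟩
    product units                      ≈⟨ *-identityʳ _ ⟨
    product units * 1#                 ∎)
    where
    open Folds *-commutativeMonoid
    open import Algebra.Properties.CommutativeSemigroup *-commutativeSemigroup using (interchange)
    product : List Carrier → Carrier
    product xs = fold xs id
    product-≉0 : ∀ {xs} → All (_≉ 0#) xs → product xs ≉ 0#
    product-≉0 []         = 1≉0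
    product-≉0 (h ∷ hs) = *-≉0 h (product-≉0 hs)
    scaled : ∀ xs → fold xs (u *_) ≈ product xs * u ^ length xs
    scaled []       = sym (*-identityˡ 1#)
    scaled (x ∷ xs) = trans (*-cong (*-comm u x) (scaled xs)) (interchange x u _ _)

  instance
    N-nonZero : NonZero N
    N-nonZero = ≡.subst NonZero suc-length-units _

  suc[N-1]≡N : suc (N ∸ 1) ≡ N
  suc[N-1]≡N = ℕ.suc-pred N

  x^N≈x : ∀ x → x ^ N ≈ x
  x^N≈x x = trans (reflexive (≡.cong (x ^_) (≡.sym suc[N-1]≡N))) (lemma (x ≈? 0#))
    where
    lemma : Dec (x ≈ 0#) → x ^ suc (N ∸ 1) ≈ x
    lemma (yes x≈0) = trans (*-congʳ x≈0) (trans (zeroˡ _) (sym x≈0))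
    lemma (no x≉0)  = trans (*-congˡ (unit^[N-1]≈1 x≉0)) (*-identityʳ x)

  -- The monic polynomial xᵏ + ∑ cᵢ xⁱ of degree k, in Horner form.
  horner : ∀ {k} → Vec Carrier k → Carrier → Carrier
  horner []       x = 1#
  horner (c ∷ cs) x = c + x * horner cs x

  private
    -- Synthetic division: the monic quotient on division by x - a, with remainder `horner cs a`.
    deflate : ∀ {k} → Vec Carrier (suc k) → Carrier → Vec Carrier k
    deflate (c ∷ [])     a = []
    deflate (c ∷ d ∷ ds) a = horner (d ∷ ds) a ∷ deflate (d ∷ ds) a

    open FromInteger.Solver commutativeRing using (solve; _:=_; _:+_; _:*_; _:-_)

    deflate-eval : ∀ {k} (cs : Vec Carrier (suc k)) a x →
                   horner cs x - horner cs a ≈ (x - a) * horner (deflate cs a) x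
    deflate-eval (c ∷ [])     a x =
      trans (solve 4 (λ c a x z → (c :+ x :* z) :- (c :+ a :* z) := (x :- a) :* z) refl c a x 1#) refl
    deflate-eval (c ∷ d ∷ ds) a x = begin
      (c + x * h x) - (c + a * h a)
        ≈⟨ solve 5 (λ c a x hx ha → (c :+ x :* hx) :- (c :+ a :* ha)
                                   := x :* (hx :- ha) :+ (x :- a) :* ha) refl c a x (h x) (h a) ⟩
      x * (h x - h a) + (x - a) * h a
        ≈⟨ +-congʳ (*-congˡ (deflate-eval (d ∷ ds) a x)) ⟩
      x * ((x - a) * horner (deflate (d ∷ ds) a) x) + (x - a) * h a
        ≈⟨ solve 4 (λ a x q ha → x :* ((x :- a) :* q) :+ (x :- a) :* ha
                               := (x :- a) :* (ha :+ x :* q)) refl a x _ (h a) ⟩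
      (x - a) * (h a + x * horner (deflate (d ∷ ds) a) x) ∎
      where h = horner (d ∷ ds)

  -- Splitting off x - a lowers the degree by one, and every other root stays a root of the quotient
  -- because x - a is a nonzero factor there.
  roots-bound : ∀ {k} (cs : Vec Carrier k) {xs : List Carrier} →
                AllPairs _≉_ xs → All (λ x → horner cs x ≈ 0#) xs → length xs ≤ k
  roots-bound cs {[]} _ _ = ℕ.z≤n
  roots-bound [] {x ∷ xs} _ (1≈0 ∷ _) = contradiction 1≈0 1≉0
  roots-bound (c ∷ cs) {a ∷ xs} (a≉xs ∷ distinct) (a-root ∷ roots) =
    ℕ.s≤s (roots-bound (deflate (c ∷ cs) a) distinct (All.zipWith step (a≉xs , roots)))
    where
    step : ∀ {x} → a ≉ x × horner (c ∷ cs) x ≈ 0# → horner (deflate (c ∷ cs) a) x ≈ 0#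
    step {x} (a≉x , x-root) = *-≉0-cancelˡ (λ x-a≈0 → a≉x (sym (x∙y⁻¹≈ε⇒x≈y x a x-a≈0))) (begin
      (x - a) * horner (deflate (c ∷ cs) a) x   ≈⟨ deflate-eval (c ∷ cs) a x ⟨
      horner (c ∷ cs) x - horner (c ∷ cs) a     ≈⟨ x≈y⇒x∙y⁻¹≈ε (trans x-root (sym a-root)) ⟩
      0#                                        ∎)

  private
    horner-0 : ∀ k x → horner (Vec.replicate k 0#) x ≈ x ^ k
    horner-0 zero    x = refl
    horner-0 (suc k) x = trans (+-identityˡ _) (*-congˡ (horner-0 k x))

  -- Otherwise all N - 1 units would be roots of xᵏ⁺¹ - 1, whose degree is smaller. This does the
  -- work of a generator of the unit group.
  exists-^≉1 : ∀ {k} → suc k < N ∸ 1 → ∃ λ g → g ≉ 0# × g ^ suc k ≉ 1#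
  exists-^≉1 {k} k<N-1 with any? (λ x → ¬? ((x ^ suc k) ≈? 1#)) units
  ... | yes any = let g , g∈ , g^≉1 = find any in g , All.lookup units-≉0 g∈ , g^≉1
  ... | no ¬any = contradiction
      (roots-bound (- 1# ∷ Vec.replicate k 0#) units-distinct (All.tabulate root))
      (ℕ.<⇒≱ (≡.subst (suc k <_) (≡.sym length-units) k<N-1))
    where
    root : ∀ {x} → x ∈ units → horner (- 1# ∷ Vec.replicate k 0#) x ≈ 0#
    root {x} x∈ = begin
      - 1# + x * horner (Vec.replicate k 0#) x   ≈⟨ +-congˡ (*-congˡ (horner-0 k x)) ⟩
      - 1# + x ^ suc k
        ≈⟨ +-congˡ (decidable-stable ((x ^ suc k) ≈? 1#) λ x^≉1 → ¬any (lose x∈ x^≉1)) ⟩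
      - 1# + 1#                                  ≈⟨ -‿inverseˡ 1# ⟩
      0#                                         ∎

  -- The fixed points are roots of x^q - x; `1 < q` keeps its linear coefficient -1 apart from the
  -- leading one, so that it is monic of degree q.
  ^-fixed-bound : ∀ {q} → 1 < q → {xs : List Carrier} → AllPairs _≉_ xs →
                  All (λ x → x ^ q ≈ x) xs → length xs ≤ q
  ^-fixed-bound {suc zero} (ℕ.s≤s ())
  ^-fixed-bound {suc (suc k)} _ distinct fixed =
    roots-bound (0# ∷ - 1# ∷ Vec.replicate k 0#) distinct (All.map (λ {x} → root x) fixed)
    where
    root : ∀ x → x ^ suc (suc k) ≈ x → horner (0# ∷ - 1# ∷ Vec.replicate k 0#) x ≈ 0#
    root x fix = begin
      0# + x * (- 1# + x * horner (Vec.replicate k 0#) x)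
        ≈⟨ +-congˡ (*-congˡ (+-congˡ (*-congˡ (horner-0 k x)))) ⟩
      0# + x * (- 1# + x ^ suc k)
        ≈⟨ +-identityˡ _ ⟩
      x * (- 1# + x ^ suc k)               ≈⟨ distribˡ _ _ _ ⟩
      x * - 1# + x ^ suc (suc k)           ≈⟨ +-cong (trans (sym (-‿distribʳ-* x 1#)) (-‿cong (*-identityʳ x))) fix ⟩
      - x + x                              ≈⟨ -‿inverseˡ x ⟩
      0#                                   ∎

-- Binomial coefficients and the Frobenius map in characteristic p

prime∣!⇒≤ : ∀ {p} → Prime p → ∀ n → p ∣ n ! → p ≤ n
prime∣!⇒≤ pr zero    p∣1 =
  contradiction (ℕ.∣1⇒≡1 p∣1) (ℕ.nonTrivial⇒≢1 {{prime⇒nonTrivial pr}})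
prime∣!⇒≤ pr (suc n) p∣ with euclidsLemma (suc n) (n !) pr p∣
... | inj₁ p∣1+n = ℕ.∣⇒≤ p∣1+n
... | inj₂ p∣n!  = ℕ.m≤n⇒m≤1+n (prime∣!⇒≤ pr n p∣n!)

-- The prime divides p! = (p C k) · k! · (p - k)!, but neither of the two factorials, whose
-- arguments are below p.
prime∣C : ∀ {p k} → Prime p → 0 < k → k < p → p ∣ p C k
prime∣C {p@(suc p-1)} {k} pr 0<k k<p with euclidsLemma (p C k) (k ! ℕ.* (p ∸ k) !) pr p∣C*
  where
  instance _ = k ℕ.!* (p ∸ k) !≢0
  p∣C* : p ∣ (p C k) ℕ.* (k ! ℕ.* (p ∸ k) !)
  p∣C* = ≡.subst (p ∣_) (≡.sym (≡.trans
      (≡.cong (ℕ._* (k ! ℕ.* (p ∸ k) !)) (nCk≡n!/k![n-k]! (ℕ.<⇒≤ k<p)))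
      (m/n*n≡m (k![n∸k]!∣n! (ℕ.<⇒≤ k<p)))))
    (ℕ.m∣m*n (p-1 !))
... | inj₁ p∣C = p∣C
... | inj₂ p∣!! with euclidsLemma (k !) ((p ∸ k) !) pr p∣!!
...   | inj₁ p∣k!  = contradiction (prime∣!⇒≤ pr k p∣k!) (ℕ.<⇒≱ k<p)
...   | inj₂ p∣-k! = contradiction (prime∣!⇒≤ pr (p ∸ k) p∣-k!) (ℕ.<⇒≱ (ℕ.∸-monoʳ-< 0<k (ℕ.<⇒≤ k<p)))

module Characteristic {c ℓ} (R : CommutativeRing c ℓ) {p : ℕ} (p-prime : Prime p)
                      (p≈0 : CommutativeRing._≈_ R (fromℕ R p) (CommutativeRing.0# R)) where
  open CommutativeRing R hiding (zero)
  open SetoidReasoning setoid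
  open Exp commutativeSemiring
  open Mult semiring renaming (_×_ to _×ₙ_)

  multiple≈0 : ∀ {n} → p ∣ n → ∀ x → n ×ₙ x ≈ 0#
  multiple≈0 {n} (divides q ≡.refl) x = begin
    (q ℕ.* p) ×ₙ x             ≈⟨ ×-congʳ (q ℕ.* p) (*-identityˡ x) ⟨
    (q ℕ.* p) ×ₙ (1# * x)      ≈⟨ ×-assocˡ (1# * x) q p ⟨
    q ×ₙ (p ×ₙ (1# * x))       ≈⟨ ×-congʳ q (×-assoc-* p 1# x) ⟨
    q ×ₙ ((p ×ₙ 1#) * x)       ≈⟨ ×-congʳ q (trans (*-congʳ p≈0) (zeroˡ x)) ⟩
    -- Rewriting 0 as `0# * 0#` lets one factor leave the multiple, which is thereby zero.
    q ×ₙ 0#                    ≈⟨ ×-congʳ q (zeroˡ 0#) ⟨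
    q ×ₙ (0# * 0#)             ≈⟨ ×-comm-* q 0# 0# ⟨
    0# * (q ×ₙ 0#)             ≈⟨ zeroˡ _ ⟩
    0#                         ∎

  freshman : ∀ x y → (x + y) ^ p ≈ x ^ p + y ^ p
  freshman x y = lemma p ≡.refl
    where
    open FinSum +-commutativeMonoid using (sum; sum-init-last; sum-cong-≋; sum-replicate-zero)
    term : Fin (suc p) → Carrier
    term = Binomial.binomialTerm commutativeSemiring x y p

    outer : ∀ k → k ≡ p → (p C k) ×ₙ (x ^ k * y ^ (p ∸ k)) ≈ x ^ p
    outer k ≡.refl = begin
      (p C p) ×ₙ (x ^ p * y ^ (p ∸ p))   ≡⟨ ≡.cong₂ (λ i j → i ×ₙ (x ^ p * y ^ j)) (nCn≡1 p) (ℕ.n∸n≡0 p) ⟩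
      1 ×ₙ (x ^ p * 1#)                  ≈⟨ trans (×-homo-1 _) (*-identityʳ _) ⟩
      x ^ p                              ∎

    -- Exposing `p` as a successor splits the binomial sum into first, inner and last terms; the
    -- inner coefficients are divisible by p.
    lemma : ∀ k → k ≡ p → (x + y) ^ p ≈ x ^ p + y ^ p
    lemma zero    0≡p = contradiction (≡.sym 0≡p) (ℕ.≢-nonZero⁻¹ p {{prime⇒nonZero p-prime}})
    lemma (suc k) ≡.refl = begin
      (x + y) ^ p
        ≈⟨ Binomial.theorem commutativeSemiring p x y ⟩
      sum term
        ≈⟨ +-cong (trans (×-homo-1 _) (*-identityˡ _)) (sum-init-last (term ∘ Fin.suc)) ⟩
      y ^ p + (sum (λ i → term (Fin.suc (inject₁ i))) + term (Fin.suc (Fin.fromℕ k)))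
        ≈⟨ +-congˡ (+-cong
             (trans (sum-cong-≋ {k} λ i → multiple≈0
                 (prime∣C p-prime (ℕ.s≤s ℕ.z≤n)
                   (ℕ.s≤s (≡.subst (_< k) (≡.sym (Fin.toℕ-inject₁ i)) (Fin.toℕ<n i)))) _)
               (sum-replicate-zero k))
             (outer (suc (toℕ (Fin.fromℕ k))) (≡.cong suc (Fin.toℕ-fromℕ k)))) ⟩
      y ^ p + (0# + x ^ p)
        ≈⟨ trans (+-congˡ (+-identityˡ _)) (+-comm _ _) ⟩
      x ^ p + y ^ p ∎

  1^ : ∀ k → 1# ^ k ≈ 1#
  1^ zero    = refl
  1^ (suc k) = trans (*-identityˡ _) (1^ k)

  frobenius-isRingHom : ∀ i → IsRingHomomorphism R R (_^ (p ℕ.^ i))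
  frobenius-isRingHom i = ringHomomorphism R R _ (^-congˡ (p ℕ.^ i)) (additive i)
    (λ x y → ^-distrib-* x y (p ℕ.^ i)) (1^ (p ℕ.^ i))
    where
    additive : ∀ i x y → (x + y) ^ (p ℕ.^ i) ≈ x ^ (p ℕ.^ i) + y ^ (p ℕ.^ i)
    additive zero    x y = trans (*-identityʳ _) (sym (+-cong (*-identityʳ x) (*-identityʳ y)))
    additive (suc i) x y = begin
      (x + y) ^ (p ℕ.* p ℕ.^ i)                         ≈⟨ ^-assocʳ (x + y) p (p ℕ.^ i) ⟨
      ((x + y) ^ p) ^ (p ℕ.^ i)                         ≈⟨ ^-congˡ (p ℕ.^ i) (freshman x y) ⟩
      (x ^ p + y ^ p) ^ (p ℕ.^ i)                       ≈⟨ additive i _ _ ⟩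
      (x ^ p) ^ (p ℕ.^ i) + (y ^ p) ^ (p ℕ.^ i)         ≈⟨ +-cong (^-assocʳ x p _) (^-assocʳ y p _) ⟩
      x ^ (p ℕ.* p ℕ.^ i) + y ^ (p ℕ.* p ℕ.^ i)         ∎

-- The last hypothesis makes t(g) - 1 invertible for g ≠ 0, 1, as it is for a
-- Teichmüller character.
module PowerSums {c ℓ N} (K : FiniteField c ℓ N) {s ℓs} (S : CommutativeRing s ℓs)
                 (t : FiniteField.Carrier K → ⟨ S ⟩)
                 (t-cong : ∀ {x y} → FiniteField._≈_ K x y → CommutativeRing._≈_ S (t x) (t y))
                 (t-* : ∀ x y → CommutativeRing._≈_ S (t (FiniteField._*_ K x y))
                                                      (CommutativeRing._*_ S (t x) (t y)))
                 (t-1 : CommutativeRing._≈_ S (t (FiniteField.1# K)) (CommutativeRing.1# S))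
                 (t-inv : ∀ g → ¬ FiniteField._≈_ K g (FiniteField.1# K) → ∃ λ z →
                    CommutativeRing._≈_ S
                      (CommutativeRing._*_ S z (CommutativeRing._-_ S (t g) (CommutativeRing.1# S)))
                      (CommutativeRing.1# S)) where
  private
    module K = FiniteField K
    module Kˣ = Exp K.commutativeSemiring
  open CommutativeRing S hiding (zero)
  open FiniteFieldProperties K
  open K using (units; _≉_)
  open SetoidReasoning setoid
  open Exp commutativeSemiring
  open RingProperties ring using (-‿distribˡ-*)
  open Sums S

  t-^ : ∀ x k → t (x Kˣ.^ k) ≈ t x ^ k
  t-^ x zero    = t-1
  t-^ x (suc k) = trans (t-* x _) (*-congˡ (t-^ x k))

  private
    instance
      N-1-nonZero : NonZero (N ∸ 1)
      N-1-nonZero = K.q-1-nonZero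

    unit^-≈1 : ∀ {u} k → u K.≉ K.0# → (N ∸ 1) ∣ k → u Kˣ.^ k K.≈ K.1#
    unit^-≈1 {u} k u≉0 (divides q ≡.refl) = K.trans (Kˣ.^-congʳ u (ℕ.*-comm q (N ∸ 1)))
      (K.trans (K.sym (Kˣ.^-assocʳ u (N ∸ 1) q))
        (K.trans (Kˣ.^-congˡ q (unit^[N-1]≈1 u≉0)) (one^ q)))
      where
      one^ : ∀ q → K.1# Kˣ.^ q K.≈ K.1#
      one^ zero    = K.refl
      one^ (suc q) = K.trans (K.*-identityˡ _) (one^ q)

    exists-nontrivial : ∀ k → (N ∸ 1) ∤ k → ∃ λ g → g K.≉ K.0# × g Kˣ.^ k K.≉ K.1#
    exists-nontrivial k N-1∤k with k % (N ∸ 1) in eq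
    ... | zero  = contradiction (ℕ.m%n≡0⇒n∣m k (N ∸ 1) eq) N-1∤k
    ... | suc j with g , g≉0 , g^≉1 ← exists-^≉1 {j} (≡.subst (_< N ∸ 1) eq (m%n<n k (N ∸ 1))) =
      g , g≉0 , λ g^k≈1 → g^≉1 (K.trans (K.sym (reduce-exponent g g≉0)) g^k≈1)
      where
      quotient = k / (N ∸ 1) ℕ.* (N ∸ 1)
      reduce-exponent : ∀ g → g K.≉ K.0# → g Kˣ.^ k K.≈ g Kˣ.^ suc j
      reduce-exponent g g≉0 = K.trans
        (Kˣ.^-congʳ g (≡.trans (m≡m%n+[m/n]*n k (N ∸ 1)) (≡.cong (ℕ._+ quotient) eq)))
        (K.trans (Kˣ.^-homo-* g (suc j) quotient)
          (K.trans (K.*-congˡ (unit^-≈1 quotient g≉0 (ℕ.n∣m*n (k / (N ∸ 1))))) (K.*-identityʳ _)))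

  -- If N - 1 does not divide k, some g has gᵏ ≠ 1. Translating the sum by g multiplies it by t(gᵏ),
  -- so it is annihilated by t(gᵏ) - 1. Since S may have zero divisors, this factor has to be
  -- invertible and not only nonzero.
  power-sum : ∀ k → sumOver S units (λ c → t c ^ k) ≈ [ (N ∸ 1) ℕ.∣? k ] * fromℕ S (N ∸ 1)
  power-sum k with (N ∸ 1) ℕ.∣? k
  ... | yes N-1∣k = begin
    sumOver S units (λ c → t c ^ k)
      ≈⟨ sum-cong-∈ units (λ {c} c∈ → trans (sym (t-^ c k))
           (trans (t-cong (unit^-≈1 k (All.lookup units-≉0 c∈) N-1∣k)) t-1)) ⟩
    sumOver S units (λ _ → 1#)           ≈⟨ sum-const units 1# ⟩
    fromℕ S (length units) * 1#          ≈⟨ *-comm _ _ ⟩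
    1# * fromℕ S (length units)          ≡⟨ ≡.cong (λ n → 1# * fromℕ S n) length-units ⟩
    1# * fromℕ S (N ∸ 1)                 ∎
  ... | no N-1∤k with g , g≉0 , g^k≉1 ← exists-nontrivial k N-1∤k
                 with z , z-inv ← t-inv (g Kˣ.^ k) g^k≉1 = begin
    total                                ≈⟨ *-identityˡ total ⟨
    1# * total                           ≈⟨ *-congʳ z-inv ⟨
    z * (t (g Kˣ.^ k) - 1#) * total      ≈⟨ *-assoc z _ total ⟩
    z * ((t (g Kˣ.^ k) - 1#) * total)    ≈⟨ *-congˡ (distribʳ total _ _) ⟩
    z * (t (g Kˣ.^ k) * total + - 1# * total)
      ≈⟨ *-congˡ (+-cong scaled (trans (sym (-‿distribˡ-* 1# total)) (-‿cong (*-identityˡ total)))) ⟩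
    z * (total - total)                  ≈⟨ *-congˡ (-‿inverseʳ total) ⟩
    z * 0#                               ≈⟨ zeroʳ z ⟩
    0#                                   ≈⟨ zeroˡ _ ⟨
    0# * fromℕ S (N ∸ 1)                 ∎
    where
    total = sumOver S units λ c → t c ^ k
    scaled : t (g Kˣ.^ k) * total ≈ total
    scaled = begin
      t (g Kˣ.^ k) * total                         ≈⟨ *-congʳ (t-^ g k) ⟩
      t g ^ k * total                              ≈⟨ sum-*ˡ _ units _ ⟩
      sumOver S units (λ c → t g ^ k * t c ^ k)
        ≈⟨ sum-cong units (λ c → trans (sym (^-distrib-* _ _ k)) (^-congˡ k (sym (t-* g c)))) ⟩
      sumOver S units (λ c → t (g K.* c) ^ k)
        ≈⟨ fold-units-scale +-commutativeMonoid (λ eq → ^-congˡ k (t-cong eq)) g≉0 ⟩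
      total                                        ∎

-- Truncated Witt vectors of the extension field

module Extension {c₁ ℓ₁ c₂ ℓ₂ c₃ ℓ₃} {p a : ℕ} (p-prime : Prime p)
                 (Fq : FiniteField c₁ ℓ₁ (p ℕ.^ a)) (Zq : WittVectors p Fq c₂ ℓ₂)
                 {r : ℕ} (1≤r : 1 ≤ r) (Fqʳ : FiniteField c₃ ℓ₃ ((p ℕ.^ a) ℕ.^ r))
                 {ι : FiniteField.Carrier Fq → FiniteField.Carrier Fqʳ}
                 (ι-hom : IsRingHomomorphism (FiniteField.commutativeRing Fq)
                                             (FiniteField.commutativeRing Fqʳ) ι) where
  q = p ℕ.^ a
  N = q ℕ.^ r
  module k = FiniteField Fq
  module K = FiniteField Fqʳ
  module R = WittVectors Zq
  module ι = RingMorphisms.IsRingHomomorphism ι-hom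
  module Kˣ = Exp K.commutativeSemiring
  module ΣK = Sums K.commutativeRing
  module ΣR = Sums R.commutativeRing
  open FiniteFieldProperties Fqʳ hiding (N-nonZero)
  private module kP = FiniteFieldProperties Fq
  open K using (units)

  instance
    p-nonZero : NonZero p
    p-nonZero = prime⇒nonZero p-prime

  ρ : R.Carrier → K.Carrier
  ρ = ι ∘ R.reduce

  ρ-hom : IsRingHomomorphism R.commutativeRing K.commutativeRing ρ
  ρ-hom = Composition.isRingHomomorphism K.trans R.reduce-isRingHom ι-hom

  module ρ = RingMorphisms.IsRingHomomorphism ρ-hom

  ι-injective₀ : ∀ {x} → ι x K.≈ K.0# → x k.≈ k.0#
  ι-injective₀ {x} ιx≈0 = decidable-stable (x k.≈? k.0#) λ x≉0 →
    let y , xy≈1 = k.inverse x x≉0 in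
    K.1≉0 (K.trans (K.sym ι.1#-homo) (K.trans (ι.⟦⟧-cong (k.sym xy≈1))
      (K.trans (ι.*-homo x y) (K.trans (K.*-congʳ ιx≈0) (K.zeroˡ _)))))

  ι-injective : ∀ {x y} → ι x K.≈ ι y → x k.≈ y
  ι-injective {x} {y} eq = RingProperties.x∙y⁻¹≈ε⇒x≈y k.ring x y (ι-injective₀
    (K.trans (ι.+-homo x _) (K.trans (K.+-congˡ (ι.-‿homo y))
      (RingProperties.x≈y⇒x∙y⁻¹≈ε K.ring eq))))

  open Divisibility R.semiring using () renaming (_∣_ to _∣ᴿ_; ∣-respˡ to ∣ᴿ-respˡ)

  pᴿ : R.Carrier
  pᴿ = fromℕ R.commutativeRing p

  ρ-kernel⇒∣ : ∀ {x} → ρ x K.≈ K.0# → pᴿ ∣ᴿ x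
  ρ-kernel⇒∣ {x} eq = ∣ᴿ-respˡ (R.*-identityʳ pᴿ)
    (Congruence.∼0⇒∣ R.commutativeRing _
      (Congruence.mk (Equivalence.to (R.reduce-kernel x) (ι-injective₀ eq))))

  ∣⇒ρ-kernel : ∀ {x} → pᴿ ∣ᴿ x → ρ x K.≈ K.0#
  ∣⇒ρ-kernel {x} h = K.trans (ι.⟦⟧-cong (Equivalence.from (R.reduce-kernel x)
      (Congruence._∼_.∣-difference (Congruence.∣⇒∼0 R.commutativeRing _
        (∣ᴿ-respˡ (R.sym (R.*-identityʳ pᴿ)) h)))))
    ι.0#-homo

  p≈0 : fromℕ K.commutativeRing p K.≈ K.0#
  p≈0 = K.trans (K.sym (fromℕ-homo R.commutativeRing K.commutativeRing ρ-hom p))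
    (∣⇒ρ-kernel (Divisibility.∣-refl R.semiring))

  open Characteristic K.commutativeRing p-prime p≈0 public using (frobenius-isRingHom)

  1<q : 1 < q
  1<q = ≡.subst (1 <_) (ℕ.suc-pred q {{kP.N-nonZero}}) (ℕ.s≤s (ℕ.>-nonZero⁻¹ _ {{k.q-1-nonZero}}))

  1<N : 1 < N
  1<N = ≡.subst (1 <_) suc[N-1]≡N (ℕ.s≤s (ℕ.>-nonZero⁻¹ _ {{K.q-1-nonZero}}))

  frobenius-q : ∀ j → IsRingHomomorphism K.commutativeRing K.commutativeRing (Kˣ._^ (q ℕ.^ j))
  frobenius-q j = ≡.subst
    (λ e → IsRingHomomorphism K.commutativeRing K.commutativeRing (Kˣ._^ e))
    (≡.sym (ℕ.^-*-assoc p a j)) (frobenius-isRingHom (a ℕ.* j))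

  ι-fixed : ∀ x → ι x Kˣ.^ q K.≈ ι x
  ι-fixed x = K.trans (K.sym (^-homo k.commutativeRing K.commutativeRing ι-hom x q))
    (ι.⟦⟧-cong (kP.x^N≈x x))

  ι-fixed^ : ∀ x j → ι x Kˣ.^ (q ℕ.^ j) K.≈ ι x
  ι-fixed^ x zero    = K.*-identityʳ _
  ι-fixed^ x (suc j) = K.trans (K.sym (Kˣ.^-assocʳ (ι x) q (q ℕ.^ j)))
    (K.trans (Kˣ.^-congˡ (q ℕ.^ j) (ι-fixed x)) (ι-fixed^ x j))

  -- The image of `ι` already consists of q distinct solutions of y^q = y; one more would exceed the
  -- root bound.
  fixed⇒image : ∀ {y} → y Kˣ.^ q K.≈ y → ∃ λ x → ι x K.≈ y
  fixed⇒image {y} y^q≈y with any? (λ x → ι x K.≈? y) kP.elements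
  ... | yes any = let x , _ , ιx≈y = find any in x , ιx≈y
  ... | no ¬any = contradiction
      (^-fixed-bound 1<q {y ∷ map ι kP.elements}
        (All.map⁺ (All.tabulate λ x∈ y≈ιx → ¬any (lose x∈ (K.sym y≈ιx))) ∷
         AllPairs.map⁺ (AllPairs.map (λ x≉y → x≉y ∘ ι-injective) kP.elements-distinct))
        (y^q≈y ∷ All.map⁺ (All.tabulate λ {x} _ → ι-fixed x)))
      (ℕ.<⇒≱ (ℕ.s≤s (ℕ.≤-reflexive (≡.sym (≡.trans (List.length-map ι kP.elements) kP.length-elements)))))

  Tr : K.Carrier → K.Carrier
  Tr c = sumOver K.commutativeRing (upTo r) λ j → c Kˣ.^ (q ℕ.^ j)

  Tr-cong : ∀ {x y} → x K.≈ y → Tr x K.≈ Tr y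
  Tr-cong eq = ΣK.sum-cong (upTo r) λ j → Kˣ.^-congˡ (q ℕ.^ j) eq

  Tr-0 : Tr K.0# K.≈ K.0#
  Tr-0 = ΣK.sum-zero (upTo r) λ j → RingMorphisms.IsRingHomomorphism.0#-homo (frobenius-q j)

  -- The q-th power permutes the conjugates cyclically because cᴺ = c. The sum over the exponents qʲ
  -- with j ≤ r is split at its first and at its last term, and c is cancelled.
  Tr-fixed : ∀ c → Tr c Kˣ.^ q K.≈ Tr c
  Tr-fixed c = begin
    Tr c Kˣ.^ q
      ≈⟨ Kˣ.^-congʳ (Tr c) (ℕ.*-identityʳ q) ⟨
    Tr c Kˣ.^ (q ℕ.^ 1)
      ≈⟨ sum-homo K.commutativeRing K.commutativeRing (frobenius-q 1) (upTo r) _ ⟩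
    sumOver K.commutativeRing (upTo r) (λ j → (c Kˣ.^ (q ℕ.^ j)) Kˣ.^ (q ℕ.^ 1))
      ≈⟨ ΣK.sum-cong (upTo r) (λ j → K.trans (Kˣ.^-assocʳ c (q ℕ.^ j) (q ℕ.^ 1))
           (Kˣ.^-congʳ c (≡.trans (≡.sym (ℕ.^-distribˡ-+-* q j 1)) (≡.cong (q ℕ.^_) (ℕ.+-comm j 1))))) ⟩
    sumOver K.commutativeRing (upTo r) (λ j → c Kˣ.^ (q ℕ.^ suc j))
      ≈⟨ RingProperties.+-cancelˡ K.ring c _ _ shift ⟩
    Tr c ∎
    where
    open SetoidReasoning K.setoid
    shift : c K.+ sumOver K.commutativeRing (upTo r) (λ j → c Kˣ.^ (q ℕ.^ suc j)) K.≈ c K.+ Tr c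
    shift = begin
      c K.+ sumOver K.commutativeRing (upTo r) (λ j → c Kˣ.^ (q ℕ.^ suc j))
        ≈⟨ K.+-congʳ (K.*-identityʳ c) ⟨
      c Kˣ.^ (q ℕ.^ 0) K.+ sumOver K.commutativeRing (upTo r) (λ j → c Kˣ.^ (q ℕ.^ suc j))
        ≈⟨ ΣK.sum-upTo-first r _ ⟨
      sumOver K.commutativeRing (upTo (suc r)) (λ j → c Kˣ.^ (q ℕ.^ j))
        ≈⟨ ΣK.sum-upTo-last r _ ⟩
      Tr c K.+ c Kˣ.^ N
        ≈⟨ K.trans (K.+-comm _ _) (K.+-congʳ (x^N≈x c)) ⟩
      c K.+ Tr c ∎

  private
    lift : ∀ c → ∃ λ x → ρ x K.≈ Tr c
    lift c with y , ιy≈ ← fixed⇒image (Tr-fixed c) with x , eq ← R.reduce-surjective y =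
      x , K.trans (ι.⟦⟧-cong eq) ιy≈

    liftIndex : _ → R.Carrier
    liftIndex i = proj₁ (lift (Inverse.from K.finite i))

  -- A lift of the trace; factoring it through Fin N makes it respect the
  -- equality of K, and the correction term makes it vanish at 0.
  L : K.Carrier → R.Carrier
  L c = liftIndex (Inverse.to K.finite c) R.- liftIndex (Inverse.to K.finite K.0#)

  L-cong : ∀ {x y} → x K.≈ y → L x R.≈ L y
  L-cong eq = R.reflexive (≡.cong (λ i → liftIndex i R.- liftIndex (Inverse.to K.finite K.0#))
    (Inverse.to-cong K.finite eq))

  L-0 : ∀ {x} → x K.≈ K.0# → L x R.≈ R.0#
  L-0 x≈0 = R.trans (L-cong x≈0) (R.-‿inverseʳ _)

  ρ-L : ∀ c → ρ (L c) K.≈ Tr c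
  ρ-L c = begin
    ρ (L c)
      ≈⟨ K.trans (ρ.+-homo _ _) (K.+-congˡ (ρ.-‿homo _)) ⟩
    ρ (liftIndex (Inverse.to K.finite c)) K.- ρ (liftIndex (Inverse.to K.finite K.0#))
      ≈⟨ K.+-cong (at c) (K.-‿cong (K.trans (at K.0#) Tr-0)) ⟩
    Tr c K.- K.0#
      ≈⟨ K.trans (K.+-congˡ (RingProperties.-0#≈0# K.ring)) (K.+-identityʳ _) ⟩
    Tr c ∎
    where
    open SetoidReasoning K.setoid
    at : ∀ c → ρ (liftIndex (Inverse.to K.finite c)) K.≈ Tr c
    at c = K.trans (proj₂ (lift _)) (Tr-cong (from-to c))

  -- As a power, the inverse is total, multiplicative and compatible with equality, and
  -- `Tr c * inv c` becomes a sum of powers of c.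
  inv : K.Carrier → K.Carrier
  inv c = c Kˣ.^ (N ∸ 2)

  inv-cong : ∀ {x y} → x K.≈ y → inv x K.≈ inv y
  inv-cong = Kˣ.^-congˡ (N ∸ 2)

  inv-* : ∀ x y → inv (x K.* y) K.≈ inv x K.* inv y
  inv-* x y = Kˣ.^-distrib-* x y (N ∸ 2)

  private
    suc[N-2]≡N-1 : suc (N ∸ 2) ≡ N ∸ 1
    suc[N-2]≡N-1 = ≡.sym (ℕ.+-∸-assoc 1 1<N)

  inv-inverseʳ : ∀ {x} → x K.≉ K.0# → x K.* inv x K.≈ K.1#
  inv-inverseʳ {x} x≉0 = K.trans (Kˣ.^-congʳ x suc[N-2]≡N-1) (unit^[N-1]≈1 x≉0)

  inv-inverseˡ : ∀ {x} → x K.≉ K.0# → inv x K.* x K.≈ K.1#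
  inv-inverseˡ x≉0 = K.trans (K.*-comm _ _) (inv-inverseʳ x≉0)

  -- N is a power of p greater than 1 and so vanishes in K; if N - 1 vanished too, so would 1.
  N-1≉0 : fromℕ K.commutativeRing (N ∸ 1) K.≉ K.0#
  N-1≉0 eq = K.1≉0 (begin
    K.1#                                                    ≈⟨ K.+-identityʳ _ ⟨
    K.1# K.+ K.0#                                           ≈⟨ K.+-congˡ eq ⟨
    fromℕ K.commutativeRing (suc (N ∸ 1))                   ≡⟨ ≡.cong (fromℕ K.commutativeRing) suc[N-1]≡N ⟩
    fromℕ K.commutativeRing N
      ≈⟨ Characteristic.multiple≈0 K.commutativeRing p-prime p≈0 p∣N K.1# ⟩
    K.0# ∎)
    where
    open SetoidReasoning K.setoid
    p∣power : ∀ e → 1 < p ℕ.^ e → p ∣ p ℕ.^ e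
    p∣power zero    (ℕ.s≤s ())
    p∣power (suc e) _ = ℕ.m∣m*n (p ℕ.^ e)
    p∣N : p ∣ N
    p∣N = ≡.subst (p ∣_) (≡.sym (ℕ.^-*-assoc p a r))
      (p∣power (a ℕ.* r) (≡.subst (1 <_) (ℕ.^-*-assoc p a r) 1<N))

  -- The multiplicative Fourier coefficient of the trace at the character c ↦ c⁻¹.
  θ : K.Carrier
  θ = sumOver K.commutativeRing units λ c → Tr c K.* inv c

  private
    g-1-invertible : ∀ g → ¬ g K.≈ K.1# → ∃ λ z → z K.* (g K.- K.1#) K.≈ K.1#
    g-1-invertible g g≉1 with z , eq ← K.inverse (g K.- K.1#)
        (λ g-1≈0 → g≉1 (RingProperties.x∙y⁻¹≈ε⇒x≈y K.ring g K.1# g-1≈0)) =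
      z , K.trans (K.*-comm _ _) eq

    module KPowers = PowerSums Fqʳ K.commutativeRing id id (λ _ _ → K.refl) K.refl g-1-invertible

    -- Modulo N - 1 the exponent is qʲ - 1, which lies strictly between 0 and N - 1 when 0 < j < r.
    N-1∣⇒0 : ∀ {j} → j < r → (N ∸ 1) ∣ q ℕ.^ j ℕ.+ (N ∸ 2) → j ≡ 0
    N-1∣⇒0 {zero}  _   _ = ≡.refl
    N-1∣⇒0 {suc j} j<r h = contradiction (ℕ.∣⇒≤ {{ℕ.>-nonZero (ℕ.m<n⇒0<n∸m 1<q^j)}} divisor)
        (ℕ.<⇒≱ (ℕ.∸-monoˡ-< (ℕ.^-monoʳ-< q 1<q j<r) (ℕ.<⇒≤ 1<q^j)))
      where
      1<q^j : 1 < q ℕ.^ suc j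
      1<q^j = ℕ.^-monoʳ-< q 1<q {0} {suc j} (ℕ.s≤s ℕ.z≤n)
      divisor : (N ∸ 1) ∣ q ℕ.^ suc j ∸ 1
      divisor = ℕ.∣m+n∣m⇒∣n {n = q ℕ.^ suc j ∸ 1} (≡.subst ((N ∸ 1) ∣_) (begin
        q ℕ.^ suc j ℕ.+ (N ∸ 2)                 ≡⟨ ≡.cong (ℕ._+ (N ∸ 2)) (ℕ.m+[n∸m]≡n (ℕ.<⇒≤ 1<q^j)) ⟨
        suc (q ℕ.^ suc j ∸ 1 ℕ.+ (N ∸ 2))       ≡⟨ ℕ.+-suc (q ℕ.^ suc j ∸ 1) (N ∸ 2) ⟨
        q ℕ.^ suc j ∸ 1 ℕ.+ suc (N ∸ 2)         ≡⟨ ≡.cong (q ℕ.^ suc j ∸ 1 ℕ.+_) suc[N-2]≡N-1 ⟩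
        q ℕ.^ suc j ∸ 1 ℕ.+ (N ∸ 1)             ≡⟨ ℕ.+-comm _ (N ∸ 1) ⟩
        N ∸ 1 ℕ.+ (q ℕ.^ suc j ∸ 1)             ∎) h) ℕ.∣-refl
        where open ≡.≡-Reasoning

  -- Exchanging the sums gives power sums with exponents qʲ + N - 2. Only the one for j = 0
  -- survives, and it equals N - 1; `1≤r` ensures that this j occurs.
  θ≉0 : θ K.≉ K.0#
  θ≉0 θ≈0 = N-1≉0 (K.trans (K.sym θ≈N-1) θ≈0)
    where
    open SetoidReasoning K.setoid
    θ≈N-1 : θ K.≈ fromℕ K.commutativeRing (N ∸ 1)
    θ≈N-1 = begin
      θ
        ≈⟨ ΣK.sum-cong units (λ c → K.trans (ΣK.sum-*ʳ (inv c) (upTo r) _)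
             (ΣK.sum-cong (upTo r) λ j → K.sym (Kˣ.^-homo-* c (q ℕ.^ j) (N ∸ 2)))) ⟩
      sumOver K.commutativeRing units (λ c → sumOver K.commutativeRing (upTo r) λ j →
        c Kˣ.^ (q ℕ.^ j ℕ.+ (N ∸ 2)))
        ≈⟨ ΣK.sum-comm units (upTo r) _ ⟩
      sumOver K.commutativeRing (upTo r) (λ j → sumOver K.commutativeRing units λ c →
        c Kˣ.^ (q ℕ.^ j ℕ.+ (N ∸ 2)))
        ≈⟨ ΣK.sum-cong-∈ (upTo r) (λ {j} j∈ → K.trans (KPowers.power-sum (q ℕ.^ j ℕ.+ (N ∸ 2)))
             (K.*-congʳ (ΣK.[]-cong ((N ∸ 1) ℕ.∣? (q ℕ.^ j ℕ.+ (N ∸ 2))) (j ℕ.≟ 0)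
               (N-1∣⇒0 (∈-upTo⁻ j∈))
               λ { ≡.refl → ℕ.∣-reflexive (≡.sym suc[N-2]≡N-1) }))) ⟩
      sumOver K.commutativeRing (upTo r) (λ j → ΣK.[ j ℕ.≟ 0 ] K.* fromℕ K.commutativeRing (N ∸ 1))
        ≈⟨ ΣK.sum-δ ℕ._≟_ 0 _ (upTo⁺ r) (∈-upTo⁺ 1≤r) ⟩
      fromℕ K.commutativeRing (N ∸ 1) ∎

-- Nilpotent ideals

module Ideal {s ℓs i} (S : CommutativeRing s ℓs) (I : ⟨ S ⟩ → Set i) where
  open CommutativeRing S hiding (zero)
  open Exp commutativeSemiring
  open SetoidReasoning setoid
  open FromInteger.Solver S using (solve; _:=_; _:+_; _:*_; _:-_)
  open import Algebra.Properties.CommutativeSemigroup *-commutativeSemigroup using (interchange)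

  product : List Carrier → Carrier
  product = List.foldr _*_ 1#

  product-++ : ∀ xs ys → product (xs ++ ys) ≈ product xs * product ys
  product-++ []       ys = sym (*-identityˡ _)
  product-++ (x ∷ xs) ys = trans (*-congˡ (product-++ xs ys)) (sym (*-assoc x _ _))

  product-replicate : ∀ w n → product (List.replicate n w) ≈ w ^ n
  product-replicate w zero    = refl
  product-replicate w (suc n) = *-congˡ (product-replicate w n)

  geometric : ∀ w n → ∃ λ s → s * (1# - w) ≈ 1# - w ^ n
  geometric w zero    = 0# , trans (zeroˡ _) (sym (-‿inverseʳ 1#))
  geometric w (suc n) with s , eq ← geometric w n = 1# + w * s , (begin
    (1# + w * s) * (1# - w)
      ≈⟨ solve 3 (λ i w s → (i :+ w :* s) :* (i :- w) := i :* (i :- w) :+ w :* (s :* (i :- w)))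
           refl 1# w s ⟩
    1# * (1# - w) + w * (s * (1# - w))
      ≈⟨ +-cong (*-identityˡ _) (*-congˡ eq) ⟩
    (1# - w) + w * (1# - w ^ n)
      ≈⟨ solve 3 (λ i w y → (i :- w) :+ w :* (i :- y) := (i :- w) :+ (w :* i :- w :* y))
           refl 1# w (w ^ n) ⟩
    (1# - w) + (w * 1# - w * w ^ n)
      ≈⟨ +-congˡ (+-congʳ (*-identityʳ w)) ⟩
    (1# - w) + (w - w * w ^ n)
      ≈⟨ solve 3 (λ i w y → (i :- w) :+ (w :- y) := i :- y) refl 1# w (w * w ^ n) ⟩
    1# - w * w ^ n ∎)

  -- Deep n x: x lies in the n-th power of the ideal I.
  record Deep (n : ℕ) (x : Carrier) : Set (s ⊔ ℓs ⊔ i) where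
    constructor deep
    field
      factors   : List Carrier
      count     : length factors ≡ n
      members   : All I factors
      cofactor  : Carrier
      factorise : x ≈ product factors * cofactor

  deep-0 : ∀ x → Deep 0 x
  deep-0 x = deep [] ≡.refl [] x (sym (*-identityˡ x))

  deep-1 : ∀ {x} → I x → Deep 1 x
  deep-1 {x} h = deep (x ∷ []) ≡.refl (h ∷ []) 1# (sym (trans (*-identityʳ _) (*-identityʳ x)))

  deep-* : ∀ {m n x y} → Deep m x → Deep n y → Deep (m ℕ.+ n) (x * y)
  deep-* (deep xs lx ax z ex) (deep ys ly ay w ey) = deep (xs ++ ys)
    (≡.trans (List.length-++ xs) (≡.cong₂ ℕ._+_ lx ly)) (All.++⁺ ax ay) (z * w)
    (trans (*-cong ex ey) (trans (interchange _ _ _ _) (*-congʳ (sym (product-++ xs ys)))))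

  deep-*ˡ : ∀ {m x} y → Deep m x → Deep m (y * x)
  deep-*ˡ y h = deep-* (deep-0 y) h

  deep-^ : ∀ {m x} → Deep m x → ∀ n → Deep (n ℕ.* m) (x ^ n)
  deep-^ h zero    = deep-0 1#
  deep-^ h (suc n) = deep-* h (deep-^ h n)

  module Nilpotent (l : ℕ) (nilpotent : ∀ xs → length xs ≡ l → All I xs → product xs ≈ 0#) where

    deep⇒≈0 : ∀ {n x} → l ≤ n → Deep n x → x ≈ 0#
    deep⇒≈0 {n} {x} l≤n (deep xs lx ax z ex) = begin
      x                                                   ≈⟨ ex ⟩
      product xs * z                                      ≡⟨ ≡.cong (λ ys → product ys * z) (List.take++drop≡id l xs) ⟨
      product (List.take l xs ++ List.drop l xs) * z      ≈⟨ *-congʳ (product-++ (List.take l xs) _) ⟩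
      product (List.take l xs) * product (List.drop l xs) * z
        ≈⟨ *-congʳ (*-congʳ (nilpotent (List.take l xs)
             (≡.trans (List.length-take l xs) (ℕ.m≤n⇒m⊓n≡m (≡.subst (l ≤_) (≡.sym lx) l≤n)))
             (All.take⁺ l ax))) ⟩
      0# * product (List.drop l xs) * z                   ≈⟨ trans (*-congʳ (zeroˡ _)) (zeroˡ z) ⟩
      0#                                                  ∎

    -- With w = 1 - vd, the geometric sum of w up to wˡ⁻¹ inverts 1 - w = vd, because wˡ is a
    -- product of l members of `I`.
    invertible : ∀ v d → I (1# - v * d) → ∃ λ z → z * d ≈ 1#
    invertible v d h with s , eq ← geometric (1# - v * d) l = s * v , (begin
      s * v * d                          ≈⟨ *-assoc s v d ⟩
      s * (v * d)                        ≈⟨ *-congˡ (solve 2 (λ i y → y := i :- (i :- y)) refl 1# (v * d)) ⟩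
      s * (1# - (1# - v * d))            ≈⟨ eq ⟩
      1# - (1# - v * d) ^ l
        ≈⟨ +-congˡ (-‿cong (trans (sym (product-replicate _ l))
             (nilpotent _ (List.length-replicate l) (All.replicate⁺ l h)))) ⟩
      1# - 0#                            ≈⟨ trans (+-congˡ (RingProperties.-0#≈0# ring)) (+-identityʳ 1#) ⟩
      1#                                 ∎)

-- The ring S, its reduction map and its Teichmüller character

module TeichmullerRing {c₁ ℓ₁ c₂ ℓ₂ c₃ ℓ₃} {p a : ℕ} (p-prime : Prime p)
                 (Fq : FiniteField c₁ ℓ₁ (p ℕ.^ a)) (Zq : WittVectors p Fq c₂ ℓ₂)
                 {r : ℕ} (1≤r : 1 ≤ r) (Fqʳ : FiniteField c₃ ℓ₃ ((p ℕ.^ a) ℕ.^ r))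
                 {ι : FiniteField.Carrier Fq → FiniteField.Carrier Fqʳ}
                 (ι-hom : IsRingHomomorphism (FiniteField.commutativeRing Fq)
                                             (FiniteField.commutativeRing Fqʳ) ι)
                 (l : ℕ) (1≤l : 1 ≤ l) where
  open Extension {p = p} {a = a} p-prime Fq Zq 1≤r Fqʳ ι-hom public
  open K using (units)
  open FiniteFieldProperties Fqʳ using (fold-units-scale; units-≉0)
  open Divisibility R.semiring using (_,_; 1∣_) renaming (_∣_ to _∣ᴿ_; ∣-respʳ to ∣ᴿ-respʳ; ∣-refl to ∣ᴿ-refl; ∣-trans to ∣ᴿ-trans)
  open Exp R.commutativeSemiring using () renaming (_^_ to _^ᴿ_)
  open import Algebra.Properties.CommutativeSemigroup R.*-commutativeSemigroup using ()
    renaming (interchange to R-interchange)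
  open import Algebra.Properties.CommutativeSemigroup K.*-commutativeSemigroup using ()
    renaming (x∙yz≈y∙xz to K-x∙yz≈y∙xz; interchange to K-interchange)

  -- Convolving once more with L makes room for one more factor from the kernel
  -- of red, since such a factor can be moved onto L, where it produces a p.
  f : ℕ → K.Carrier → R.Carrier
  f zero    c = L c
  f (suc k) c = sumOver R.commutativeRing units λ b → L b R.* f k (inv b K.* c)

  f-cong : ∀ k {x y} → x K.≈ y → f k x R.≈ f k y
  f-cong zero    eq = L-cong eq
  f-cong (suc k) eq = ΣR.sum-cong units λ b → R.*-congˡ (f-cong k (K.*-congˡ eq))

  f-0 : ∀ k {x} → x K.≈ K.0# → f k x R.≈ R.0#
  f-0 zero    x≈0 = L-0 x≈0
  f-0 (suc k) x≈0 = ΣR.sum-zero units λ b →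
    R.trans (R.*-congˡ (f-0 k (K.trans (K.*-congˡ x≈0) (K.zeroʳ _)))) (R.zeroʳ _)

  private
    inv-cancel : ∀ {u} → u K.≉ K.0# → ∀ b z → inv (u K.* b) K.* (u K.* z) K.≈ inv b K.* z
    inv-cancel {u} u≉0 b z = begin
      inv (u K.* b) K.* (u K.* z)          ≈⟨ K.*-congʳ (inv-* u b) ⟩
      inv u K.* inv b K.* (u K.* z)        ≈⟨ K-interchange _ _ _ _ ⟩
      inv u K.* u K.* (inv b K.* z)        ≈⟨ K.*-congʳ (inv-inverseˡ u≉0) ⟩
      K.1# K.* (inv b K.* z)               ≈⟨ K.*-identityˡ _ ⟩
      inv b K.* z                          ∎
      where open SetoidReasoning K.setoid

  -- Substituting ub for b moves u from the inner function onto `L`. For u = 0 there is no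
  -- substitution, but both sides vanish; this is why `L` is made to vanish at 0.
  f-translate : ∀ k u z → f (suc k) (u K.* z) R.≈
                sumOver R.commutativeRing units λ b → L (u K.* b) R.* f k (inv b K.* z)
  f-translate k u z with u K.≈? K.0#
  ... | yes u≈0 = R.trans (f-0 (suc k) (K.trans (K.*-congʳ u≈0) (K.zeroˡ z)))
    (R.sym (ΣR.sum-zero units λ b →
      R.trans (R.*-congʳ (L-0 (K.trans (K.*-congʳ u≈0) (K.zeroˡ b)))) (R.zeroˡ _)))
  ... | no u≉0 = begin
    sumOver R.commutativeRing units (λ b → L b R.* f k (inv b K.* (u K.* z)))
      ≈⟨ fold-units-scale R.+-commutativeMonoid
           (λ eq → R.*-cong (L-cong eq) (f-cong k (K.*-congʳ (inv-cong eq)))) u≉0 ⟨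
    sumOver R.commutativeRing units (λ b → L (u K.* b) R.* f k (inv (u K.* b) K.* (u K.* z)))
      ≈⟨ ΣR.sum-cong units (λ b → R.*-congˡ (f-cong k (inv-cancel u≉0 b z))) ⟩
    sumOver R.commutativeRing units (λ b → L (u K.* b) R.* f k (inv b K.* z)) ∎
    where open SetoidReasoning R.setoid

  -- The Fourier coefficient of `θ`, for the reduction of an R-valued function.
  Θ : (K.Carrier → R.Carrier) → K.Carrier
  Θ g = sumOver K.commutativeRing units λ c → ρ (g c) K.* inv c

  Θ-L≉0 : Θ L K.≉ K.0#
  Θ-L≉0 eq = θ≉0 (K.trans (K.sym (ΣK.sum-cong units λ c → K.*-congʳ (ρ-L c))) eq)

  -- Fourier coefficients turn convolution into multiplication: substituting bc for c in the inner
  -- sum yields Θ(L) · Θ(f k), a product of nonzero elements of a field.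
  Θ-f≉0 : ∀ k → Θ (f k) K.≉ K.0#
  Θ-f≉0 zero       = Θ-L≉0
  Θ-f≉0 (suc k) eq = FiniteFieldProperties.*-≉0 Fqʳ Θ-L≉0 (Θ-f≉0 k) (K.trans (K.sym (begin
    sumOver K.commutativeRing units (λ c → ρ (f (suc k) c) K.* inv c)
      ≈⟨ ΣK.sum-cong units (λ c → K.trans
           (K.*-congʳ (sum-homo R.commutativeRing K.commutativeRing ρ-hom units _))
           (ΣK.sum-*ʳ (inv c) units _)) ⟩
    sumOver K.commutativeRing units (λ c → sumOver K.commutativeRing units λ b →
      ρ (L b R.* f k (inv b K.* c)) K.* inv c)
      ≈⟨ ΣK.sum-comm units units _ ⟩
    sumOver K.commutativeRing units (λ b → sumOver K.commutativeRing units λ c →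
      ρ (L b R.* f k (inv b K.* c)) K.* inv c)
      ≈⟨ ΣK.sum-cong-∈ units (λ {b} b∈ → inner b (All.lookup units-≉0 b∈)) ⟩
    sumOver K.commutativeRing units (λ b → (ρ (L b) K.* inv b) K.* Θ (f k))
      ≈⟨ ΣK.sum-*ʳ (Θ (f k)) units _ ⟨
    Θ L K.* Θ (f k) ∎)) eq)
    where
    open SetoidReasoning K.setoid
    inner : ∀ b → b K.≉ K.0# →
            sumOver K.commutativeRing units (λ c → ρ (L b R.* f k (inv b K.* c)) K.* inv c) K.≈
            (ρ (L b) K.* inv b) K.* Θ (f k)
    inner b b≉0 = begin
      sumOver K.commutativeRing units (λ c → ρ (L b R.* f k (inv b K.* c)) K.* inv c)
        ≈⟨ fold-units-scale K.+-commutativeMonoid (λ eq → K.*-cong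
             (ρ.⟦⟧-cong (R.*-congˡ (f-cong k (K.*-congˡ eq)))) (inv-cong eq)) b≉0 ⟨
      sumOver K.commutativeRing units (λ c → ρ (L b R.* f k (inv b K.* (b K.* c))) K.* inv (b K.* c))
        ≈⟨ ΣK.sum-cong units (λ c → K.trans
             (K.*-cong (K.trans (ρ.*-homo _ _) (K.*-congˡ (ρ.⟦⟧-cong (f-cong k
               (K.trans (K.sym (K.*-assoc _ _ _)) (K.trans (K.*-congʳ (inv-inverseˡ b≉0)) (K.*-identityˡ c)))))))
               (inv-* b c))
             (K-interchange _ _ _ _)) ⟩
      sumOver K.commutativeRing units (λ c → (ρ (L b) K.* inv b) K.* (ρ (f k c) K.* inv c))
        ≈⟨ ΣK.sum-*ˡ _ units _ ⟨
      (ρ (L b) K.* inv b) K.* Θ (f k) ∎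

  -- If every value of `f k` on units reduced to zero, its Fourier coefficient would vanish.
  unit-value : ∀ k → ∃ λ c → ρ (f k c) K.≉ K.0#
  unit-value k with any? (λ c → ¬? (ρ (f k c) K.≈? K.0#)) units
  ... | yes any = let c , _ , h = find any in c , h
  ... | no ¬any = contradiction (ΣK.sum-zero-∈ units λ {c} c∈ → K.trans
          (K.*-congʳ (decidable-stable (ρ (f k c) K.≈? K.0#) λ h → ¬any (lose c∈ h))) (K.zeroˡ _))
        (Θ-f≉0 k)

  private
    Rᶜ = R.commutativeRing
    Kᶜ = K.commutativeRing
    module PR = Pairing Rᶜ Rᶜ (Identity.isRingHomomorphism R.rawRing R.refl)
    module Pρ = Pairing Rᶜ Kᶜ ρ-hom

  Rₗ : CommutativeRing _ _
  Rₗ = Congruence.quotientRing Rᶜ (pᴿ ^ᴿ l)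

  open Congruence Rᶜ (pᴿ ^ᴿ l) using (_∼_; mk; ∼0⇒∣; ∣⇒∼0; ∼-reflexive; ∼-trans; ∼-sym; ∼-*; ∼-+) public

  module O = Operators Rₗ K.*-commutativeMonoid (f l) (λ eq → ∼-reflexive (f-cong l eq))

  S : CommutativeRing _ _
  S = O.operatorRing

  module S = CommutativeRing S
  module Sˣ = Exp S.commutativeSemiring

  -- Defined on representatives. That it respects the equality of S is not evident, as equality
  -- there is defined through f; `red-cong` derives it from nilpotence.
  red : S.Carrier → K.Carrier
  red P = Pρ.pair P id

  red-+ : ∀ P Q → red (P S.+ Q) K.≈ red P K.+ red Q
  red-+ P Q = Pρ.pair-++ P Q id

  red-* : ∀ P Q → red (P S.* Q) K.≈ red P K.* red Q
  red-* P Q = K.trans (Pρ.pair-convolve K._*_ P Q id)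
    (K.trans (Pρ.pair-cong P λ u → K.sym (Pρ.pair-*ˡ u Q id)) (K.sym (Pρ.pair-*ʳ (red Q) P id)))

  red-neg : ∀ P → red (S.- P) K.≈ K.- red P
  red-neg P = Pρ.pair-neg P id

  red-1 : red S.1# K.≈ K.1#
  red-1 = K.trans (K.+-identityʳ _) (K.trans (K.*-identityʳ _) ρ.1#-homo)

  Killed : S.Carrier → Set ℓ₃
  Killed P = red P K.≈ K.0#

  open Ideal S Killed using (product)

  private

    ∣-*-mono : ∀ {x y z w} → x ∣ᴿ y → z ∣ᴿ w → x R.* z ∣ᴿ y R.* w
    ∣-*-mono (s , eq) (s′ , eq′) = s R.* s′ , R.trans (R-interchange _ _ _ _) (R.*-cong eq eq′)

    -- The reduced coefficients lie in F_q, so they are fixed by qʲ-th powers. Hence P applied to u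
    -- ↦ (ub)^(qʲ) is the qʲ-th power of `red P` times b, which is zero; summing over j gives the
    -- trace.
    killed-L : ∀ P → Killed P → ∀ b → pᴿ ∣ᴿ PR.pair P (λ u → L (u K.* b))
    killed-L P killed b = ρ-kernel⇒∣ (begin
      ρ (PR.pair P (λ u → L (u K.* b)))
        ≈⟨ K.trans (sum-homo Rᶜ Kᶜ ρ-hom P _)
             (ΣK.sum-cong P λ x → K.trans (ρ.*-homo _ _) (K.*-congˡ (ρ-L _))) ⟩
      Pρ.pair P (λ u → Tr (u K.* b))
        ≈⟨ Pρ.pair-sum P (upTo r) (λ j u → (u K.* b) Kˣ.^ (q ℕ.^ j)) ⟨
      sumOver Kᶜ (upTo r) (λ j → Pρ.pair P λ u → (u K.* b) Kˣ.^ (q ℕ.^ j))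
        ≈⟨ ΣK.sum-zero (upTo r) conjugate ⟩
      K.0# ∎)
      where
      open SetoidReasoning K.setoid
      conjugate : ∀ j → Pρ.pair P (λ u → (u K.* b) Kˣ.^ (q ℕ.^ j)) K.≈ K.0#
      conjugate j = begin
        Pρ.pair P (λ u → (u K.* b) Kˣ.^ (q ℕ.^ j))
          ≈⟨ ΣK.sum-cong P (λ x → K.trans (K.*-congʳ (K.sym (ι-fixed^ (R.reduce (proj₁ x)) j)))
               (K.sym (Kˣ.^-distrib-* _ _ (q ℕ.^ j)))) ⟩
        sumOver Kᶜ P (λ x → (ρ (proj₁ x) K.* (proj₂ x K.* b)) Kˣ.^ (q ℕ.^ j))
          ≈⟨ sum-homo Kᶜ Kᶜ (frobenius-q j) P _ ⟨
        Pρ.pair P (K._* b) Kˣ.^ (q ℕ.^ j)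
          ≈⟨ Kˣ.^-congˡ (q ℕ.^ j) (K.trans (K.sym (Pρ.pair-*ʳ b P id))
               (K.trans (K.*-congʳ killed) (K.zeroˡ b))) ⟩
        K.0# Kˣ.^ (q ℕ.^ j)
          ≈⟨ RingMorphisms.IsRingHomomorphism.0#-homo (frobenius-q j) ⟩
        K.0# ∎

    -- One convolution is spent on each factor: `f-translate` makes P act on `L` alone, where
    -- `killed-L` yields a p, while the remaining product acts on a translate of `f k`.
    product-kills : ∀ k xs → length xs ≡ k → All Killed xs → ∀ z →
                    pᴿ ^ᴿ k ∣ᴿ PR.pair (product xs) (λ u → f k (u K.* z))
    product-kills zero    _        _      _ z = 1∣ _
    product-kills (suc k) (P ∷ xs) len (killed ∷ all) z = ∣ᴿ-respʳ (R.sym (begin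
      PR.pair (P S.* product xs) (λ u → f (suc k) (u K.* z))
        ≈⟨ PR.pair-convolve K._*_ P (product xs) _ ⟩
      PR.pair P (λ u → PR.pair (product xs) λ v → f (suc k) (u K.* v K.* z))
        ≈⟨ PR.pair-cong P (λ u → PR.pair-cong (product xs) λ v →
             R.trans (f-cong (suc k) (K.*-assoc u v z)) (R.trans (f-translate k u (v K.* z))
               (ΣR.sum-cong units λ b → R.*-congˡ (f-cong k (K-x∙yz≈y∙xz _ _ _))))) ⟩
      PR.pair P (λ u → PR.pair (product xs) λ v →
        sumOver Rᶜ units λ b → L (u K.* b) R.* f k (v K.* (inv b K.* z)))
        ≈⟨ PR.pair-cong P (λ u → R.trans (R.sym (PR.pair-sum (product xs) units _))
             (ΣR.sum-cong units λ b → R.sym (PR.pair-*ˡ _ (product xs) _))) ⟩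
      PR.pair P (λ u → sumOver Rᶜ units λ b → L (u K.* b) R.* value b)
        ≈⟨ PR.pair-sum P units (λ b u → L (u K.* b) R.* value b) ⟨
      sumOver Rᶜ units (λ b → PR.pair P λ u → L (u K.* b) R.* value b)
        ≈⟨ ΣR.sum-cong units (λ b → R.sym (PR.pair-*ʳ (value b) P _)) ⟩
      sumOver Rᶜ units (λ b → PR.pair P (λ u → L (u K.* b)) R.* value b) ∎))
      (Congruence.∣-sum Rᶜ _ units _ λ b →
        ∣-*-mono (killed-L P killed b)
          (product-kills k xs (ℕ.suc-injective len) all (inv b K.* z)))
      where
      open SetoidReasoning R.setoid
      value : K.Carrier → R.Carrier
      value b = PR.pair (product xs) λ v → f k (v K.* (inv b K.* z))

  nilpotent : ∀ xs → length xs ≡ l → All Killed xs → product xs S.≈ S.0#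
  nilpotent xs len killed = O.mk λ z → ∣⇒∼0 (product-kills l xs len killed z)

  t : K.Carrier → S.Carrier
  t c = (R.1# , c) ∷ []

  red-t : ∀ c → red (t c) K.≈ c
  red-t c = K.trans (K.+-identityʳ _) (K.trans (K.*-congʳ ρ.1#-homo) (K.*-identityˡ c))

  j : R.Carrier → S.Carrier
  j x = (x , K.1#) ∷ []

  red-j : ∀ x → red (j x) K.≈ ρ x
  red-j x = K.trans (K.+-identityʳ _) (K.*-identityʳ _)

  private
    single-cong : ∀ {x y u v} → x ∼ y → u K.≈ v → (x , u) ∷ [] S.≈ (y , v) ∷ []
    single-cong x∼y u≈v = O.mk λ z → ∼-+ (∼-* x∼y (∼-reflexive (f-cong l (K.*-congʳ u≈v))))
      (∼-reflexive R.refl)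

  -- If v is the inverse of `red d` in K, then `t v` inverts d up to an element of the kernel, and
  -- kernel elements are nilpotent.
  unit⇒invertible : ∀ d → red d K.≉ K.0# → ∃ λ z → z S.* d S.≈ S.1#
  unit⇒invertible d red≉0 with v , dv≈1 ← K.inverse (red d) red≉0 =
    Ideal.Nilpotent.invertible S Killed l nilpotent (t v) d
      (K.trans (red-+ S.1# (S.- (t v S.* d))) (K.trans
        (K.+-cong red-1 (K.trans (red-neg (t v S.* d)) (K.-‿cong
          (K.trans (red-* (t v) d) (K.trans (K.*-congʳ (red-t v)) (K.trans (K.*-comm _ _) dv≈1))))))
        (K.-‿inverseʳ K.1#)))

  -- For a lift v′ of the inverse of u modulo p, w = 1 - uv′ is divisible by p. Modulo pˡ the
  -- hypothesis gives x = xw, hence x = xwˡ = 0.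
  ρ-unit-cancel : ∀ {x u} → ρ u K.≉ K.0# → x R.* u ∼ R.0# → x ∼ R.0#
  ρ-unit-cancel {x} {u} ρu≉0 xu∼0
    with v , uv≈1 ← k.inverse (R.reduce u) (λ h → ρu≉0 (K.trans (ι.⟦⟧-cong h) ι.0#-homo))
    with v′ , eq ← R.reduce-surjective v =
    ∼-trans (absorb l) (∼-trans (∼-* (∼-reflexive R.refl) (∣⇒∼0 (power-∣ l))) (∼-reflexive (R.zeroʳ x)))
    where
    open FromInteger.Solver Rᶜ using (solve; _:=_; _:*_; _:-_)
    w = R.1# R.- u R.* v′

    p∣w : pᴿ ∣ᴿ w
    p∣w = ρ-kernel⇒∣ (K.trans (ρ.+-homo _ _) (K.trans (K.+-cong ρ.1#-homo
      (K.trans (ρ.-‿homo _) (K.-‿cong (K.trans (ι.⟦⟧-cong (k.trans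
        (RingMorphisms.IsRingHomomorphism.*-homo R.reduce-isRingHom u v′)
        (k.trans (k.*-congˡ eq) uv≈1))) ι.1#-homo)))) (K.-‿inverseʳ K.1#)))

    power-∣ : ∀ n → pᴿ ^ᴿ n ∣ᴿ w ^ᴿ n
    power-∣ zero    = ∣ᴿ-refl
    power-∣ (suc n) = ∣-*-mono p∣w (power-∣ n)

    x∼xw : x ∼ x R.* w
    x∼xw = ∼-sym (∼-trans (∼-reflexive (R.trans
        (solve 4 (λ x u v i → x :* (i :- u :* v) := x :* i :- (x :* u) :* v) R.refl x u v′ R.1#)
        (R.+-congʳ (R.*-identityʳ x))))
      (∼-trans (∼-+ (∼-reflexive R.refl) (Congruence.∼-neg Rᶜ _ (∼-* xu∼0 (∼-reflexive (R.refl {v′})))))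
        (∼-reflexive (R.trans (R.+-congˡ (R.trans (R.-‿cong (R.zeroˡ v′))
          (RingProperties.-0#≈0# R.ring))) (R.+-identityʳ x)))))

    absorb : ∀ n → x ∼ x R.* w ^ᴿ n
    absorb zero    = ∼-reflexive (R.sym (R.*-identityʳ x))
    absorb (suc n) = ∼-trans (absorb n) (∼-trans (∼-* x∼xw (∼-reflexive R.refl))
      (∼-reflexive (R.*-assoc _ _ _)))

  -- Acting on `f l` and evaluating at a point where it is a unit modulo p gives x times that unit.
  j-reflects : ∀ {x} → j x S.≈ S.0# → x ∼ R.0#
  j-reflects {x} (O.mk h) with c , unit ← unit-value l = ρ-unit-cancel unit
    (∼-trans (∼-reflexive (R.trans (R.*-congˡ (f-cong l (K.sym (K.*-identityˡ c)))) (R.sym (R.+-identityʳ _))))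
      (h c))

  1≉0 : ¬ S.1# S.≈ S.0#
  1≉0 eq = K.1≉0 (K.trans (K.sym ρ.1#-homo) (∣⇒ρ-kernel (p∣ l 1≤l (∼0⇒∣ (j-reflects eq)))))
    where
    p∣ : ∀ l → 1 ≤ l → pᴿ ^ᴿ l ∣ᴿ R.1# → pᴿ ∣ᴿ R.1#
    p∣ (suc l) _ h = ∣ᴿ-trans (pᴿ ^ᴿ l , R.*-comm _ _) h

  -- If `red (P - Q)` were nonzero, P - Q would be invertible; but it is zero in S, where 1 and 0
  -- differ.
  red-cong : ∀ {P Q} → P S.≈ Q → red P K.≈ red Q
  red-cong {P} {Q} eq = RingProperties.x∙y⁻¹≈ε⇒x≈y K.ring (red P) (red Q)
    (K.trans (K.sym (K.trans (red-+ P (S.- Q)) (K.+-congˡ (red-neg Q))))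
      (decidable-stable (red (P S.- Q) K.≈? K.0#) λ h →
        let z , zd≈1 = unit⇒invertible (P S.- Q) h in
        1≉0 (S.trans (S.sym zd≈1) (S.trans
          (S.*-congˡ {z} (RingProperties.x≈y⇒x∙y⁻¹≈ε S.ring eq)) (S.zeroʳ z)))))

  red-hom : IsRingHomomorphism S Kᶜ red
  red-hom = ringHomomorphism S Kᶜ red red-cong red-+ red-* red-1

  module red = RingMorphisms.IsRingHomomorphism red-hom

  j-hom : IsRingHomomorphism Rᶜ S j
  j-hom = ringHomomorphism Rᶜ S j (λ eq → single-cong (∼-reflexive eq) K.refl)
    (λ x y → O.mk λ z → ∼-reflexive (R.trans (R.+-congʳ (R.distribʳ _ x y)) (R.+-assoc _ _ _)))
    (λ x y → single-cong (∼-reflexive R.refl) (K.sym (K.*-identityˡ K.1#))) S.refl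

  t-cong : ∀ {x y} → x K.≈ y → t x S.≈ t y
  t-cong = single-cong (∼-reflexive R.refl)

  t-* : ∀ x y → t (x K.* y) S.≈ t x S.* t y
  t-* x y = single-cong (∼-reflexive (R.sym (R.*-identityˡ R.1#))) K.refl

  t-1≢⇒invertible : ∀ g → ¬ g K.≈ K.1# → ∃ λ z → z S.* (t g S.- S.1#) S.≈ S.1#
  t-1≢⇒invertible g g≉1 = unit⇒invertible (t g S.- S.1#) λ h →
    g≉1 (RingProperties.x∙y⁻¹≈ε⇒x≈y K.ring g K.1# (K.trans (K.sym (K.trans (red-+ (t g) (S.- S.1#))
      (K.+-cong (red-t g) (K.trans (red-neg S.1#) (K.-‿cong red-1))))) h))

  open PowerSums Fqʳ S t t-cong t-* S.refl t-1≢⇒invertible public using (power-sum; t-^)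

-- Exponents and polynomials

infix 4 _≟ᵉ_
_≟ᵉ_ : ∀ {m} → DecidableEquality (Exponent m)
_≟ᵉ_ = ≡-dec ℕ._≟_

infixl 6 _⊕_ _⊖_
_⊕_ _⊖_ : ∀ {m} → Exponent m → Exponent m → Exponent m
_⊕_ = Vec.zipWith ℕ._+_
_⊖_ = Vec.zipWith _∸_

infixr 7 _⊙_
_⊙_ : ∀ {m} → ℕ → Exponent m → Exponent m
c ⊙ u = Vec.map (c ℕ.*_) u

⊕-⊖-cancel : ∀ {m} (v w : Exponent m) → (v ⊕ w) ⊖ v ≡ w
⊕-⊖-cancel []      []      = ≡.refl
⊕-⊖-cancel (x ∷ v) (y ∷ w) = ≡.cong₂ _∷_ (ℕ.m+n∸m≡n x y) (⊕-⊖-cancel v w)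

⊕-cancelˡ : ∀ {m} (v : Exponent m) {w w′} → v ⊕ w ≡ v ⊕ w′ → w ≡ w′
⊕-cancelˡ v {w} {w′} eq = ≡.trans (≡.sym (⊕-⊖-cancel v w)) (≡.trans (≡.cong (_⊖ v) eq) (⊕-⊖-cancel v w′))

sum-⊕ : ∀ {m} (v w : Exponent m) → Vec.sum (v ⊕ w) ≡ Vec.sum v ℕ.+ Vec.sum w
sum-⊕ []      []      = ≡.refl
sum-⊕ (x ∷ v) (y ∷ w) = ≡.trans (≡.cong (x ℕ.+ y ℕ.+_) (sum-⊕ v w)) (interchange x y _ _)
  where open import Algebra.Properties.CommutativeSemigroup ℕ.+-commutativeSemigroup using (interchange)

sum-⊙ : ∀ {m} c (v : Exponent m) → Vec.sum (c ⊙ v) ≡ c ℕ.* Vec.sum v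
sum-⊙ c []      = ≡.sym (ℕ.*-zeroʳ c)
sum-⊙ c (x ∷ v) = ≡.trans (≡.cong (c ℕ.* x ℕ.+_) (sum-⊙ c v)) (≡.sym (ℕ.*-distribˡ-+ c x _))

∈-below⁻ : ∀ {m} {v w : Exponent m} → v ∈ below w → v ⊕ (w ⊖ v) ≡ w
∈-below⁻ {v = []}     {[]}    _ = ≡.refl
∈-below⁻ {v = v₀ ∷ v} {x ∷ w} v∈
  with _ , _ , y∈ , v∈′ , ≡.refl ← ∈-cartesianProductWith⁻ _∷_ (upTo (suc x)) _ v∈ =
  ≡.cong₂ _∷_ (ℕ.m+[n∸m]≡n (ℕ.s≤s⁻¹ (∈-upTo⁻ y∈))) (∈-below⁻ v∈′)

∈-below⁺ : ∀ {m} (v w : Exponent m) → v ∈ below (v ⊕ w)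
∈-below⁺ []      []      = here ≡.refl
∈-below⁺ (x ∷ v) (y ∷ w) = ∈-cartesianProductWith⁺ _∷_ (∈-upTo⁺ (ℕ.s≤s (ℕ.m≤m+n x y))) (∈-below⁺ v w)

below-unique : ∀ {m} (w : Exponent m) → Unique (below w)
below-unique []      = [] ∷ []
below-unique (x ∷ w) = cartesianProductWith⁺ _∷_ ∷-injective (upTo⁺ (suc x)) (below-unique w)

private
  ∈-box : ∀ {m k} (u : Exponent m) → Vec.sum u ≤ k → u ∈ below (Vec.replicate m k)
  ∈-box []      _   = here ≡.refl
  ∈-box (x ∷ u) u≤k = ∈-cartesianProductWith⁺ _∷_
    (∈-upTo⁺ (ℕ.s≤s (ℕ.m+n≤o⇒m≤o x u≤k))) (∈-box u (ℕ.m+n≤o⇒n≤o x u≤k))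

∈-B⁺ : ∀ {m} (u : Exponent m) {k} → Vec.sum u ≡ k → u ∈ B m k
∈-B⁺ u eq = ∈-filter⁺ _ (∈-box u (ℕ.≤-reflexive eq)) eq

∈-B⁻ : ∀ {m k} {u : Exponent m} → u ∈ B m k → Vec.sum u ≡ k
∈-B⁻ {m} {k} u∈ = proj₂ (∈-filter⁻ (λ u → Vec.sum u ℕ.≟ k) {xs = below (Vec.replicate m k)} u∈)

B-unique : ∀ m k → Unique (B m k)
B-unique m k = filter⁺ _ (below-unique (Vec.replicate m k))

simplex : ∀ m → ℕ → List (Exponent m)
simplex m b = concatMap (B m) (upTo (suc b))

∈-simplex⁺ : ∀ {m b} (u : Exponent m) → Vec.sum u ≤ b → u ∈ simplex m b
∈-simplex⁺ {m} u u≤b = ∈-concatMap⁺ (B m) (lose (∈-upTo⁺ (ℕ.s≤s u≤b)) (∈-B⁺ u ≡.refl))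

∈-simplex⁻ : ∀ {m b} {u : Exponent m} → u ∈ simplex m b → Vec.sum u ≤ b
∈-simplex⁻ {m} {b} u∈ with k , k∈ , u∈B ← find (∈-concatMap⁻ (B m) {xs = upTo (suc b)} u∈) =
  ≡.subst (_≤ b) (≡.sym (∈-B⁻ u∈B)) (ℕ.s≤s⁻¹ (∈-upTo⁻ k∈))

simplex-unique : ∀ m b → Unique (simplex m b)
simplex-unique m b = concat⁺ (All.map⁺ (All.tabulate λ {k} _ → B-unique m k))
  (AllPairs.map⁺ (AllPairs.map disjoint (upTo⁺ (suc b))))
  where
  disjoint : ∀ {i j} → i ≢ j → Disjoint (B m i) (B m j)
  disjoint i≢j (u∈i , u∈j) = i≢j (≡.trans (≡.sym (∈-B⁻ u∈i)) (∈-B⁻ u∈j))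

module Polynomials {c ℓ} (R : CommutativeRing c ℓ) where
  open CommutativeRing R
  open Sums R
  open SetoidReasoning setoid

  -- The index list `below u` depends on u, which blocks exchanging sums; a fixed simplex does not.
  -- The bracket removes those v that are not below u, where truncated subtraction gives a
  -- meaningless exponent.
  coeff-* : ∀ {m} (G H : Poly R m) (u : Exponent m) {b} → bound G ≤ b →
            coeff (G *ₚ H) u ≈ sumOver R (simplex m b) λ v →
              coeff G v * ([ v ⊕ (u ⊖ v) ≟ᵉ u ] * coeff H (u ⊖ v))
  coeff-* {m} G H u {b} G≤b = begin
    sumOver R (below u) (λ v → coeff G v * coeff H (u ⊖ v))
      ≈⟨ sum-cong-∈ (below u) (λ {v} v∈ → *-congˡ (sym (trans
           (*-congʳ ([]-yes (v ⊕ (u ⊖ v) ≟ᵉ u) (∈-below⁻ v∈))) (*-identityˡ _)))) ⟩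
    sumOver R (below u) term
      ≈⟨ sum-support _≟ᵉ_ term (below-unique u) (simplex-unique m b) below⇒ simplex⇒ ⟩
    sumOver R (simplex m b) term ∎
    where
    term : Exponent m → Carrier
    term v = coeff G v * ([ v ⊕ (u ⊖ v) ≟ᵉ u ] * coeff H (u ⊖ v))

    below⇒ : ∀ {v} → v ∈ below u → v ∈ simplex m b ⊎ term v ≈ 0#
    below⇒ {v} _ with ℕ.≤-<-connex (Vec.sum v) (bound G)
    ... | inj₁ v≤G = inj₁ (∈-simplex⁺ v (ℕ.≤-trans v≤G G≤b))
    ... | inj₂ G<v = inj₂ (trans (*-congʳ (vanish G v G<v)) (zeroˡ _))

    simplex⇒ : ∀ {v} → v ∈ simplex m b → v ∈ below u ⊎ term v ≈ 0#
    simplex⇒ {v} _ with v ⊕ (u ⊖ v) ≟ᵉ u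
    ... | yes eq = inj₁ (≡.subst (λ u′ → v ∈ below u′) eq (∈-below⁺ v (u ⊖ v)))
    ... | no _   = inj₂ (trans (*-congˡ (zeroˡ _)) (zeroʳ _))

  formal : ∀ {m} → Poly R m → FormalSum R (Exponent m)
  formal {m} G = map (λ u → coeff G u , u) (simplex m (bound G))

  homogeneous-* : ∀ {m d e} {G H : Poly R m} → Homogeneous d G → Homogeneous e H →
                  Homogeneous (d ℕ.+ e) (G *ₚ H)
  homogeneous-* {d = d} {e} {G} {H} hG hH u u≢ = sum-zero-∈ (below u) zero-term
    where
    zero-term : ∀ {v} → v ∈ below u → coeff G v * coeff H (u ⊖ v) ≈ 0#
    zero-term {v} v∈ with Vec.sum v ℕ.≟ d | Vec.sum (u ⊖ v) ℕ.≟ e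
    ... | no v≢d  | _      = trans (*-congʳ (hG v v≢d)) (zeroˡ _)
    ... | yes _   | no w≢e = trans (*-congˡ (hH (u ⊖ v) w≢e)) (zeroʳ _)
    ... | yes v≡d | yes w≡e = contradiction
      (≡.trans (≡.cong Vec.sum (≡.sym (∈-below⁻ v∈)))
        (≡.trans (sum-⊕ v (u ⊖ v)) (≡.cong₂ ℕ._+_ v≡d w≡e))) u≢

  monomial-coeff : ∀ {m} (w u : Exponent m) → coeff (monomial {R = R} w) u ≈ [ u ≟ᵉ w ]
  monomial-coeff w u with u ≟ᵉ w
  ... | yes _ = refl
  ... | no _  = refl

  sum-replicate-0 : ∀ m → Vec.sum (Vec.replicate m 0) ≡ 0
  sum-replicate-0 zero    = ≡.refl
  sum-replicate-0 (suc m) = sum-replicate-0 m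

  homogeneous-^ : ∀ {m d} {G : Poly R m} → Homogeneous d G → ∀ s → Homogeneous (s ℕ.* d) (G ^ₚ s)
  homogeneous-^ {m} h zero    u u≢0 = trans (monomial-coeff (Vec.replicate m 0) u)
    ([]-no (u ≟ᵉ Vec.replicate m 0) λ { ≡.refl → u≢0 (sum-replicate-0 m) })
  homogeneous-^ {G = G} h (suc s) = homogeneous-* {G = G} {H = G ^ₚ s} h (homogeneous-^ {G = G} h s)

module Evaluation {c₁ ℓ₁ c₂ ℓ₂} (R : CommutativeRing c₁ ℓ₁) (S : CommutativeRing c₂ ℓ₂)
                  {f : ⟨ R ⟩ → ⟨ S ⟩} (f-hom : IsRingHomomorphism R S f) where
  private module R = CommutativeRing R
  open CommutativeRing S
  private module f = RingMorphisms.IsRingHomomorphism f-hom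
  open Sums S
  open Pairing R S f-hom
  open Polynomials R
  open Exp commutativeSemiring using (_^_)
  open SetoidReasoning setoid

  pair-formal : ∀ {m} (G : Poly R m) (h : Exponent m → Carrier) →
                pair (formal G) h ≈ sumOver S (simplex m (bound G)) λ u → f (coeff G u) * h u
  pair-formal {m} G h = sum-map (λ u → coeff G u , u) (simplex m (bound G)) _

  private
    f-[] : ∀ {ℓp} {P : Set ℓp} (d : Dec P) → f (Sums.[_] R d) ≈ [ d ]
    f-[] (yes _) = f.1#-homo
    f-[] (no _)  = f.0#-homo

  module Multiplicative {m} (χ : Exponent m → Carrier)
                        (χ-⊕ : ∀ u v → χ (u ⊕ v) ≈ χ u * χ v)
                        (χ-0 : χ (Vec.replicate m 0) ≈ 1#) where

    -- Evaluation at a character χ of the exponent monoid is multiplicative: after the sums are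
    -- exchanged, u is replaced by v + w and χ(v + w) factors.
    pair-formal-* : (G H : Poly R m) → pair (formal (G *ₚ H)) χ ≈ pair (formal G) χ * pair (formal H) χ
    pair-formal-* G H = begin
      pair (formal (G *ₚ H)) χ
        ≈⟨ pair-formal (G *ₚ H) χ ⟩
      sumOver S Σ₀ (λ u → f (coeff (G *ₚ H) u) * χ u)
        ≈⟨ sum-cong Σ₀ (λ u → begin
             f (coeff (G *ₚ H) u) * χ u
               ≈⟨ *-congʳ (trans (f.⟦⟧-cong (coeff-* G H u ℕ.≤-refl)) (sum-homo R S f-hom Σ₁ _)) ⟩
             sumOver S Σ₁ (λ v → f (coeff G v R.* (Sums.[_] R (v ⊕ (u ⊖ v) ≟ᵉ u) R.* coeff H (u ⊖ v)))) * χ u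
               ≈⟨ sum-*ʳ (χ u) Σ₁ _ ⟩
             sumOver S Σ₁ (λ v → f (coeff G v R.* (Sums.[_] R (v ⊕ (u ⊖ v) ≟ᵉ u) R.* coeff H (u ⊖ v))) * χ u)
               ≈⟨ sum-cong Σ₁ (λ v → trans (*-congʳ (trans (f.*-homo _ _) (*-congˡ (trans (f.*-homo _ _)
                    (*-congʳ (f-[] (v ⊕ (u ⊖ v) ≟ᵉ u))))))) (trans (*-assoc _ _ _) (*-congˡ (*-assoc _ _ _)))) ⟩
             sumOver S Σ₁ (λ v → f (coeff G v) * ([ v ⊕ (u ⊖ v) ≟ᵉ u ] * (f (coeff H (u ⊖ v)) * χ u))) ∎) ⟩
      sumOver S Σ₀ (λ u → sumOver S Σ₁ λ v → f (coeff G v) * ([ v ⊕ (u ⊖ v) ≟ᵉ u ] * (f (coeff H (u ⊖ v)) * χ u)))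
        ≈⟨ sum-comm Σ₀ Σ₁ _ ⟩
      sumOver S Σ₁ (λ v → sumOver S Σ₀ λ u → f (coeff G v) * ([ v ⊕ (u ⊖ v) ≟ᵉ u ] * (f (coeff H (u ⊖ v)) * χ u)))
        ≈⟨ sum-cong-∈ Σ₁ (λ {v} v∈ → trans (sym (sum-*ˡ _ Σ₀ _)) (*-congˡ (shift v (∈-simplex⁻ v∈)))) ⟩
      sumOver S Σ₁ (λ v → f (coeff G v) * (χ v * sumOver S Σ₂ λ w → f (coeff H w) * χ w))
        ≈⟨ sum-cong Σ₁ (λ v → sym (*-assoc _ _ _)) ⟩
      sumOver S Σ₁ (λ v → (f (coeff G v) * χ v) * sumOver S Σ₂ λ w → f (coeff H w) * χ w)
        ≈⟨ sum-*ʳ _ Σ₁ _ ⟨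
      sumOver S Σ₁ (λ v → f (coeff G v) * χ v) * sumOver S Σ₂ (λ w → f (coeff H w) * χ w)
        ≈⟨ *-cong (pair-formal G χ) (pair-formal H χ) ⟨
      pair (formal G) χ * pair (formal H) χ ∎
      where
      Σ₀ = simplex m (bound G ℕ.+ bound H)
      Σ₁ = simplex m (bound G)
      Σ₂ = simplex m (bound H)

      module _ (v : Exponent m) (v≤G : Vec.sum v ≤ bound G) where
        g : Exponent m → Carrier
        g w = f (coeff H w) * χ (v ⊕ w)

        g-support : ∀ w → w ∈ Σ₂ ⊎ g w ≈ 0#
        g-support w with ℕ.≤-<-connex (Vec.sum w) (bound H)
        ... | inj₁ w≤H = inj₁ (∈-simplex⁺ w w≤H)
        ... | inj₂ H<w = inj₂ (trans (*-congʳ (trans (f.⟦⟧-cong (vanish H w H<w)) f.0#-homo)) (zeroˡ _))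

        -- Writing the term as a sum over w with the condition u = v + w performs the substitution
        -- by means of a delta function.
        spread : ∀ u → [ v ⊕ (u ⊖ v) ≟ᵉ u ] * (f (coeff H (u ⊖ v)) * χ u) ≈
                       sumOver S Σ₂ λ w → [ u ≟ᵉ v ⊕ w ] * g w
        spread u with v ⊕ (u ⊖ v) ≟ᵉ u
        ... | yes eq = begin
          1# * (f (coeff H (u ⊖ v)) * χ u)              ≡⟨ ≡.cong (λ u′ → 1# * (f (coeff H (u ⊖ v)) * χ u′)) eq ⟨
          1# * g (u ⊖ v)                                ≈⟨ *-identityˡ _ ⟩
          g (u ⊖ v)                                     ≈⟨ sum-δ-⊎ _≟ᵉ_ (u ⊖ v) g (simplex-unique m (bound H)) (g-support (u ⊖ v)) ⟨
          sumOver S Σ₂ (λ w → [ w ≟ᵉ u ⊖ v ] * g w)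
            ≈⟨ sum-cong Σ₂ (λ w → *-congʳ ([]-cong (w ≟ᵉ u ⊖ v) (u ≟ᵉ v ⊕ w)
                 (λ { ≡.refl → ≡.sym eq })
                 (λ u≡ → ⊕-cancelˡ v (≡.trans (≡.sym u≡) (≡.sym eq))))) ⟩
          sumOver S Σ₂ (λ w → [ u ≟ᵉ v ⊕ w ] * g w)     ∎
        ... | no ¬eq = trans (zeroˡ _) (sym (sum-zero Σ₂ λ w → trans
          (*-congʳ ([]-no (u ≟ᵉ v ⊕ w) λ { ≡.refl → ¬eq (≡.cong (v ⊕_) (⊕-⊖-cancel v w)) }))
          (zeroˡ _)))

        shift : sumOver S Σ₀ (λ u → [ v ⊕ (u ⊖ v) ≟ᵉ u ] * (f (coeff H (u ⊖ v)) * χ u)) ≈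
                χ v * sumOver S Σ₂ λ w → f (coeff H w) * χ w
        shift = begin
          sumOver S Σ₀ (λ u → [ v ⊕ (u ⊖ v) ≟ᵉ u ] * (f (coeff H (u ⊖ v)) * χ u))
            ≈⟨ trans (sum-cong Σ₀ spread) (sum-comm Σ₀ Σ₂ _) ⟩
          sumOver S Σ₂ (λ w → sumOver S Σ₀ λ u → [ u ≟ᵉ v ⊕ w ] * g w)
            ≈⟨ sum-cong-∈ Σ₂ (λ {w} w∈ → sum-δ _≟ᵉ_ (v ⊕ w) (λ _ → g w) (simplex-unique m (bound G ℕ.+ bound H))
                 (∈-simplex⁺ (v ⊕ w) (≡.subst (_≤ bound G ℕ.+ bound H) (≡.sym (sum-⊕ v w))
                   (ℕ.+-mono-≤ v≤G (∈-simplex⁻ w∈))))) ⟩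
          sumOver S Σ₂ g
            ≈⟨ sum-cong Σ₂ (λ w → trans (*-congˡ (χ-⊕ v w)) (x∙yz≈y∙xz _ _ _)) ⟩
          sumOver S Σ₂ (λ w → χ v * (f (coeff H w) * χ w))
            ≈⟨ sum-*ˡ _ Σ₂ _ ⟨
          χ v * sumOver S Σ₂ (λ w → f (coeff H w) * χ w) ∎
          where open import Algebra.Properties.CommutativeSemigroup *-commutativeSemigroup using (x∙yz≈y∙xz)

    pair-formal-^ : (G : Poly R m) (s : ℕ) → pair (formal (G ^ₚ s)) χ ≈ pair (formal G) χ ^ s
    pair-formal-^ G (suc s) = trans (pair-formal-* G (G ^ₚ s)) (*-congˡ (pair-formal-^ G s))
    pair-formal-^ G zero    = begin
      pair (formal (monomial {R = R} 𝟎)) χ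
        ≈⟨ pair-formal (monomial {R = R} 𝟎) χ ⟩
      sumOver S (simplex m (Vec.sum 𝟎)) (λ u → f (coeff (monomial {R = R} 𝟎) u) * χ u)
        ≈⟨ sum-cong (simplex m (Vec.sum 𝟎)) (λ u → *-congʳ
             (trans (f.⟦⟧-cong (monomial-coeff 𝟎 u)) (f-[] (u ≟ᵉ 𝟎)))) ⟩
      sumOver S (simplex m (Vec.sum 𝟎)) (λ u → [ u ≟ᵉ 𝟎 ] * χ u)
        ≈⟨ sum-δ _≟ᵉ_ 𝟎 χ (simplex-unique m (Vec.sum 𝟎)) (∈-simplex⁺ 𝟎 ℕ.≤-refl) ⟩
      χ 𝟎
        ≈⟨ χ-0 ⟩
      1# ∎
      where 𝟎 = Vec.replicate m 0

-- The trace of A_Hⁱ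

-- By definition `iterate` peels off the innermost application. That suits `φ^`, whose innermost φ
-- meets the φ⁻¹ of ψ, but for A the outermost application is needed.
iterate-suc : ∀ {a} {X : Set a} (f : X → X) (x : X) n → iterate f x (suc n) ≡ f (iterate f x n)
iterate-suc f x zero    = ≡.refl
iterate-suc f x (suc n) = iterate-suc f (f x) n

⊕-assoc : ∀ {m} (u v w : Exponent m) → (u ⊕ v) ⊕ w ≡ u ⊕ (v ⊕ w)
⊕-assoc []      []      []      = ≡.refl
⊕-assoc (x ∷ u) (y ∷ v) (z ∷ w) = ≡.cong₂ _∷_ (ℕ.+-assoc x y z) (⊕-assoc u v w)

⊕-identityˡ : ∀ {m} (u : Exponent m) → Vec.replicate m 0 ⊕ u ≡ u
⊕-identityˡ []      = ≡.refl
⊕-identityˡ (x ∷ u) = ≡.cong (x ∷_) (⊕-identityˡ u)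

⊙-distrib-⊕ : ∀ {m} c (u v : Exponent m) → c ⊙ (u ⊕ v) ≡ c ⊙ u ⊕ c ⊙ v
⊙-distrib-⊕ c []      []      = ≡.refl
⊙-distrib-⊕ c (x ∷ u) (y ∷ v) = ≡.cong₂ _∷_ (ℕ.*-distribˡ-+ c x y) (⊙-distrib-⊕ c u v)

⊙-assoc : ∀ {m} c d (u : Exponent m) → c ⊙ d ⊙ u ≡ (c ℕ.* d) ⊙ u
⊙-assoc c d []      = ≡.refl
⊙-assoc c d (x ∷ u) = ≡.cong₂ _∷_ (≡.sym (ℕ.*-assoc c d x)) (⊙-assoc c d u)

⊙-identityˡ : ∀ {m} (u : Exponent m) → 1 ⊙ u ≡ u
⊙-identityˡ []      = ≡.refl
⊙-identityˡ (x ∷ u) = ≡.cong₂ _∷_ (ℕ.*-identityˡ x) (⊙-identityˡ u)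

-- The equation forces cu ≤ cw entrywise, hence u ≤ w, so the truncated subtraction is exact.
⊙-⊕-⊖ : ∀ {m} c .{{_ : NonZero c}} (u v w : Exponent m) → c ⊙ u ⊕ v ≡ c ⊙ w → u ⊕ (w ⊖ u) ≡ w
⊙-⊕-⊖ c []      []      []      _  = ≡.refl
⊙-⊕-⊖ c (x ∷ u) (y ∷ v) (z ∷ w) eq with eq₁ , eq₂ ← ∷-injective eq = ≡.cong₂ _∷_
  (ℕ.m+[n∸m]≡n (ℕ.*-cancelˡ-≤ c (≡.subst (c ℕ.* x ≤_) eq₁ (ℕ.m≤m+n (c ℕ.* x) y))))
  (⊙-⊕-⊖ c u v w eq₂)

⊙-cancelˡ : ∀ {m} c .{{_ : NonZero c}} (u v : Exponent m) → c ⊙ u ≡ c ⊙ v → u ≡ v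
⊙-cancelˡ c []      []      _  = ≡.refl
⊙-cancelˡ c (x ∷ u) (y ∷ v) eq with eq₁ , eq₂ ← ∷-injective eq =
  ≡.cong₂ _∷_ (ℕ.*-cancelˡ-≡ x y c eq₁) (⊙-cancelˡ c u v eq₂)

⊙-suc : ∀ {m} c (u : Exponent m) → c ⊙ u ⊕ u ≡ suc c ⊙ u
⊙-suc c []      = ≡.refl
⊙-suc c (x ∷ u) = ≡.cong₂ _∷_ (ℕ.+-comm (c ℕ.* x) x) (⊙-suc c u)

⊕-cancelʳ : ∀ {m} (u v w : Exponent m) → u ⊕ w ≡ v ⊕ w → u ≡ v
⊕-cancelʳ []      []      []      _  = ≡.refl
⊕-cancelʳ (x ∷ u) (y ∷ v) (z ∷ w) eq with eq₁ , eq₂ ← ∷-injective eq =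
  ≡.cong₂ _∷_ (ℕ.+-cancelʳ-≡ z x y eq₁) (⊕-cancelʳ u v w eq₂)

-- Divisibility of all entries of u by c, in a form that provides the quotient.
multiple? : ∀ {m} c .{{_ : NonZero c}} (u : Exponent m) → Dec (c ⊙ Vec.map (_/ c) u ≡ u)
multiple? c u = c ⊙ Vec.map (_/ c) u ≟ᵉ u

⊙-/ : ∀ {m} c .{{_ : NonZero c}} (u : Exponent m) → Vec.map (_/ c) (c ⊙ u) ≡ u
⊙-/ c []      = ≡.refl
⊙-/ c (x ∷ u) = ≡.cong₂ _∷_ (≡.trans (≡.cong (_/ c) (ℕ.*-comm c x)) (m*n/n≡m x c)) (⊙-/ c u)

module FrobeniusTrace {p c ℓ q} {k : FiniteField c ℓ q} {c′ ℓ′} {W : WittVectors p k c′ ℓ′}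
                      (p-prime : Prime p) (Φ : Frobenius W) where
  private
    R = WittVectors.commutativeRing W
    instance
      p-nonZero : NonZero p
      p-nonZero = prime⇒nonZero p-prime
  open CommutativeRing R
  open Frobenius Φ using (φ; φ⁻¹; surjective; injective; isRingHomomorphism)
  open Sums R
  open Polynomials R
  open Pairing R R (Identity.isRingHomomorphism rawRing refl)
  open SetoidReasoning setoid

  φ^ : ℕ → Carrier → Carrier
  φ^ i x = iterate φ x i

  φ^-hom : ∀ i → IsRingHomomorphism R R (φ^ i)
  φ^-hom zero    = Identity.isRingHomomorphism rawRing refl
  φ^-hom (suc i) = Composition.isRingHomomorphism trans isRingHomomorphism (φ^-hom i)

  φ^-injective : ∀ i {x y} → φ^ i x ≈ φ^ i y → x ≈ y
  φ^-injective zero    eq = eq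
  φ^-injective (suc i) eq = injective (φ^-injective i eq)

  φ^-surjective : ∀ i y → ∃ λ x → φ^ i x ≈ y
  φ^-surjective zero    y = y , refl
  φ^-surjective (suc i) y with x , eq ← φ^-surjective i y = φ⁻¹ x ,
    trans (RingMorphisms.IsRingHomomorphism.⟦⟧-cong (φ^-hom i) (proj₂ (surjective x) refl)) eq

  module _ {m : ℕ} where
    private 𝟎 = Vec.replicate m 0

    twist : ℕ → FormalSum R (Exponent m) → FormalSum R (Exponent m)
    twist i = map λ x → φ^ i (proj₁ x) , (p ℕ.^ i) ⊙ proj₂ x

    -- The formal sum of the polynomial ∏_{j<i} φʲ(K), where φ also raises the
    -- variables to the p-th power; moving all ψ to the left turns A_Hⁱ into ψⁱ
    -- after multiplication by it, for K = H^(p-1).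
    frobeniusProduct : Poly R m → ℕ → FormalSum R (Exponent m)
    frobeniusProduct K zero    = (1# , 𝟎) ∷ []
    frobeniusProduct K (suc i) = convolve R _⊕_ (twist i (formal K)) (frobeniusProduct K i)

    module _ (H : Poly R m) (w : Exponent m) where
      private K = H ^ₚ (p ∸ 1)

      A^ : ℕ → Poly R m
      A^ = iterate (A p-prime Φ H) (monomial w)

      -- Up to the twist of coefficients, the coefficient of xᵘ after ψⁱ is the one at pⁱu before
      -- it; applying φⁱ removes the twist. What remains is the coefficient at pⁱu of the Frobenius
      -- product times xʷ.
      A^-coeff : ∀ i u → φ^ i (coeff (A^ i) u) ≈
                 pair (frobeniusProduct K i) λ v → [ v ⊕ w ≟ᵉ (p ℕ.^ i) ⊙ u ]
      A^-coeff zero u = begin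
        coeff (monomial {R = R} w) u                 ≈⟨ monomial-coeff w u ⟩
        [ u ≟ᵉ w ]
          ≈⟨ []-cong (u ≟ᵉ w) (𝟎 ⊕ w ≟ᵉ 1 ⊙ u)
               (λ { ≡.refl → ≡.trans (⊕-identityˡ u) (≡.sym (⊙-identityˡ u)) })
               (λ eq → ≡.trans (≡.sym (⊙-identityˡ u)) (≡.trans (≡.sym eq) (⊕-identityˡ w))) ⟩
        [ 𝟎 ⊕ w ≟ᵉ 1 ⊙ u ]                           ≈⟨ *-identityˡ _ ⟨
        1# * [ 𝟎 ⊕ w ≟ᵉ 1 ⊙ u ]                      ≈⟨ +-identityʳ _ ⟨
        pair (frobeniusProduct K 0) (λ v → [ v ⊕ w ≟ᵉ 1 ⊙ u ]) ∎
      A^-coeff (suc i) u = begin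
        φ^ (suc i) (coeff (A^ (suc i)) u)
          ≡⟨ ≡.cong (λ G → φ^ (suc i) (coeff G u)) (iterate-suc (A p-prime Φ H) (monomial w) i) ⟩
        φ^ i (φ (φ⁻¹ (coeff (K *ₚ A^ i) (p ⊙ u))))
          ≈⟨ φ^ᵢ.⟦⟧-cong (proj₂ (surjective _) refl) ⟩
        φ^ i (coeff (K *ₚ A^ i) (p ⊙ u))
          ≈⟨ φ^ᵢ.⟦⟧-cong (coeff-* K (A^ i) (p ⊙ u) ℕ.≤-refl) ⟩
        φ^ i (sumOver R Σ₁ λ v → coeff K v * ([ below? v ] * coeff (A^ i) (p ⊙ u ⊖ v)))
          ≈⟨ sum-homo R R (φ^-hom i) Σ₁ _ ⟩
        sumOver R Σ₁ (λ v → φ^ i (coeff K v * ([ below? v ] * coeff (A^ i) (p ⊙ u ⊖ v))))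
          ≈⟨ sum-cong Σ₁ (λ v → trans (φ^ᵢ.*-homo _ _) (*-congˡ (step v))) ⟩
        sumOver R Σ₁ (λ v → φ^ i (coeff K v) * h ((p ℕ.^ i) ⊙ v))
          ≈⟨ trans (sum-map _ (formal K) (λ x → proj₁ x * h (proj₂ x)))
                   (sum-map (λ v → coeff K v , v) Σ₁ _) ⟨
        pair (twist i (formal K)) h
          ≈⟨ pair-convolve _⊕_ (twist i (formal K)) (frobeniusProduct K i) _ ⟨
        pair (frobeniusProduct K (suc i)) (λ v → [ v ⊕ w ≟ᵉ (p ℕ.^ suc i) ⊙ u ]) ∎
        where
        module φ^ᵢ = RingMorphisms.IsRingHomomorphism (φ^-hom i)
        Σ₁ = simplex m (bound K)

        instance
          p^i-nonZero : NonZero (p ℕ.^ i)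
          p^i-nonZero = ℕ.m^n≢0 p i

        below? : ∀ v → Dec (v ⊕ (p ⊙ u ⊖ v) ≡ p ⊙ u)
        below? v = v ⊕ (p ⊙ u ⊖ v) ≟ᵉ p ⊙ u

        h : Exponent m → Carrier
        h v = pair (frobeniusProduct K i) λ v′ → [ (v ⊕ v′) ⊕ w ≟ᵉ (p ℕ.^ suc i) ⊙ u ]

        φ^-[] : ∀ {P : Set} (d : Dec P) → φ^ i [ d ] ≈ [ d ]
        φ^-[] (yes _) = φ^ᵢ.1#-homo
        φ^-[] (no _)  = φ^ᵢ.0#-homo

        p^suc : (p ℕ.^ i) ⊙ p ⊙ u ≡ (p ℕ.^ suc i) ⊙ u
        p^suc = ≡.trans (⊙-assoc (p ℕ.^ i) p u) (≡.cong (_⊙ u) (ℕ.*-comm (p ℕ.^ i) p))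

        -- The two conditions v ≤ pu and v′ + w = pⁱ(pu - v) merge into pⁱv + v′ + w = pⁱ⁺¹u, which
        -- implies the inequality by itself.
        combine : ∀ v v′ → [ below? v ] * [ v′ ⊕ w ≟ᵉ (p ℕ.^ i) ⊙ (p ⊙ u ⊖ v) ] ≈
                  [ ((p ℕ.^ i) ⊙ v ⊕ v′) ⊕ w ≟ᵉ (p ℕ.^ suc i) ⊙ u ]
        combine v v′ with below? v
        ... | no ¬below = trans (zeroˡ _) (sym ([]-no (((p ℕ.^ i) ⊙ v ⊕ v′) ⊕ w ≟ᵉ (p ℕ.^ suc i) ⊙ u)
          λ eq → ¬below (⊙-⊕-⊖ (p ℕ.^ i) v (v′ ⊕ w) (p ⊙ u)
            (≡.trans (≡.sym (⊕-assoc _ v′ w)) (≡.trans eq (≡.sym p^suc))))))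
        ... | yes below = trans (*-identityˡ _) ([]-cong (v′ ⊕ w ≟ᵉ (p ℕ.^ i) ⊙ (p ⊙ u ⊖ v))
            (((p ℕ.^ i) ⊙ v ⊕ v′) ⊕ w ≟ᵉ (p ℕ.^ suc i) ⊙ u)
            (λ eq → ≡.trans (⊕-assoc _ v′ w) (≡.trans (≡.cong ((p ℕ.^ i) ⊙ v ⊕_) eq) split))
            (λ eq → ⊕-cancelˡ ((p ℕ.^ i) ⊙ v)
              (≡.trans (≡.sym (⊕-assoc _ v′ w)) (≡.trans eq (≡.sym split)))))
          where
          split : (p ℕ.^ i) ⊙ v ⊕ (p ℕ.^ i) ⊙ (p ⊙ u ⊖ v) ≡ (p ℕ.^ suc i) ⊙ u
          split = ≡.trans (≡.sym (⊙-distrib-⊕ (p ℕ.^ i) v _))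
            (≡.trans (≡.cong ((p ℕ.^ i) ⊙_) below) p^suc)

        step : ∀ v → φ^ i ([ below? v ] * coeff (A^ i) (p ⊙ u ⊖ v)) ≈ h ((p ℕ.^ i) ⊙ v)
        step v = begin
          φ^ i ([ below? v ] * coeff (A^ i) (p ⊙ u ⊖ v))
            ≈⟨ trans (φ^ᵢ.*-homo _ _) (*-cong (φ^-[] (below? v)) (A^-coeff i (p ⊙ u ⊖ v))) ⟩
          [ below? v ] * pair (frobeniusProduct K i) (λ v′ → [ v′ ⊕ w ≟ᵉ (p ℕ.^ i) ⊙ (p ⊙ u ⊖ v) ])
            ≈⟨ trans (pair-*ˡ _ (frobeniusProduct K i) _) (pair-cong (frobeniusProduct K i) (combine v)) ⟩
          h ((p ℕ.^ i) ⊙ v) ∎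

    -- Zero coefficients may carry any exponent, because `formal` lists all exponents up to the
    -- degree bound.
    Supported : ℕ → FormalSum R (Exponent m) → Set (c′ ⊔ ℓ′)
    Supported D = All λ x → Vec.sum (proj₂ x) ≡ D ⊎ proj₁ x ≈ 0#

    formal-supported : ∀ {D} (K : Poly R m) → Homogeneous D K → Supported D (formal K)
    formal-supported {D} K hom = All.map⁺ (All.universal supported (simplex m (bound K)))
      where
      supported : ∀ u → Vec.sum u ≡ D ⊎ coeff K u ≈ 0#
      supported u with Vec.sum u ℕ.≟ D
      ... | yes eq = inj₁ eq
      ... | no ≢D  = inj₂ (hom u ≢D)

    private
      convolve-supported : ∀ {D E} {P Q : FormalSum R (Exponent m)} → Supported D P → Supported E Q →
                           Supported (D ℕ.+ E) (convolve R _⊕_ P Q)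
      convolve-supported []       _ = []
      convolve-supported {D} {E} {P = (x , u) ∷ P} (h ∷ hs) ks =
        All.++⁺ (All.map⁺ (All.map (both h) ks)) (convolve-supported hs ks)
        where
        both : ∀ {y} → Vec.sum u ≡ D ⊎ x ≈ 0# → Vec.sum (proj₂ y) ≡ E ⊎ proj₁ y ≈ 0# →
               Vec.sum (u ⊕ proj₂ y) ≡ D ℕ.+ E ⊎ x * proj₁ y ≈ 0#
        both         (inj₂ x≈0) _          = inj₂ (trans (*-congʳ x≈0) (zeroˡ _))
        both         (inj₁ _)   (inj₂ y≈0) = inj₂ (trans (*-congˡ y≈0) (zeroʳ _))
        both {_ , v} (inj₁ eq)  (inj₁ eq′) = inj₁ (≡.trans (sum-⊕ u v) (≡.cong₂ ℕ._+_ eq eq′))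

      twist-supported : ∀ i {D} {P : FormalSum R (Exponent m)} → Supported D P →
                        Supported (p ℕ.^ i ℕ.* D) (twist i P)
      twist-supported i {D} hs = All.map⁺ (All.map (λ {x} → scaled x) hs)
        where
        scaled : ∀ x → Vec.sum (proj₂ x) ≡ D ⊎ proj₁ x ≈ 0# →
                 Vec.sum ((p ℕ.^ i) ⊙ proj₂ x) ≡ p ℕ.^ i ℕ.* D ⊎ φ^ i (proj₁ x) ≈ 0#
        scaled (_ , u) (inj₁ eq) = inj₁ (≡.trans (sum-⊙ (p ℕ.^ i) u) (≡.cong (p ℕ.^ i ℕ.*_) eq))
        scaled _       (inj₂ x≈0) = inj₂ (trans (RingMorphisms.IsRingHomomorphism.⟦⟧-cong (φ^-hom i) x≈0)
          (RingMorphisms.IsRingHomomorphism.0#-homo (φ^-hom i)))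

    -- The factors have degrees pʲ(p - 1)D for j < i, a geometric sum.
    frobeniusProduct-supported : ∀ {D} (K : Poly R m) → Homogeneous ((p ∸ 1) ℕ.* D) K → ∀ i →
                                 Supported ((p ℕ.^ i ∸ 1) ℕ.* D) (frobeniusProduct K i)
    frobeniusProduct-supported K hom zero = inj₁ (sum-replicate-0 m) ∷ []
    frobeniusProduct-supported {D} K hom (suc i) = ≡.subst
      (λ E → Supported E (frobeniusProduct K (suc i))) degree
      (convolve-supported (twist-supported i (formal-supported K hom)) (frobeniusProduct-supported K hom i))
      where
      degree : p ℕ.^ i ℕ.* ((p ∸ 1) ℕ.* D) ℕ.+ (p ℕ.^ i ∸ 1) ℕ.* D ≡ (p ℕ.^ suc i ∸ 1) ℕ.* D
      degree = ≡.trans (≡.cong (ℕ._+ (p ℕ.^ i ∸ 1) ℕ.* D) (≡.sym (ℕ.*-assoc (p ℕ.^ i) (p ∸ 1) D)))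
        (≡.trans (≡.sym (ℕ.*-distribʳ-+ D (p ℕ.^ i ℕ.* (p ∸ 1)) (p ℕ.^ i ∸ 1)))
          (≡.cong (ℕ._* D) (≡.trans (≡.sym (ℕ.+-∸-assoc (p ℕ.^ i ℕ.* (p ∸ 1)) (ℕ.m^n>0 p i)))
            (≡.cong (_∸ 1) (≡.trans (ℕ.+-comm (p ℕ.^ i ℕ.* (p ∸ 1)) (p ℕ.^ i))
              (≡.trans (≡.sym (ℕ.*-suc (p ℕ.^ i) (p ∸ 1)))
                (≡.trans (≡.cong (p ℕ.^ i ℕ.*_) (ℕ.suc-pred p)) (ℕ.*-comm (p ℕ.^ i) p))))))))

    -- A diagonal entry picks the exponents v with v + w = pⁱw, that is v = (pⁱ - 1)w. So v
    -- determines w, which exists exactly if pⁱ - 1 divides v, and the degree of v then places w in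
    -- `B m D`.
    φ^-trace : ∀ {D} (H : Poly R m) → Homogeneous D H → ∀ i .{{_ : NonZero (p ℕ.^ i ∸ 1)}} →
               φ^ i (trace D (λ G → iterate (A p-prime Φ H) G i)) ≈
               pair (frobeniusProduct (H ^ₚ (p ∸ 1)) i) λ v → [ multiple? (p ℕ.^ i ∸ 1) v ]
    φ^-trace {D} H hom i = begin
      φ^ i (trace D (λ G → iterate (A p-prime Φ H) G i))
        ≈⟨ sum-homo R R (φ^-hom i) (B m D) _ ⟩
      sumOver R (B m D) (λ w → φ^ i (coeff (A^ H w i) w))
        ≈⟨ sum-cong (B m D) (λ w → A^-coeff H w i w) ⟩
      sumOver R (B m D) (λ w → pair X λ v → [ v ⊕ w ≟ᵉ (p ℕ.^ i) ⊙ w ])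
        ≈⟨ pair-sum X (B m D) (λ w v → [ v ⊕ w ≟ᵉ (p ℕ.^ i) ⊙ w ]) ⟩
      pair X (λ v → sumOver R (B m D) λ w → [ v ⊕ w ≟ᵉ (p ℕ.^ i) ⊙ w ])
        ≈⟨ sum-cong-∈ X (λ {x} x∈ → term x (All.lookup
             (frobeniusProduct-supported (H ^ₚ (p ∸ 1)) (homogeneous-^ {G = H} hom (p ∸ 1)) i) x∈)) ⟩
      pair X (λ v → [ multiple? (p ℕ.^ i ∸ 1) v ]) ∎
      where
      X = frobeniusProduct (H ^ₚ (p ∸ 1)) i
      c₀ = p ℕ.^ i ∸ 1

      suc-c₀ : suc c₀ ≡ p ℕ.^ i
      suc-c₀ = ℕ.suc-pred (p ℕ.^ i) {{ℕ.m^n≢0 p i}}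

      difference : ∀ v w → v ⊕ w ≡ (p ℕ.^ i) ⊙ w → v ≡ c₀ ⊙ w
      difference v w eq = ⊕-cancelʳ v (c₀ ⊙ w) w
        (≡.trans eq (≡.sym (≡.trans (⊙-suc c₀ w) (≡.cong (_⊙ w) suc-c₀))))

      difference⁻ : ∀ w → c₀ ⊙ w ⊕ w ≡ (p ℕ.^ i) ⊙ w
      difference⁻ w = ≡.trans (⊙-suc c₀ w) (≡.cong (_⊙ w) suc-c₀)

      count : ∀ v → Vec.sum v ≡ c₀ ℕ.* D →
              sumOver R (B m D) (λ w → [ v ⊕ w ≟ᵉ (p ℕ.^ i) ⊙ w ]) ≈ [ multiple? c₀ v ]
      count v |v| with multiple? c₀ v
      ... | no ¬mult = sum-zero (B m D) λ w → []-no (v ⊕ w ≟ᵉ (p ℕ.^ i) ⊙ w) λ eq →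
        let v≡ = difference v w eq in
        ¬mult (≡.trans (≡.cong (λ z → c₀ ⊙ Vec.map (_/ c₀) z) v≡)
          (≡.trans (≡.cong (c₀ ⊙_) (⊙-/ c₀ w)) (≡.sym v≡)))
      ... | yes mult = begin
        sumOver R (B m D) (λ w → [ v ⊕ w ≟ᵉ (p ℕ.^ i) ⊙ w ])
          ≈⟨ sum-cong (B m D) (λ w → trans ([]-cong (v ⊕ w ≟ᵉ (p ℕ.^ i) ⊙ w) (w ≟ᵉ v/)
               (λ eq → ⊙-cancelˡ c₀ w v/ (≡.trans (≡.sym (difference v w eq)) (≡.sym mult)))
               (λ { ≡.refl → ≡.trans (≡.cong (_⊕ w) (≡.sym mult)) (difference⁻ w) }))
             (sym (*-identityʳ _))) ⟩
        sumOver R (B m D) (λ w → [ w ≟ᵉ v/ ] * 1#)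
          ≈⟨ sum-δ _≟ᵉ_ v/ (λ _ → 1#) (B-unique m D) (∈-B⁺ v/ (ℕ.*-cancelˡ-≡ _ D c₀
               (≡.trans (≡.sym (sum-⊙ c₀ v/)) (≡.trans (≡.cong Vec.sum mult) |v|)))) ⟩
        1# ∎
        where v/ = Vec.map (_/ c₀) v

      term : ∀ x → Vec.sum (proj₂ x) ≡ c₀ ℕ.* D ⊎ proj₁ x ≈ 0# →
             proj₁ x * sumOver R (B m D) (λ w → [ proj₂ x ⊕ w ≟ᵉ (p ℕ.^ i) ⊙ w ]) ≈
             proj₁ x * [ multiple? c₀ (proj₂ x) ]
      term x (inj₁ eq)  = *-congˡ (count (proj₂ x) eq)
      term x (inj₂ x≈0) = trans (*-congʳ x≈0) (trans (zeroˡ _) (sym (trans (*-congʳ x≈0) (zeroˡ _))))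

-- The polynomial with coefficients α

private
  module ΣZ = Sums ℤ.+-*-commutativeRing

fallingFactorial-suc : ∀ x t → fallingFactorial (1ℤ ℤ.+ x) (suc t) ≡ (1ℤ ℤ.+ x) ℤ.* fallingFactorial x t
fallingFactorial-suc x zero    =
  solve 1 (λ x → con 1ℤ :* ((con 1ℤ :+ x) :- con 0ℤ) := (con 1ℤ :+ x) :* con 1ℤ) ≡.refl x
  where open ℤ.+-*-Solver
fallingFactorial-suc x (suc t) = begin
  fallingFactorial (1ℤ ℤ.+ x) (suc t) ℤ.* ((1ℤ ℤ.+ x) ℤ.- (1ℤ ℤ.+ + t))
    ≡⟨ ≡.cong (ℤ._* ((1ℤ ℤ.+ x) ℤ.- (1ℤ ℤ.+ + t))) (fallingFactorial-suc x t) ⟩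
  (1ℤ ℤ.+ x) ℤ.* fallingFactorial x t ℤ.* ((1ℤ ℤ.+ x) ℤ.- (1ℤ ℤ.+ + t))
    ≡⟨ solve 3 (λ x f t → (con 1ℤ :+ x) :* f :* ((con 1ℤ :+ x) :- (con 1ℤ :+ t))
                        := (con 1ℤ :+ x) :* (f :* (x :- t))) ≡.refl x (fallingFactorial x t) (+ t) ⟩
  (1ℤ ℤ.+ x) ℤ.* (fallingFactorial x t ℤ.* (x ℤ.- + t)) ∎
  where
  open ≡.≡-Reasoning
  open ℤ.+-*-Solver

fallingFactorial-pascal : ∀ x t → fallingFactorial (1ℤ ℤ.+ x) (suc t) ≡
                          fallingFactorial x (suc t) ℤ.+ + suc t ℤ.* fallingFactorial x t
fallingFactorial-pascal x t = ≡.trans (fallingFactorial-suc x t)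
  (solve 3 (λ x f t → (con 1ℤ :+ x) :* f := f :* (x :- t) :+ (con 1ℤ :+ t) :* f)
    ≡.refl x (fallingFactorial x t) (+ t))
  where open ℤ.+-*-Solver

fallingFactorial-0 : ∀ t → fallingFactorial 0ℤ (suc t) ≡ 0ℤ
fallingFactorial-0 zero    = ≡.refl
fallingFactorial-0 (suc t) = ≡.cong (ℤ._* (0ℤ ℤ.- + suc t)) (fallingFactorial-0 t)

private
  MultipleOf! : ℕ → ℤ → Set
  MultipleOf! t i = ∃ λ z → i ≡ z ℤ.* + (t !)

  multiple-+ : ∀ {t i j} → MultipleOf! t i → MultipleOf! t j → MultipleOf! t (i ℤ.+ j)
  multiple-+ {t} (z , ≡.refl) (z′ , ≡.refl) = z ℤ.+ z′ , ≡.sym (ℤ.*-distribʳ-+ (+ (t !)) z z′)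

  multiple-neg : ∀ {t i} → MultipleOf! t i → MultipleOf! t (ℤ.- i)
  multiple-neg {t} (z , ≡.refl) = ℤ.- z , ℤ.neg-distribˡ-* z (+ (t !))

  -- Pascal's rule carries divisibility by (t + 1)! from x to x + 1 and, read backwards, from x + 1
  -- to x. Starting at 0, where the falling factorial vanishes, this reaches all integers.
  !∣fallingFactorial : ∀ t x → MultipleOf! t (fallingFactorial x t)
  !∣fallingFactorial zero    x = 1ℤ , ≡.refl
  !∣fallingFactorial (suc t) = integers
    where
    step : ∀ x → MultipleOf! (suc t) (+ suc t ℤ.* fallingFactorial x t)
    step x with z , eq ← !∣fallingFactorial t x = z , (begin
      + suc t ℤ.* fallingFactorial x t     ≡⟨ ≡.cong (+ suc t ℤ.*_) eq ⟩
      + suc t ℤ.* (z ℤ.* + (t !))          ≡⟨ solve 3 (λ s z f → s :* (z :* f) := z :* (s :* f)) ≡.refl (+ suc t) z (+ (t !)) ⟩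
      z ℤ.* (+ suc t ℤ.* + (t !))          ≡⟨ ≡.cong (z ℤ.*_) (ℤ.pos-* (suc t) (t !)) ⟨
      z ℤ.* + (suc t !)                    ∎)
      where
      open ≡.≡-Reasoning
      open ℤ.+-*-Solver

    down : ∀ x → MultipleOf! (suc t) (fallingFactorial (1ℤ ℤ.+ x) (suc t)) →
           MultipleOf! (suc t) (fallingFactorial x (suc t))
    down x h = ≡.subst (MultipleOf! (suc t)) (begin
      fallingFactorial (1ℤ ℤ.+ x) (suc t) ℤ.- + suc t ℤ.* fallingFactorial x t
        ≡⟨ ≡.cong (ℤ._- + suc t ℤ.* fallingFactorial x t) (fallingFactorial-pascal x t) ⟩
      fallingFactorial x (suc t) ℤ.+ + suc t ℤ.* fallingFactorial x t ℤ.- + suc t ℤ.* fallingFactorial x t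
        ≡⟨ solve 2 (λ a b → a :+ b :- b := a) ≡.refl (fallingFactorial x (suc t)) (+ suc t ℤ.* fallingFactorial x t) ⟩
      fallingFactorial x (suc t) ∎) (multiple-+ {suc t} h (multiple-neg {suc t} (step x)))
      where
      open ≡.≡-Reasoning
      open ℤ.+-*-Solver

    integers : ∀ x → MultipleOf! (suc t) (fallingFactorial x (suc t))
    integers (+ zero)       = 0ℤ , fallingFactorial-0 t
    integers (+ suc n)      = ≡.subst (MultipleOf! (suc t)) (≡.sym (fallingFactorial-pascal (+ n) t))
      (multiple-+ {suc t} (integers (+ n)) (step (+ n)))
    integers -[1+ zero ]    = down -[1+ zero ] (0ℤ , fallingFactorial-0 t)
    integers -[1+ suc n ]   = down -[1+ suc n ] (integers -[1+ n ])

  -- Division of a negative integer branches on the remainder in order to round down; for a multiple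
  -- of d only the branch with remainder zero is possible.
  *-/ℕ-cancel : ∀ z d .{{_ : NonZero d}} → (z ℤ.* + d) /ℕ d ≡ z
  *-/ℕ-cancel (+ m)    d = ≡.trans (≡.cong (_/ℕ d) (≡.sym (ℤ.pos-* m d))) (≡.cong +_ (m*n/n≡m m d))
  *-/ℕ-cancel -[1+ m ] d@(suc _) = lemma _ ≡.refl
    where
    lemma : ∀ k → suc k ≡ suc m ℕ.* d → -[1+ k ] /ℕ d ≡ -[1+ m ]
    lemma k eq with suc k % d in rem
    ... | zero  = ≡.cong (λ n → ℤ.- + n) (≡.trans (≡.cong (_/ d) eq) (m*n/n≡m (suc m) d))
    ... | suc _ with () ← ≡.trans (≡.sym rem) (≡.trans (≡.cong (_% d) eq) (m*n%n≡0 (suc m) d))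

binomial-* : ∀ x t → binomial x (+ t) ℤ.* + (t !) ≡ fallingFactorial x t
binomial-* x t with z , eq ← !∣fallingFactorial t x = ≡.trans
  (≡.cong (ℤ._* + (t !)) (≡.trans (≡.cong (λ i → (i /ℕ (t !)) {{t ℕ.!≢0}}) eq) (*-/ℕ-cancel z (t !) {{t ℕ.!≢0}})))
  (≡.sym eq)

binomial-zero : ∀ {x t} → fallingFactorial x t ≡ 0ℤ → binomial x (+ t) ≡ 0ℤ
binomial-zero {x} {t} eq = ≡.trans (≡.cong (λ i → (i /ℕ (t !)) {{t ℕ.!≢0}}) eq) (*-/ℕ-cancel 0ℤ (t !) {{t ℕ.!≢0}})

-- Since binomials with negative lower index are zero, the rule holds for every integer j, and the
-- index shifts in `γ` need no boundary cases. For j ≥ 0 it is checked after multiplication by (j +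
-- 1)!.
binomial-pascal : ∀ x j → binomial (1ℤ ℤ.+ x) (1ℤ ℤ.+ j) ≡ binomial x (1ℤ ℤ.+ j) ℤ.+ binomial x j
binomial-pascal x -[1+ zero ]  = ≡.refl
binomial-pascal x -[1+ suc n ] = ≡.refl
binomial-pascal x (+ t) = ℤ.*-cancelʳ-≡ _ _ (+ (suc t !)) {{ℤ.≢-nonZero (ℕ.≢-nonZero⁻¹ _ {{suc t ℕ.!≢0}} ∘ ℤ.+-injective)}} (begin
  binomial (1ℤ ℤ.+ x) (+ suc t) ℤ.* + (suc t !)
    ≡⟨ ≡.trans (binomial-* (1ℤ ℤ.+ x) (suc t)) (fallingFactorial-pascal x t) ⟩
  fallingFactorial x (suc t) ℤ.+ + suc t ℤ.* fallingFactorial x t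
    ≡⟨ ≡.cong₂ (λ a b → a ℤ.+ + suc t ℤ.* b) (binomial-* x (suc t)) (binomial-* x t) ⟨
  binomial x (+ suc t) ℤ.* + (suc t !) ℤ.+ + suc t ℤ.* (binomial x (+ t) ℤ.* + (t !))
    ≡⟨ ≡.cong (λ f → binomial x (+ suc t) ℤ.* f ℤ.+ + suc t ℤ.* (binomial x (+ t) ℤ.* + (t !))) (ℤ.pos-* (suc t) (t !)) ⟩
  binomial x (+ suc t) ℤ.* (+ suc t ℤ.* + (t !)) ℤ.+ + suc t ℤ.* (binomial x (+ t) ℤ.* + (t !))
    ≡⟨ solve 4 (λ a s f b → a :* (s :* f) :+ s :* (b :* f) := (a :+ b) :* (s :* f)) ≡.refl
         (binomial x (+ suc t)) (+ suc t) (+ (t !)) (binomial x (+ t)) ⟩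
  (binomial x (+ suc t) ℤ.+ binomial x (+ t)) ℤ.* (+ suc t ℤ.* + (t !))
    ≡⟨ ≡.cong ((binomial x (+ suc t) ℤ.+ binomial x (+ t)) ℤ.*_) (ℤ.pos-* (suc t) (t !)) ⟨
  (binomial x (+ suc t) ℤ.+ binomial x (+ t)) ℤ.* + (suc t !) ∎)
  where
  open ≡.≡-Reasoning
  open ℤ.+-*-Solver

fallingFactorial-> : ∀ {n t} → n < t → fallingFactorial (+ n) t ≡ 0ℤ
fallingFactorial-> {zero}  {suc t} _   = fallingFactorial-0 t
fallingFactorial-> {suc n} {suc t} n<t = ≡.trans (fallingFactorial-suc (+ n) t)
  (≡.trans (≡.cong (+ suc n ℤ.*_) (fallingFactorial-> (ℕ.s<s⁻¹ n<t))) (ℤ.*-zeroʳ (+ suc n)))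

private
  0-n-negative : ∀ x t → binomial x (-1ℤ ℤ.- + t) ≡ 0ℤ
  0-n-negative x zero    = ≡.refl
  0-n-negative x (suc t) = ≡.refl

  +∸ : ∀ {s t} → t ≤ s → + s ℤ.- + t ≡ + (s ∸ t)
  +∸ {s} {t} t≤s = ≡.trans (ℤ.m-n≡m⊖n s t) (ℤ.⊖-≥ t≤s)

  ∸-negative : ∀ {s t} x → s < t → binomial x (+ s ℤ.- + t) ≡ 0ℤ
  ∸-negative {s} {t} x s<t = ≡.trans
    (≡.cong (binomial x) (≡.trans (ℤ.m-n≡m⊖n s t) (ℤ.⊖-< s<t))) (negative (ℕ.m<n⇒0<n∸m s<t))
    where
    negative : ∀ {n} → 0 < n → binomial x (ℤ.- + n) ≡ 0ℤ
    negative {suc n} _ = ≡.refl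

  binomial-0 : ∀ s t → binomial 0ℤ (+ s ℤ.- + t) ≡ ΣZ.[ t ℕ.≟ s ]
  binomial-0 s t with ℕ.<-cmp t s
  ... | tri< t<s t≢s _ = ≡.trans (≡.trans (≡.cong (binomial 0ℤ) (+∸ (ℕ.<⇒≤ t<s)))
    (positive (ℕ.m<n⇒0<n∸m t<s))) (≡.sym (ΣZ.[]-no (t ℕ.≟ s) t≢s))
    where
    positive : ∀ {n} → 0 < n → binomial 0ℤ (+ n) ≡ 0ℤ
    positive {suc n} _ = binomial-zero {0ℤ} {suc n} (fallingFactorial-0 n)
  ... | tri≈ _ ≡.refl _ = ≡.trans (≡.cong (binomial 0ℤ) (ℤ.+-inverseʳ (+ s))) (≡.sym (ΣZ.[]-yes (s ℕ.≟ s) ≡.refl))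
  ... | tri> _ t≢s s<t = ≡.trans (∸-negative 0ℤ s<t) (≡.sym (ΣZ.[]-no (t ℕ.≟ s) t≢s))

module Truncation (β : ℕ → ℤ) (τ : ℕ) where

  -- The coefficient of wʲ in (1 + w)ˡ ∑_{t<τ} β t wᵗ.
  γ : ℕ → ℤ → ℤ
  γ l j = sumOver ℤ.+-*-commutativeRing (upTo τ) λ t → β t ℤ.* binomial (+ l) (j ℤ.- + t)

  γ-pascal : ∀ l j → γ (suc l) (1ℤ ℤ.+ j) ≡ γ l (1ℤ ℤ.+ j) ℤ.+ γ l j
  γ-pascal l j = ≡.trans (ΣZ.sum-cong (upTo τ) λ t → begin
      β t ℤ.* binomial (+ suc l) (1ℤ ℤ.+ j ℤ.- + t)
        ≡⟨ ≡.cong (λ i → β t ℤ.* binomial (+ suc l) i) (ℤ.+-assoc 1ℤ j (ℤ.- + t)) ⟩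
      β t ℤ.* binomial (1ℤ ℤ.+ + l) (1ℤ ℤ.+ (j ℤ.- + t))
        ≡⟨ ≡.cong (β t ℤ.*_) (binomial-pascal (+ l) (j ℤ.- + t)) ⟩
      β t ℤ.* (binomial (+ l) (1ℤ ℤ.+ (j ℤ.- + t)) ℤ.+ binomial (+ l) (j ℤ.- + t))
        ≡⟨ ℤ.*-distribˡ-+ (β t) _ _ ⟩
      β t ℤ.* binomial (+ l) (1ℤ ℤ.+ (j ℤ.- + t)) ℤ.+ β t ℤ.* binomial (+ l) (j ℤ.- + t)
        ≡⟨ ≡.cong (λ i → β t ℤ.* binomial (+ l) i ℤ.+ β t ℤ.* binomial (+ l) (j ℤ.- + t)) (ℤ.+-assoc 1ℤ j (ℤ.- + t)) ⟨
      β t ℤ.* binomial (+ l) (1ℤ ℤ.+ j ℤ.- + t) ℤ.+ β t ℤ.* binomial (+ l) (j ℤ.- + t) ∎)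
    (ΣZ.sum-+ (upTo τ) _ _)
    where open ≡.≡-Reasoning

  γ-0 : ∀ {s} → s < τ → γ 0 (+ s) ≡ β s
  γ-0 {s} s<τ = ≡.trans (ΣZ.sum-cong (upTo τ) λ t →
      ≡.trans (≡.cong (β t ℤ.*_) (binomial-0 s t)) (ℤ.*-comm (β t) _))
    (ΣZ.sum-δ ℕ._≟_ s β (upTo⁺ τ) (∈-upTo⁺ s<τ))

  γ--1 : ∀ l → γ l -1ℤ ≡ 0ℤ
  γ--1 l = ΣZ.sum-zero (upTo τ) λ t → ≡.trans (≡.cong (β t ℤ.*_) (0-n-negative (+ l) t)) (ℤ.*-zeroʳ (β t))

  γ-large : ∀ l {s} → l ℕ.+ τ ≤ s → γ l (+ s) ≡ 0ℤ
  γ-large l {s} l+τ≤s = ΣZ.sum-zero-∈ (upTo τ) λ {t} t∈ →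
    let l+t<s = ℕ.<-≤-trans (ℕ.+-monoʳ-< l (∈-upTo⁻ t∈)) l+τ≤s in
    ≡.trans (≡.cong (β t ℤ.*_) (≡.trans (≡.cong (binomial (+ l)) (+∸ (ℕ.<⇒≤ (ℕ.m+n≤o⇒n≤o l (≡.subst (_≤ s) (≡.sym (ℕ.+-suc l t)) l+t<s)))))
      (binomial-zero {+ l} {s ∸ t} (fallingFactorial-> (ℕ.m+n≤o⇒m≤o∸n (suc l) l+t<s))))) (ℤ.*-zeroʳ (β t))

  module _ {c ℓ} (S : CommutativeRing c ℓ) where
    open CommutativeRing S
    open Exp commutativeSemiring
    open FromInteger S using (fromℤ-+)
    open Sums S
    open SetoidReasoning setoid

    -- By Pascal's rule, raising l by one multiplies the generating function by 1 + w; the boundary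
    -- coefficients at l + τ and at -1 vanish.
    γ-generating : ∀ l w → sumOver S (upTo (l ℕ.+ τ)) (λ s → fromℤ S (γ l (+ s)) * w ^ s) ≈
                   (1# + w) ^ l * sumOver S (upTo τ) (λ t → fromℤ S (β t) * w ^ t)
    γ-generating zero    w = trans
      (sum-cong-∈ (upTo τ) λ s∈ → *-congʳ (reflexive (≡.cong (fromℤ S) (γ-0 (∈-upTo⁻ s∈)))))
      (sym (*-identityˡ _))
    γ-generating (suc l) w = begin
      sumOver S (upTo (suc n)) (λ s → fromℤ S (γ (suc l) (+ s)) * w ^ s)
        ≈⟨ sum-cong (upTo (suc n)) split ⟩
      sumOver S (upTo (suc n)) (λ s → fromℤ S (γ l (+ s)) * w ^ s + fromℤ S (γ l (-1ℤ ℤ.+ + s)) * w ^ s)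
        ≈⟨ sum-+ (upTo (suc n)) _ _ ⟩
      sumOver S (upTo (suc n)) (λ s → fromℤ S (γ l (+ s)) * w ^ s) +
      sumOver S (upTo (suc n)) (λ s → fromℤ S (γ l (-1ℤ ℤ.+ + s)) * w ^ s)
        ≈⟨ +-cong (sum-upTo-last n _) (sum-upTo-first n _) ⟩
      (total + fromℤ S (γ l (+ n)) * w ^ n) +
      (fromℤ S (γ l (-1ℤ ℤ.+ + 0)) * w ^ 0 + sumOver S (upTo n) (λ s → fromℤ S (γ l (+ s)) * w ^ suc s))
        ≈⟨ +-cong (trans (+-congˡ (vanishing (γ-large l ℕ.≤-refl) _)) (+-identityʳ _))
                  (trans (+-cong (vanishing (γ--1 l) _) (trans (sum-cong (upTo n) λ s → x∙yz≈y∙xz _ w _)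
                    (sym (sum-*ˡ w (upTo n) _)))) (+-identityˡ _)) ⟩
      total + w * total
        ≈⟨ +-congʳ (*-identityˡ total) ⟨
      1# * total + w * total
        ≈⟨ distribʳ total 1# w ⟨
      (1# + w) * total
        ≈⟨ trans (*-congˡ (γ-generating l w)) (sym (*-assoc _ _ _)) ⟩
      (1# + w) ^ suc l * sumOver S (upTo τ) (λ t → fromℤ S (β t) * w ^ t) ∎
      where
      n = l ℕ.+ τ
      total = sumOver S (upTo n) λ s → fromℤ S (γ l (+ s)) * w ^ s
      open import Algebra.Properties.CommutativeSemigroup *-commutativeSemigroup using (x∙yz≈y∙xz)

      vanishing : ∀ {i} → i ≡ 0ℤ → ∀ x → fromℤ S i * x ≈ 0#
      vanishing ≡.refl x = zeroˡ x

      split : ∀ s → fromℤ S (γ (suc l) (+ s)) * w ^ s ≈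
              fromℤ S (γ l (+ s)) * w ^ s + fromℤ S (γ l (-1ℤ ℤ.+ + s)) * w ^ s
      split s = trans (*-congʳ (trans (reflexive (≡.cong (fromℤ S) (≡.subst
          (λ i → γ (suc l) i ≡ γ l i ℤ.+ γ l (-1ℤ ℤ.+ + s))
          (≡.trans (≡.sym (ℤ.+-assoc 1ℤ -1ℤ (+ s))) (ℤ.+-identityˡ (+ s)))
          (γ-pascal l (-1ℤ ℤ.+ + s))))) (fromℤ-+ (γ l (+ s)) (γ l (-1ℤ ℤ.+ + s)))))
        (distribʳ _ _ _)

module AlphaPolynomial {c ℓ} (S : CommutativeRing c ℓ) where
  open CommutativeRing S
  open Exp commutativeSemiring
  open FromInteger S using (fromℤ-+; fromℤ-*)
  open FromInteger.Solver S using (solve; _:=_; _:+_; _:*_)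
  open Sums S
  open RingProperties ring using (-‿distribˡ-*)
  open SetoidReasoning setoid

  alphaPolynomial : ℕ → ℕ → Carrier → Carrier
  alphaPolynomial l τ y = sumOver S (upTo (l ℕ.+ τ)) λ s → fromℤ S (α l τ s) * y ^ s

  -- The truncation of the binomial series of (1 + w)⁻ˡ.
  inverseSeries : ℕ → ℕ → Carrier → Carrier
  inverseSeries l τ w = sumOver S (upTo τ) λ t → fromℤ S (binomial (ℤ.- (+ l)) (+ t)) * w ^ t

  private
    neg-^ : ∀ s y → fromℤ S (-1ℤ ℤ.^ s) * y ^ s ≈ (- y) ^ s
    neg-^ zero    y = trans (*-identityʳ _) (+-identityʳ 1#)
    neg-^ (suc s) y = begin
      fromℤ S (-1ℤ ℤ.* -1ℤ ℤ.^ s) * (y * y ^ s)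
        ≈⟨ *-congʳ (fromℤ-* -1ℤ (-1ℤ ℤ.^ s)) ⟩
      (- (1# + 0#) * fromℤ S (-1ℤ ℤ.^ s)) * (y * y ^ s)
        ≈⟨ interchange _ _ _ _ ⟩
      (- (1# + 0#) * y) * (fromℤ S (-1ℤ ℤ.^ s) * y ^ s)
        ≈⟨ *-cong (trans (sym (-‿distribˡ-* _ y)) (-‿cong (trans (*-congʳ (+-identityʳ 1#)) (*-identityˡ y))))
                  (neg-^ s y) ⟩
      - y * (- y) ^ s ∎
      where open import Algebra.Properties.CommutativeSemigroup *-commutativeSemigroup using (interchange)

  -- Up to the sign (-1)ˢ, `α l τ s` is the coefficient `γ l (+ s)` for the truncated series of (1 +
  -- w)⁻ˡ; the sign is absorbed by w = -y.
  alphaPolynomial-factor : ∀ l τ y →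
    alphaPolynomial l τ y ≈ (1# - y) ^ l * inverseSeries l τ (- y)
  alphaPolynomial-factor l τ y = trans
    (sum-cong (upTo (l ℕ.+ τ)) λ s → begin
      fromℤ S (α l τ s) * y ^ s
        ≈⟨ *-congʳ (trans (fromℤ-* (-1ℤ ℤ.^ s) _) (*-comm _ _)) ⟩
      (fromℤ S (γ l (+ s)) * fromℤ S (-1ℤ ℤ.^ s)) * y ^ s
        ≈⟨ trans (*-assoc _ _ _) (*-congˡ (neg-^ s y)) ⟩
      fromℤ S (γ l (+ s)) * (- y) ^ s ∎)
    (γ-generating S l (- y))
    where open Truncation (λ t → binomial (ℤ.- (+ l)) (+ t)) τ

  private
    -- By Pascal's rule, multiplication by 1 + w lowers the exponent l + 1 of the inverse power to
    -- l; truncation leaves an error in the single degree τ + 1.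
    inverseSeries-step : ∀ l τ w → ∃ λ z →
      (1# + w) * inverseSeries (suc l) (suc τ) w ≈ inverseSeries l (suc τ) w + w ^ suc τ * z
    -- The error is w times the last retained term, so the witness is its coefficient.
    inverseSeries-step l τ w = b τ , sym (begin
      inverseSeries l (suc τ) w + w ^ suc τ * b τ
        ≈⟨ +-congʳ (sum-upTo-first τ _) ⟩
      (fromℤ S (binomial (ℤ.- (+ l)) (+ 0)) * w ^ 0 +
        sumOver S (upTo τ) (λ t → fromℤ S (binomial (ℤ.- (+ l)) (+ suc t)) * w ^ suc t)) + w ^ suc τ * b τ
        ≈⟨ +-congʳ (+-congˡ (trans (sum-cong (upTo τ) λ t → trans (*-congʳ (trans
             (reflexive (≡.cong (fromℤ S) (pascal t)))
               (fromℤ-+ (binomial (ℤ.- (+ suc l)) (+ suc t)) (binomial (ℤ.- (+ suc l)) (+ t))))) (distribʳ _ _ _))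
             (sum-+ (upTo τ) _ _))) ⟩
      (b 0 * w ^ 0 + (sumOver S (upTo τ) (λ t → b (suc t) * w ^ suc t) +
        sumOver S (upTo τ) (λ t → b t * w ^ suc t))) + w ^ suc τ * b τ
        ≈⟨ +-congʳ (+-congˡ (+-congˡ (trans (sum-cong (upTo τ) λ t → x∙yz≈y∙xz _ w _)
             (sym (sum-*ˡ w (upTo τ) _))))) ⟩
      (b 0 * w ^ 0 + (sumOver S (upTo τ) (λ t → b (suc t) * w ^ suc t) +
        w * sumOver S (upTo τ) (λ t → b t * w ^ t))) + w * w ^ τ * b τ
        ≈⟨ solve 6 (λ x y w z u v → (x :+ (y :+ w :* z)) :+ w :* u :* v := (x :+ y) :+ w :* (z :+ v :* u)) refl
             (b 0 * w ^ 0) _ w (sumOver S (upTo τ) (λ t → b t * w ^ t)) (w ^ τ) (b τ) ⟩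
      (b 0 * w ^ 0 + sumOver S (upTo τ) (λ t → b (suc t) * w ^ suc t)) +
        w * (sumOver S (upTo τ) (λ t → b t * w ^ t) + b τ * w ^ τ)
        ≈⟨ +-cong (sum-upTo-first τ _) (*-congˡ (sum-upTo-last τ _)) ⟨
      series + w * series
        ≈⟨ +-congʳ (*-identityˡ series) ⟨
      1# * series + w * series
        ≈⟨ distribʳ series 1# w ⟨
      (1# + w) * series ∎)
      where
      b : ℕ → Carrier
      b t = fromℤ S (binomial (ℤ.- (+ suc l)) (+ t))
      series = inverseSeries (suc l) (suc τ) w
      open import Algebra.Properties.CommutativeSemigroup *-commutativeSemigroup using (x∙yz≈y∙xz)

      pascal : ∀ t → binomial (ℤ.- (+ l)) (+ suc t) ≡
                     binomial (ℤ.- (+ suc l)) (+ suc t) ℤ.+ binomial (ℤ.- (+ suc l)) (+ t)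
      pascal t = ≡.trans (≡.cong (λ x → binomial x (+ suc t)) (1-suc l)) (binomial-pascal (ℤ.- (+ suc l)) (+ t))
        where
        1-suc : ∀ l → ℤ.- (+ l) ≡ 1ℤ ℤ.+ ℤ.- (+ suc l)
        1-suc zero    = ≡.refl
        1-suc (suc l) = ≡.refl

  inverseSeries-inverse : ∀ l τ w → ∃ λ z →
    (1# + w) ^ l * inverseSeries l (suc τ) w ≈ 1# + w ^ suc τ * z
  inverseSeries-inverse zero τ w = 0# , trans (*-identityˡ _) (trans (sum-upTo-first τ _)
    (+-cong (trans (*-identityʳ _) (+-identityʳ 1#)) (trans (sum-zero (upTo τ) λ t →
      trans (*-congʳ (reflexive (≡.cong (fromℤ S) (binomial-zero {0ℤ} {suc t} (fallingFactorial-0 t))))) (zeroˡ _))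
      (sym (zeroʳ _)))))
  inverseSeries-inverse (suc l) τ w
    with z , eq ← inverseSeries-inverse l τ w | z′ , eq′ ← inverseSeries-step l τ w =
    z + (1# + w) ^ l * z′ , (begin
      (1# + w) * (1# + w) ^ l * inverseSeries (suc l) (suc τ) w
        ≈⟨ trans (*-congʳ (*-comm _ _)) (*-assoc _ _ _) ⟩
      (1# + w) ^ l * ((1# + w) * inverseSeries (suc l) (suc τ) w)
        ≈⟨ trans (*-congˡ eq′) (distribˡ _ _ _) ⟩
      (1# + w) ^ l * inverseSeries l (suc τ) w + (1# + w) ^ l * (w ^ suc τ * z′)
        ≈⟨ +-congʳ eq ⟩
      1# + w ^ suc τ * z + (1# + w) ^ l * (w ^ suc τ * z′)
        ≈⟨ solve 5 (λ i u z v z′ → i :+ u :* z :+ v :* (u :* z′) := i :+ u :* (z :+ v :* z′)) refl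
             1# (w ^ suc τ) z ((1# + w) ^ l) z′ ⟩
      1# + w ^ suc τ * (z + (1# + w) ^ l * z′) ∎)

  alphaPolynomial-near-0 : ∀ l τ y → ∃ λ z → alphaPolynomial l (suc τ) y ≈ 1# + z * y ^ suc τ
  alphaPolynomial-near-0 l τ y with z , eq ← inverseSeries-inverse l τ (- y) =
    z * fromℤ S (-1ℤ ℤ.^ suc τ) , (begin
      alphaPolynomial l (suc τ) y                            ≈⟨ alphaPolynomial-factor l (suc τ) y ⟩
      (1# - y) ^ l * inverseSeries l (suc τ) (- y)           ≈⟨ eq ⟩
      1# + (- y) ^ suc τ * z                                 ≈⟨ +-congˡ (trans (*-comm _ z) (*-congˡ (sym (neg-^ (suc τ) y)))) ⟩
      1# + z * (fromℤ S (-1ℤ ℤ.^ suc τ) * y ^ suc τ)         ≈⟨ +-congˡ (*-assoc _ _ _) ⟨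
      1# + z * fromℤ S (-1ℤ ℤ.^ suc τ) * y ^ suc τ           ∎)

-- Sums over the torus

module MonomialValue {c ℓ} (R : CommutativeRing c ℓ) where
  open CommutativeRing R
  open Exp commutativeSemiring
  open import Algebra.Properties.CommutativeSemigroup *-commutativeSemigroup using (interchange)

  value : ∀ {m} → Vec Carrier m → Exponent m → Carrier
  value x u = Vec.foldr _ _*_ 1# (Vec.zipWith _^_ x u)

  value-cong : ∀ {m} {x y : Vec Carrier m} → Pointwise _≈_ x y → ∀ u → value x u ≈ value y u
  value-cong []         []      = refl
  value-cong (eq ∷ eqs) (k ∷ u) = *-cong (^-congˡ k eq) (value-cong eqs u)

  value-⊕ : ∀ {m} (x : Vec Carrier m) u v → value x (u ⊕ v) ≈ value x u * value x v
  value-⊕ []      []      []      = sym (*-identityˡ 1#)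
  value-⊕ (x ∷ xs) (i ∷ u) (j ∷ v) = trans (*-cong (^-homo-* x i j) (value-⊕ xs u v)) (interchange _ _ _ _)

  value-0 : ∀ {m} (x : Vec Carrier m) → value x (Vec.replicate m 0) ≈ 1#
  value-0 []       = refl
  value-0 (x ∷ xs) = trans (*-identityˡ _) (value-0 xs)

  1^ : ∀ k → 1# ^ k ≈ 1#
  1^ zero    = refl
  1^ (suc k) = trans (*-identityˡ _) (1^ k)

  value-⊙ : ∀ {m} (x : Vec Carrier m) c u → value x (c ⊙ u) ≈ value x u ^ c
  value-⊙ []       c []      = sym (1^ c)
  value-⊙ (x ∷ xs) c (k ∷ u) = trans
    (*-cong (trans (^-congʳ x (ℕ.*-comm c k)) (sym (^-assocʳ x k c))) (value-⊙ xs c u))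
    (sym (^-distrib-* _ _ c))

  value-scale : ∀ {m} g (x : Vec Carrier m) u → value (Vec.map (g *_) x) u ≈ g ^ Vec.sum u * value x u
  value-scale g []       []      = sym (*-identityˡ 1#)
  value-scale g (x ∷ xs) (k ∷ u) = trans (*-cong (^-distrib-* g x k) (value-scale g xs u))
    (trans (interchange _ _ _ _) (*-congʳ (sym (^-homo-* g k (Vec.sum u)))))

module _ {c₁ ℓ₁ c₂ ℓ₂} (R : CommutativeRing c₁ ℓ₁) (S : CommutativeRing c₂ ℓ₂)
         {f : ⟨ R ⟩ → ⟨ S ⟩} (f-hom : IsRingHomomorphism R S f) where
  private
    module R = CommutativeRing R
    module S = CommutativeRing S
    module f = RingMorphisms.IsRingHomomorphism f-hom

  value-homo : ∀ {m} (x : Vec R.Carrier m) u →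
               f (MonomialValue.value R x u) S.≈ MonomialValue.value S (Vec.map f x) u
  value-homo []       []      = f.1#-homo
  value-homo (x ∷ xs) (k ∷ u) = S.trans (f.*-homo _ _) (S.*-cong (^-homo R S f-hom x k) (value-homo xs u))

fromℕ-ℤ : ∀ n → fromℕ ℤ.+-*-commutativeRing n ≡ + n
fromℕ-ℤ zero    = ≡.refl
fromℕ-ℤ (suc n) = ≡.cong (λ i → ℤ.1ℤ ℤ.+ i) (fromℕ-ℤ n)

module TorusSums {c ℓ N} (K : FiniteField c ℓ N) where
  private module K = FiniteField K
  open K using (units)
  open FiniteFieldProperties K

  torus : ∀ m → List (Vec K.Carrier m)
  torus m = choices (Vec.replicate m units)

  module _ {s ℓs} (S : CommutativeRing s ℓs) where
    open CommutativeRing S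
    open Sums S
    open Exp commutativeSemiring
    open SetoidReasoning setoid

    sum-torus-scale : ∀ {m} {f : Vec K.Carrier m → Carrier} →
                      (∀ {x y} → Pointwise K._≈_ x y → f x ≈ f y) →
                      ∀ {g} → g K.≉ K.0# →
                      sumOver S (torus m) (λ x → f (Vec.map (g K.*_) x)) ≈ sumOver S (torus m) f
    sum-torus-scale {zero}      f-cong g≉0 = refl
    sum-torus-scale {suc m} {f} f-cong {g} g≉0 = begin
      sumOver S (torus (suc m)) (λ x → f (Vec.map (g K.*_) x))
        ≈⟨ sum-product _∷_ units (torus m) _ ⟩
      sumOver S units (λ a → sumOver S (torus m) λ x → f (g K.* a ∷ Vec.map (g K.*_) x))
        ≈⟨ sum-cong units (λ a → sum-torus-scale {m} {λ x → f (g K.* a ∷ x)}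
             (λ eqs → f-cong (K.refl ∷ eqs)) g≉0) ⟩
      sumOver S units (λ a → sumOver S (torus m) λ x → f (g K.* a ∷ x))
        ≈⟨ fold-units-scale +-commutativeMonoid {λ a → sumOver S (torus m) λ x → f (a ∷ x)}
             (λ eq → sum-cong (torus m) λ x → f-cong (eq ∷ Pointwise.refl K.refl)) g≉0 ⟩
      sumOver S units (λ a → sumOver S (torus m) λ x → f (a ∷ x))
        ≈⟨ sum-product _∷_ units (torus m) f ⟨
      sumOver S (torus (suc m)) f ∎

    module _ (t : K.Carrier → Carrier)
             (power-sum : ∀ k → sumOver S units (λ c → t c ^ k) ≈
                                [ (N ∸ 1) ℕ.∣? k ] * fromℕ S (N ∸ 1)) where
      open MonomialValue S

      private instance
        N-1-nonZero : NonZero (N ∸ 1)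
        N-1-nonZero = K.q-1-nonZero

      -- Orthogonality on the torus: the sum is a product of one power sum per coordinate, and a
      -- product of brackets is the bracket for all entries at once.
      sum-torus-character : ∀ {m} (v : Exponent m) →
        sumOver S (torus m) (λ x → value (Vec.map t x) v) ≈
        [ multiple? (N ∸ 1) v ] * fromℕ S (N ∸ 1) ^ m
      sum-torus-character []      = trans (+-identityʳ 1#) (sym (*-identityˡ 1#))
      sum-torus-character {suc m} (k ∷ v) = begin
        sumOver S (torus (suc m)) (λ x → value (Vec.map t x) (k ∷ v))
          ≈⟨ sum-product _∷_ units (torus m) _ ⟩
        sumOver S units (λ a → sumOver S (torus m) λ x → t a ^ k * value (Vec.map t x) v)
          ≈⟨ sum-cong units (λ a → sym (sum-*ˡ (t a ^ k) (torus m) _)) ⟩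
        sumOver S units (λ a → t a ^ k * sumOver S (torus m) λ x → value (Vec.map t x) v)
          ≈⟨ sum-*ʳ _ units _ ⟨
        sumOver S units (λ a → t a ^ k) * sumOver S (torus m) (λ x → value (Vec.map t x) v)
          ≈⟨ *-cong (power-sum k) (sum-torus-character v) ⟩
        ([ (N ∸ 1) ℕ.∣? k ] * fromℕ S (N ∸ 1)) * ([ multiple? (N ∸ 1) v ] * fromℕ S (N ∸ 1) ^ m)
          ≈⟨ interchange _ _ _ _ ⟩
        ([ (N ∸ 1) ℕ.∣? k ] * [ multiple? (N ∸ 1) v ]) * fromℕ S (N ∸ 1) ^ suc m
          ≈⟨ *-congʳ both ⟩
        [ multiple? (N ∸ 1) (k ∷ v) ] * fromℕ S (N ∸ 1) ^ suc m ∎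
        where
        open import Algebra.Properties.CommutativeSemigroup *-commutativeSemigroup using (interchange)
        both : [ (N ∸ 1) ℕ.∣? k ] * [ multiple? (N ∸ 1) v ] ≈ [ multiple? (N ∸ 1) (k ∷ v) ]
        both with (N ∸ 1) ℕ.∣? k
        ... | yes N-1∣k = trans (*-identityˡ _) ([]-cong (multiple? (N ∸ 1) v) (multiple? (N ∸ 1) (k ∷ v))
          (≡.cong₂ _∷_ (≡.trans (ℕ.*-comm (N ∸ 1) _) (m/n*n≡m N-1∣k)))
          (proj₂ ∘ ∷-injective))
        ... | no N-1∤k  = trans (zeroˡ _) (sym ([]-no (multiple? (N ∸ 1) (k ∷ v)) λ eq →
          N-1∤k (≡.subst ((N ∸ 1) ∣_) (proj₁ (∷-injective eq)) (ℕ.m∣m*n (k / (N ∸ 1))))))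

  module _ {r ℓr} {R : CommutativeRing r ℓr} {ι : ⟨ R ⟩ → K.Carrier}
           (ι-hom : IsRingHomomorphism R K.commutativeRing ι) where
    private
      module ι = RingMorphisms.IsRingHomomorphism ι-hom
      module R = CommutativeRing R
      Kᶜ = K.commutativeRing
    open Sums Kᶜ
    open Exp K.commutativeSemiring
    open MonomialValue Kᶜ

    eval-cong : ∀ {m} (F : Poly R m) {x y : Vec K.Carrier m} → Pointwise K._≈_ x y →
                eval Kᶜ ι F x K.≈ eval Kᶜ ι F y
    eval-cong {m} F eqs = sum-cong (simplex m (bound F)) λ u → K.*-congˡ (value-cong eqs u)

    eval-homogeneous : ∀ {m d} (F : Poly R m) → Homogeneous d F → ∀ g x →
                       eval Kᶜ ι F (Vec.map (g K.*_) x) K.≈ g ^ d K.* eval Kᶜ ι F x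
    eval-homogeneous {m} {d} F hom g x = K.trans
      (sum-cong (simplex m (bound F)) term) (K.sym (sum-*ˡ (g ^ d) (simplex m (bound F)) _))
      where
      open import Algebra.Properties.CommutativeSemigroup K.*-commutativeSemigroup using (x∙yz≈y∙xz)
      term : ∀ u → ι (coeff F u) K.* value (Vec.map (g K.*_) x) u K.≈
             g ^ d K.* (ι (coeff F u) K.* value x u)
      term u with Vec.sum u ℕ.≟ d
      ... | yes ≡.refl = K.trans (K.*-congˡ (value-scale g x u)) (x∙yz≈y∙xz _ _ _)
      ... | no |u|≢d   = K.trans (vanishes _) (K.sym (K.trans (K.*-congˡ (vanishes _)) (K.zeroʳ _)))
        where
        vanishes : ∀ z → ι (coeff F u) K.* z K.≈ K.0#
        vanishes z = K.trans (K.*-congʳ (K.trans (ι.⟦⟧-cong (hom u |u|≢d)) ι.0#-homo)) (K.zeroˡ z)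

    zeros : ∀ {m} → Poly R m → List (Vec K.Carrier m)
    zeros {m} F = filter (λ x → eval Kᶜ ι F x K.≈? K.0#) (torus m)

    private
      ℤᶜ = ℤ.+-*-commutativeRing

    -- Scaling by the first coordinate maps the zeros with first coordinate 1
    -- bijectively to the zeros with any other first coordinate.
    length-zeros : ∀ {n d} (F : Poly R (suc n)) → Homogeneous d F → (N ∸ 1) ∣ length (zeros F)
    length-zeros {n} {d} F hom = divides M (ℤ.+-injective (begin
      + length (zeros F)
        ≡⟨ fromℕ-ℤ _ ⟨
      fromℕ ℤᶜ (length (zeros F))
        ≡⟨ ΣZ.length-filter zero? (torus (suc n)) ⟩
      sumOver ℤᶜ (torus (suc n)) (λ x → ΣZ.[ zero? x ])
        ≡⟨ ΣZ.sum-product _∷_ units (torus n) _ ⟩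
      sumOver ℤᶜ units (λ a → sumOver ℤᶜ (torus n) λ x → ΣZ.[ zero? (a ∷ x) ])
        ≡⟨ ΣZ.sum-cong-∈ units (λ {a} a∈ → rescale a (All.lookup units-≉0 a∈)) ⟩
      sumOver ℤᶜ units (λ a → sumOver ℤᶜ (torus n) λ x → ΣZ.[ zero? (K.1# ∷ x) ])
        ≡⟨ ΣZ.sum-const units _ ⟩
      fromℕ ℤᶜ (length units) ℤ.* sumOver ℤᶜ (torus n) (λ x → ΣZ.[ zero? (K.1# ∷ x) ])
        ≡⟨ ≡.cong₂ ℤ._*_ (≡.trans (fromℕ-ℤ _) (≡.cong +_ length-units))
             (≡.trans (≡.sym (ΣZ.length-filter (zero? ∘ (K.1# ∷_)) (torus n))) (fromℕ-ℤ M)) ⟩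
      + (N ∸ 1) ℤ.* + M
        ≡⟨ ≡.trans (≡.sym (ℤ.pos-* (N ∸ 1) M)) (≡.cong +_ (ℕ.*-comm (N ∸ 1) M)) ⟩
      + (M ℕ.* (N ∸ 1)) ∎))
      where
      open ≡.≡-Reasoning
      zero? : ∀ x → Dec (eval Kᶜ ι F x K.≈ K.0#)
      zero? x = eval Kᶜ ι F x K.≈? K.0#

      M = length (filter (zero? ∘ (K.1# ∷_)) (torus n))

      rescale : ∀ a → a K.≉ K.0# → sumOver ℤᶜ (torus n) (λ x → ΣZ.[ zero? (a ∷ x) ]) ≡
                sumOver ℤᶜ (torus n) (λ x → ΣZ.[ zero? (K.1# ∷ x) ])
      rescale a a≉0 = ≡.trans
        (≡.sym (sum-torus-scale ℤᶜ {n} {λ x → ΣZ.[ zero? (a ∷ x) ]}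
          (λ {x} {y} eqs → ΣZ.[]-cong (zero? (a ∷ x)) (zero? (a ∷ y))
            (K.trans (K.sym (eval-cong F (K.refl ∷ eqs)))) (K.trans (eval-cong F (K.refl ∷ eqs)))) a≉0))
        (ΣZ.sum-cong (torus n) λ x → ΣZ.[]-cong (zero? (a ∷ Vec.map (a K.*_) x)) (zero? (K.1# ∷ x))
          (λ h → *-≉0-cancelˡ (^-≉0 d a≉0) (K.trans (K.sym (scaled x)) h))
          (λ h → K.trans (scaled x) (K.trans (K.*-congˡ h) (K.zeroʳ _))))
        where
        scaled : ∀ x → eval Kᶜ ι F (a ∷ Vec.map (a K.*_) x) K.≈ a ^ d K.* eval Kᶜ ι F (K.1# ∷ x)
        scaled x = K.trans (eval-cong F (K.sym (K.*-identityʳ a) ∷ Pointwise.refl K.refl))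
          (eval-homogeneous F hom a (K.1# ∷ x))

-- The congruence

-- S plays the role of the Witt vectors of length l of Fqʳ, with reduction map
-- red and Teichmüller character t.
module CountInS {c₁ ℓ₁ c₂ ℓ₂ c₃ ℓ₃ s ℓs} {p a : ℕ} (p-prime : Prime p)
                (Fq : FiniteField c₁ ℓ₁ (p ℕ.^ a)) (Zq : WittVectors p Fq c₂ ℓ₂) (Φ : Frobenius Zq)
                {r : ℕ} (1≤r : 1 ≤ r) (Fqʳ : FiniteField c₃ ℓ₃ ((p ℕ.^ a) ℕ.^ r))
                {ι : FiniteField.Carrier Fq → FiniteField.Carrier Fqʳ}
                (ι-hom : IsRingHomomorphism (FiniteField.commutativeRing Fq)
                                            (FiniteField.commutativeRing Fqʳ) ι)
                (l : ℕ) (S : CommutativeRing s ℓs)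
                {j : WittVectors.Carrier Zq → ⟨ S ⟩}
                (j-hom : IsRingHomomorphism (WittVectors.commutativeRing Zq) S j)
                {red : ⟨ S ⟩ → FiniteField.Carrier Fqʳ}
                (red-hom : IsRingHomomorphism S (FiniteField.commutativeRing Fqʳ) red)
                (red-j : ∀ x → FiniteField._≈_ Fqʳ (red (j x)) (ι (WittVectors.reduce Zq x)))
                (t : FiniteField.Carrier Fqʳ → ⟨ S ⟩)
                (red-t : ∀ c → FiniteField._≈_ Fqʳ (red (t c)) c)
                (power-sum : ∀ k → CommutativeRing._≈_ S
                   (sumOver S (FiniteField.units Fqʳ) (λ c →
                     Exp._^_ (CommutativeRing.commutativeSemiring S) (t c) k))
                   (CommutativeRing._*_ S
                     (Sums.[_] S (((p ℕ.^ a) ℕ.^ r ∸ 1) ℕ.∣? k))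
                     (fromℕ S ((p ℕ.^ a) ℕ.^ r ∸ 1))))
                (nilpotent : ∀ xs → length xs ≡ l →
                   All (λ x → FiniteField._≈_ Fqʳ (red x) (FiniteField.0# Fqʳ)) xs →
                   CommutativeRing._≈_ S
                     (List.foldr (CommutativeRing._*_ S) (CommutativeRing.1# S) xs)
                     (CommutativeRing.0# S)) where
  open Extension {p = p} {a = a} p-prime Fq Zq 1≤r Fqʳ ι-hom
  open FrobeniusTrace p-prime Φ
  open TorusSums Fqʳ
  private
    Rᶜ = R.commutativeRing
    Kᶜ = K.commutativeRing
    module red = RingMorphisms.IsRingHomomorphism red-hom
    module kˣ = Exp k.commutativeSemiring
    i₀ = a ℕ.* r

    Killed : ⟨ S ⟩ → Set ℓ₃
    Killed x = red x K.≈ K.0#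

    instance
      N-1-nonZero : NonZero (N ∸ 1)
      N-1-nonZero = K.q-1-nonZero

    N≡p^ar : N ≡ p ℕ.^ i₀
    N≡p^ar = ℕ.^-*-assoc p a r

    instance
      p^ar-1-nonZero : NonZero (p ℕ.^ i₀ ∸ 1)
      p^ar-1-nonZero = ≡.subst (λ n → NonZero (n ∸ 1)) N≡p^ar K.q-1-nonZero
  open CommutativeRing S
  open Exp commutativeSemiring
  open Sums S
  open Ideal S Killed
  open Nilpotent l nilpotent
  open AlphaPolynomial S
  open MonomialValue S
  private module VK = MonomialValue Kᶜ

  jφ^-hom : ∀ i → IsRingHomomorphism Rᶜ S (j ∘ φ^ i)
  jφ^-hom i = Composition.isRingHomomorphism trans (φ^-hom i) j-hom

  reduce-φ^ : ∀ i x → R.reduce (φ^ i x) k.≈ R.reduce x kˣ.^ (p ℕ.^ i)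
  reduce-φ^ zero    x = k.sym (k.*-identityʳ _)
  reduce-φ^ (suc i) x = k.trans (reduce-φ^ i (Frobenius.φ Φ x))
    (k.trans (kˣ.^-congˡ (p ℕ.^ i) (Frobenius.φ-lift Φ x)) (kˣ.^-assocʳ _ p (p ℕ.^ i)))

  red-jφ^ : ∀ i x → red (j (φ^ i x)) K.≈ ρ x Kˣ.^ (p ℕ.^ i)
  red-jφ^ i x = K.trans (red-j _) (K.trans (ι.⟦⟧-cong (reduce-φ^ i x))
    (^-homo k.commutativeRing Kᶜ ι-hom (R.reduce x) (p ℕ.^ i)))

  module _ {m d : ℕ} (F̄ : Poly k.commutativeRing m) (F : Poly Rᶜ m)
           (F-lifts : ∀ u → R.reduce (coeff F u) k.≈ coeff F̄ u) where
    private
      P : ℕ → FormalSum Rᶜ (Exponent m)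
      P s = frobeniusProduct ((F ^ₚ s) ^ₚ (p ∸ 1)) i₀

    -- The lift and `F̄` may carry different degree bounds; beyond either bound the reduced
    -- coefficients vanish, so the index lists can be exchanged.
    eval-lift : ∀ x → sumOver Kᶜ (simplex m (bound F)) (λ u → ρ (coeff F u) K.* VK.value x u) K.≈
                eval Kᶜ ι F̄ x
    eval-lift x = K.trans
      (ΣK.sum-cong (simplex m (bound F)) λ u → K.*-congʳ (ι.⟦⟧-cong (F-lifts u)))
      (ΣK.sum-support _≟ᵉ_ term (simplex-unique m (bound F)) (simplex-unique m (bound F̄))
        (λ {u} _ → support F̄ (λ h → ι.⟦⟧-cong h) u)
        (λ {u} _ → support F (λ h → ι.⟦⟧-cong (k.trans (k.sym (F-lifts _)) (k.trans
          (RingMorphisms.IsRingHomomorphism.⟦⟧-cong R.reduce-isRingHom h)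
          (RingMorphisms.IsRingHomomorphism.0#-homo R.reduce-isRingHom)))) u))
      where
      term : Exponent m → K.Carrier
      term u = ι (coeff F̄ u) K.* VK.value x u

      support : ∀ {c ℓ} {A : CommutativeRing c ℓ} (G : Poly A m) →
                (∀ {u} → CommutativeRing._≈_ A (coeff G u) (CommutativeRing.0# A) →
                         ι (coeff F̄ u) K.≈ ι k.0#) →
                ∀ u → u ∈ simplex m (bound G) ⊎ term u K.≈ K.0#
      support G vanishes u with ℕ.≤-<-connex (Vec.sum u) (bound G)
      ... | inj₁ u≤G = inj₁ (∈-simplex⁺ u u≤G)
      ... | inj₂ G<u = inj₂ (K.trans (K.*-congʳ (K.trans (vanishes (vanish G u G<u)) ι.0#-homo)) (K.zeroˡ _))

    module _ (x : Vec K.Carrier m) where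
      private
        χ : Exponent m → Carrier
        χ = value (Vec.map t x)

        χ^ : ℕ → Exponent m → Carrier
        χ^ i u = χ ((p ℕ.^ i) ⊙ u)

        ⊙-0 : ∀ m c → c ⊙ Vec.replicate m 0 ≡ Vec.replicate m 0
        ⊙-0 zero    c = ≡.refl
        ⊙-0 (suc m) c = ≡.cong₂ _∷_ (ℕ.*-zeroʳ c) (⊙-0 m c)

        χ^-⊕ : ∀ i u v → χ^ i (u ⊕ v) ≈ χ^ i u * χ^ i v
        χ^-⊕ i u v = trans (reflexive (≡.cong χ (⊙-distrib-⊕ (p ℕ.^ i) u v))) (value-⊕ (Vec.map t x) _ _)

        χ^-0 : ∀ i → χ^ i (Vec.replicate m 0) ≈ 1#
        χ^-0 i = trans (reflexive (≡.cong χ (⊙-0 m (p ℕ.^ i)))) (value-0 (Vec.map t x))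

      -- φⁱ(F) evaluated at the Teichmüller point t(x).
      conjugate : ℕ → Carrier
      conjugate i = Pairing.pair Rᶜ S (jφ^-hom i) (Polynomials.formal Rᶜ F) (χ^ i)

      -- The value at t(x) of the Frobenius product formed with F itself, that is with s = 1.
      norm : ℕ → Carrier
      norm zero    = 1#
      norm (suc i) = conjugate i ^ (p ∸ 1) * norm i

      -- Evaluation at t(x) is multiplicative, so replacing F by Fˢ only raises the value to the
      -- s-th power. This turns the traces into power sums of one number per point.
      pair-frobeniusProduct : ∀ s i →
        Pairing.pair Rᶜ S j-hom (frobeniusProduct ((F ^ₚ s) ^ₚ (p ∸ 1)) i) χ ≈ norm i ^ s
      pair-frobeniusProduct s zero = begin
        Pairing.pair Rᶜ S j-hom (frobeniusProduct ((F ^ₚ s) ^ₚ (p ∸ 1)) 0) χ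
          ≈⟨ Pairing.pair-single Rᶜ S j-hom R.1# (Vec.replicate m 0) χ ⟩
        j R.1# * χ (Vec.replicate m 0)
          ≈⟨ *-cong (RingMorphisms.IsRingHomomorphism.1#-homo j-hom) (value-0 (Vec.map t x)) ⟩
        1# * 1#
          ≈⟨ trans (*-identityˡ 1#) (sym (1^ s)) ⟩
        1# ^ s ∎
        where open SetoidReasoning setoid
      pair-frobeniusProduct s (suc i) = begin
        pair (convolve Rᶜ _⊕_ (twist i G) X) χ
          ≈⟨ pair-convolve _⊕_ (twist i G) X χ ⟩
        pair (twist i G) (λ u → pair X λ v → χ (u ⊕ v))
          ≈⟨ pair-cong (twist i G) (λ u → trans (pair-cong X (value-⊕ (Vec.map t x) u)) (sym (pair-*ˡ (χ u) X χ))) ⟩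
        pair (twist i G) (λ u → χ u * pair X χ)
          ≈⟨ pair-*ʳ (pair X χ) (twist i G) χ ⟨
        pair (twist i G) χ * pair X χ
          ≈⟨ *-cong (sum-map _ G _) (pair-frobeniusProduct s i) ⟩
        Pairing.pair Rᶜ S (jφ^-hom i) G (χ^ i) * norm i ^ s
          ≈⟨ *-congʳ (trans (pair-formal-^ (F ^ₚ s) (p ∸ 1)) (^-congˡ (p ∸ 1) (pair-formal-^ F s))) ⟩
        (conjugate i ^ s) ^ (p ∸ 1) * norm i ^ s
          ≈⟨ *-congʳ (trans (^-assocʳ _ s (p ∸ 1)) (trans (^-congʳ _ (ℕ.*-comm s (p ∸ 1)))
               (sym (^-assocʳ _ (p ∸ 1) s)))) ⟩
        (conjugate i ^ (p ∸ 1)) ^ s * norm i ^ s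
          ≈⟨ ^-distrib-* _ _ s ⟨
        norm (suc i) ^ s ∎
        where
        open SetoidReasoning setoid
        open Pairing Rᶜ S j-hom
        open Evaluation.Multiplicative Rᶜ S (jφ^-hom i) (χ^ i) (χ^-⊕ i) (χ^-0 i)
        G = Polynomials.formal Rᶜ ((F ^ₚ s) ^ₚ (p ∸ 1))
        X = frobeniusProduct ((F ^ₚ s) ^ₚ (p ∸ 1)) i

      -- Modulo p, φⁱ acts on coefficients and monomials as the pⁱ-th power, which is additive in K.
      red-conjugate : ∀ i → red (conjugate i) K.≈ eval Kᶜ ι F̄ x Kˣ.^ (p ℕ.^ i)
      red-conjugate i = begin
        red (conjugate i)
          ≈⟨ red.⟦⟧-cong (Evaluation.pair-formal Rᶜ S (jφ^-hom i) F (χ^ i)) ⟩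
        red (sumOver S Σ₀ λ u → j (φ^ i (coeff F u)) * χ^ i u)
          ≈⟨ sum-homo S Kᶜ red-hom Σ₀ _ ⟩
        sumOver Kᶜ Σ₀ (λ u → red (j (φ^ i (coeff F u)) * χ^ i u))
          ≈⟨ ΣK.sum-cong Σ₀ (λ u → K.trans (red.*-homo _ _) (K.trans
               (K.*-cong (red-jφ^ i (coeff F u)) (red-χ^ u)) (K.sym (Kˣ.^-distrib-* _ _ (p ℕ.^ i))))) ⟩
        sumOver Kᶜ Σ₀ (λ u → (ρ (coeff F u) K.* VK.value x u) Kˣ.^ (p ℕ.^ i))
          ≈⟨ sum-homo Kᶜ Kᶜ (frobenius-isRingHom i) Σ₀ _ ⟨
        sumOver Kᶜ Σ₀ (λ u → ρ (coeff F u) K.* VK.value x u) Kˣ.^ (p ℕ.^ i)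
          ≈⟨ Kˣ.^-congˡ (p ℕ.^ i) (eval-lift x) ⟩
        eval Kᶜ ι F̄ x Kˣ.^ (p ℕ.^ i) ∎
        where
        open SetoidReasoning K.setoid
        Σ₀ = simplex m (bound F)

        red-map-t : ∀ {m} (x : Vec K.Carrier m) → Pointwise K._≈_ (Vec.map red (Vec.map t x)) x
        red-map-t []       = []
        red-map-t (c ∷ x) = red-t c ∷ red-map-t x

        red-χ^ : ∀ u → red (χ^ i u) K.≈ VK.value x u Kˣ.^ (p ℕ.^ i)
        red-χ^ u = K.trans (value-homo S Kᶜ red-hom (Vec.map t x) _)
          (K.trans (VK.value-cong (red-map-t x) _) (VK.value-⊙ x (p ℕ.^ i) u))

      -- The exponents (p - 1)pʲ with j < i add up to pⁱ - 1. The extra factor z = F̄(x) avoids this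
      -- subtraction and, for i = ar, allows zᴺ = z to be used.
      red-norm : ∀ i → red (norm i) K.* eval Kᶜ ι F̄ x K.≈ eval Kᶜ ι F̄ x Kˣ.^ (p ℕ.^ i)
      red-norm zero    = K.trans (K.*-congʳ red.1#-homo) (K.*-comm _ _)
      red-norm (suc i) = begin
        red (conjugate i ^ (p ∸ 1) * norm i) K.* z
          ≈⟨ K.trans (K.*-congʳ (red.*-homo _ _)) (K.*-assoc _ _ _) ⟩
        red (conjugate i ^ (p ∸ 1)) K.* (red (norm i) K.* z)
          ≈⟨ K.*-cong (K.trans (^-homo S Kᶜ red-hom _ (p ∸ 1)) (Kˣ.^-congˡ (p ∸ 1) (red-conjugate i)))
                      (red-norm i) ⟩
        (z Kˣ.^ (p ℕ.^ i)) Kˣ.^ (p ∸ 1) K.* z Kˣ.^ (p ℕ.^ i)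
          ≈⟨ K.*-comm _ _ ⟩
        (z Kˣ.^ (p ℕ.^ i)) Kˣ.^ suc (p ∸ 1)
          ≈⟨ Kˣ.^-assocʳ z (p ℕ.^ i) (suc (p ∸ 1)) ⟩
        z Kˣ.^ (p ℕ.^ i ℕ.* suc (p ∸ 1))
          ≈⟨ Kˣ.^-congʳ z (≡.trans (≡.cong (p ℕ.^ i ℕ.*_) (ℕ.suc-pred p)) (ℕ.*-comm (p ℕ.^ i) p)) ⟩
        z Kˣ.^ (p ℕ.^ suc i) ∎
        where
        open SetoidReasoning K.setoid
        z = eval Kᶜ ι F̄ x

      -- At a zero of F̄ each `conjugate` lies in the kernel, and `norm i` contains i of them to the
      -- power p - 1. The factor 1 in the depth is that of a single element, as `deep-^` returns it.
      norm-deep : eval Kᶜ ι F̄ x K.≈ K.0# → ∀ i → Deep (i ℕ.* ((p ∸ 1) ℕ.* 1)) (norm i)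
      norm-deep h zero    = deep-0 1#
      norm-deep h (suc i) = deep-* (deep-^ (deep-1 (K.trans (red-conjugate i) (K.trans
        (Kˣ.^-congˡ (p ℕ.^ i) h) (RingMorphisms.IsRingHomomorphism.0#-homo (frobenius-isRingHom i))))) (p ∸ 1))
        (norm-deep h i)

      alphaPolynomial-norm : ∀ τ → 1 ≤ τ → l ≤ τ ℕ.* ((p ∸ 1) ℕ.* a ℕ.* r) →
        alphaPolynomial l τ (norm i₀) ≈ [ eval Kᶜ ι F̄ x K.≈? K.0# ]
      alphaPolynomial-norm τ@(suc τ-1) _ l≤ with eval Kᶜ ι F̄ x K.≈? K.0#
      -- The error is a multiple of the τ-th power of the norm, of depth τ(p - 1)ar; the lower bound
      -- on τ makes this at least l.
      ... | yes h with z , eq ← alphaPolynomial-near-0 l τ-1 (norm i₀) = trans eq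
        (trans (+-congˡ (deep⇒≈0 l≤′ (deep-*ˡ z (deep-^ (norm-deep h i₀) τ)))) (+-identityʳ 1#))
        where
        l≤′ : l ≤ τ ℕ.* (i₀ ℕ.* ((p ∸ 1) ℕ.* 1))
        l≤′ = ≡.subst (λ n → l ≤ τ ℕ.* n) (≡.trans (ℕ.*-assoc (p ∸ 1) a r)
          (≡.trans (ℕ.*-comm (p ∸ 1) i₀) (≡.cong (i₀ ℕ.*_) (≡.sym (ℕ.*-identityʳ (p ∸ 1)))))) l≤
      -- The norm reduces to 1, so the factor (1 - y)ˡ is a product of l kernel elements and
      -- vanishes.
      ... | no z≉0 = trans (alphaPolynomial-factor l τ (norm i₀)) (trans (*-comm _ _)
        (deep⇒≈0 (ℕ.≤-reflexive (≡.sym (ℕ.*-identityʳ l))) (deep-*ˡ _ (deep-^ (deep-1 killed) l))))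
        where
        red≈1 : red (norm i₀) K.≈ K.1#
        red≈1 = FiniteFieldProperties.*-cancelˡ-≉0 Fqʳ z≉0 (K.trans (K.*-comm _ _) (K.trans (red-norm i₀)
          (K.trans (Kˣ.^-congʳ _ (≡.sym N≡p^ar)) (K.trans (FiniteFieldProperties.x^N≈x Fqʳ _)
            (K.sym (K.*-identityʳ _))))))

        killed : red (1# - norm i₀) K.≈ K.0#
        killed = K.trans (red.+-homo _ _) (K.trans
          (K.+-cong red.1#-homo (K.trans (red.-‿homo _) (K.-‿cong red≈1))) (K.-‿inverseʳ K.1#))

    -- Homomorphisms preserve brackets. The moduli N - 1 and pᵃʳ - 1 agree only through a law of
    -- exponents, hence the transport in `modulus`.
    pair-j : ∀ (X : FormalSum Rᶜ (Exponent m)) →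
             Pairing.pair Rᶜ S j-hom X (λ v → [ multiple? (N ∸ 1) v ]) ≈
             j (Pairing.pair Rᶜ Rᶜ (Identity.isRingHomomorphism R.rawRing R.refl) X
                  (λ v → ΣR.[ multiple? (p ℕ.^ i₀ ∸ 1) v ]))
    pair-j X = sym (trans (sum-homo Rᶜ S j-hom X _) (sum-cong X λ y → trans
        (RingMorphisms.IsRingHomomorphism.*-homo j-hom _ _)
        (*-congˡ (trans (j-[] (multiple? (p ℕ.^ i₀ ∸ 1) (proj₂ y))) (modulus (≡.cong (_∸ 1) N≡p^ar) (proj₂ y))))))
      where
      j-[] : ∀ {P : Set} (d : Dec P) → j ΣR.[ d ] ≈ [ d ]
      j-[] (yes _) = RingMorphisms.IsRingHomomorphism.1#-homo j-hom
      j-[] (no _)  = RingMorphisms.IsRingHomomorphism.0#-homo j-hom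

      modulus : ∀ {c c′} .{{_ : NonZero c}} .{{_ : NonZero c′}} → c ≡ c′ → (v : Exponent m) →
                [ multiple? c′ v ] ≈ [ multiple? c v ]
      modulus ≡.refl v = refl

    -- The zeros are counted by the values of the indicator polynomial at the norms; exchanging the
    -- sums over points and over s leaves the power sums, which `φ^-trace` identifies with traces.
    count-in-S : Homogeneous d F → ∀ τ → 1 ≤ τ → l ≤ τ ℕ.* ((p ∸ 1) ℕ.* a ℕ.* r) →
      fromℕ S (length (zeros ι-hom F̄)) ≈
      fromℕ S (N ∸ 1) ^ m * sumOver S (upTo (l ℕ.+ τ)) λ s →
        fromℤ S (α l τ s) *
        j (φ^ i₀ (trace (d ℕ.* s) (λ G → iterate (A p-prime Φ (F ^ₚ s)) G i₀)))
    count-in-S hom τ 1≤τ l≤ = begin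
      fromℕ S (length (zeros ι-hom F̄))
        ≈⟨ length-filter _ (torus m) ⟩
      sumOver S (torus m) (λ x → [ eval Kᶜ ι F̄ x K.≈? K.0# ])
        ≈⟨ sum-cong (torus m) (λ x → alphaPolynomial-norm x τ 1≤τ l≤) ⟨
      sumOver S (torus m) (λ x → sumOver S Σₛ λ s → fromℤ S (α l τ s) * norm x i₀ ^ s)
        ≈⟨ sum-comm (torus m) Σₛ _ ⟩
      sumOver S Σₛ (λ s → sumOver S (torus m) λ x → fromℤ S (α l τ s) * norm x i₀ ^ s)
        ≈⟨ sum-cong Σₛ (λ s → trans (sym (sum-*ˡ _ (torus m) _)) (trans (*-congˡ (points s)) (x∙yz≈y∙xz _ _ _))) ⟩
      sumOver S Σₛ (λ s → fromℕ S (N ∸ 1) ^ m * (fromℤ S (α l τ s) * j (φ^ i₀ (T s))))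
        ≈⟨ sum-*ˡ _ Σₛ _ ⟨
      fromℕ S (N ∸ 1) ^ m * sumOver S Σₛ (λ s → fromℤ S (α l τ s) * j (φ^ i₀ (T s))) ∎
      where
      open SetoidReasoning setoid
      open import Algebra.Properties.CommutativeSemigroup *-commutativeSemigroup using (x∙yz≈y∙xz)
      open Pairing Rᶜ S j-hom
      Σₛ = upTo (l ℕ.+ τ)
      T : ℕ → R.Carrier
      T s = trace (d ℕ.* s) (λ G → iterate (A p-prime Φ (F ^ₚ s)) G i₀)

      points : ∀ s → sumOver S (torus m) (λ x → norm x i₀ ^ s) ≈ fromℕ S (N ∸ 1) ^ m * j (φ^ i₀ (T s))
      points s = begin
        sumOver S (torus m) (λ x → norm x i₀ ^ s)
          ≈⟨ sum-cong (torus m) (λ x → pair-frobeniusProduct x s i₀) ⟨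
        sumOver S (torus m) (λ x → pair (P s) (value (Vec.map t x)))
          ≈⟨ pair-sum (P s) (torus m) (λ x → value (Vec.map t x)) ⟩
        pair (P s) (λ v → sumOver S (torus m) λ x → value (Vec.map t x) v)
          ≈⟨ pair-cong (P s) (sum-torus-character S t power-sum) ⟩
        pair (P s) (λ v → [ multiple? (N ∸ 1) v ] * fromℕ S (N ∸ 1) ^ m)
          ≈⟨ pair-*ʳ _ (P s) _ ⟨
        pair (P s) (λ v → [ multiple? (N ∸ 1) v ]) * fromℕ S (N ∸ 1) ^ m
          ≈⟨ trans (*-comm _ _) (*-congˡ (pair-j (P s))) ⟩
        fromℕ S (N ∸ 1) ^ m * j (Pairing.pair Rᶜ Rᶜ (Identity.isRingHomomorphism R.rawRing R.refl) (P s)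
                                   (λ v → ΣR.[ multiple? (p ℕ.^ i₀ ∸ 1) v ]))
          ≈⟨ *-congˡ (RingMorphisms.IsRingHomomorphism.⟦⟧-cong j-hom (φ^-trace (F ^ₚ s)
               (≡.subst (λ D → Homogeneous D (F ^ₚ s)) (ℕ.*-comm s d)
                 (Polynomials.homogeneous-^ Rᶜ {G = F} hom s)) i₀)) ⟨
        fromℕ S (N ∸ 1) ^ m * j (φ^ i₀ (T s)) ∎

-- Descent from S to Z_q

open import Data.Nat.Base using (_+_; _*_; _^_)

theorem3p1 :
  ∀ {c₁ ℓ₁ c₂ ℓ₂ c₃ ℓ₃} (p a n d : ℕ) (p-prime : Prime p) → 1 ≤ a → 1 ≤ n → 1 ≤ d →
  (Fq : FiniteField c₁ ℓ₁ (p ^ a)) (Zq : WittVectors p Fq c₂ ℓ₂) (Φ : Frobenius Zq) →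
  (F̄ : Poly (FiniteField.commutativeRing Fq) (suc n)) → Homogeneous d F̄ →
  (r l τ : ℕ) → 1 ≤ r → 1 ≤ l → 1 ≤ τ → l ≤ τ * ((p ∸ 1) * a * r) →
  (Fqʳ : FiniteField c₃ ℓ₃ ((p ^ a) ^ r)) →
  (ι : FiniteField.Carrier Fq → FiniteField.Carrier Fqʳ) →
  IsRingHomomorphism (FiniteField.commutativeRing Fq) (FiniteField.commutativeRing Fqʳ) ι →
  (F : Poly (WittVectors.commutativeRing Zq) (suc n)) → Homogeneous d F →
  (∀ u → FiniteField._≈_ Fq (WittVectors.reduce Zq (coeff F u)) (coeff F̄ u)) →
  let R = WittVectors.commutativeRing Zq
      open WittVectors Zq using () renaming (_*_ to _·_)
  in R ⊢ fromℕ R (torusPoints Fqʳ ι F̄)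
       ≈ fromℕ R (((p ^ a) ^ r ∸ 1) ^ n)
           · sumOver R (upTo (l + τ)) (λ s →
               fromℤ R (α l τ s)
                 · trace (d * s) (λ G → iterate (A p-prime Φ (F ^ₚ s)) G (a * r)))
       mod p ^ l
theorem3p1 p a n d p-prime 1≤a 1≤n 1≤d Fq Zq Φ F̄ F̄-hom r l τ 1≤r 1≤l 1≤τ l≤ Fqʳ ι ι-hom F F-hom F-lifts =
  descend divisible
  where
  open TeichmullerRing {p = p} {a = a} p-prime Fq Zq 1≤r Fqʳ ι-hom l 1≤l
  open FrobeniusTrace p-prime Φ
  module T = TorusSums Fqʳ
  module C = CountInS {p = p} {a = a} p-prime Fq Zq Φ 1≤r Fqʳ ι-hom l S j-hom red-hom red-j t red-t power-sum nilpotent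
  module jφ = RingMorphisms.IsRingHomomorphism (C.jφ^-hom (a ℕ.* r))
  module φᵢ = RingMorphisms.IsRingHomomorphism (φ^-hom (a ℕ.* r))
  open Divisibility R.semiring using (_,_) renaming (_∣_ to _∣ᴿ_)
  open Exp R.commutativeSemiring using () renaming (_^_ to _^ᴿ_)
  open FromInteger R.commutativeRing using (fromℕ-*)
  Rᶜ = R.commutativeRing
  i₀ = a ℕ.* r
  M = torusPoints Fqʳ ι F̄
  Σₛ = upTo (l ℕ.+ τ)

  instance
    N-1-nonZero : NonZero (N ∸ 1)
    N-1-nonZero = K.q-1-nonZero

  traces : R.Carrier
  traces = sumOver Rᶜ Σₛ λ s →
    fromℤ Rᶜ (α l τ s) R.* trace (d ℕ.* s) (λ G → iterate (A p-prime Φ (F ^ₚ s)) G i₀)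

  -- E is the difference to be shown divisible by pˡ. The count in S concerns affine zeros and so
  -- controls E · D only; D is a unit modulo p and is cancelled in `divisible`.
  D E : R.Carrier
  D = fromℕ Rᶜ (N ∸ 1)
  E = fromℕ Rᶜ M R.- fromℕ Rᶜ ((N ∸ 1) ℕ.^ n) R.* traces

  fromℕ-^ : ∀ x k → fromℕ Rᶜ (x ℕ.^ k) R.≈ fromℕ Rᶜ x ^ᴿ k
  fromℕ-^ x zero    = R.+-identityʳ R.1#
  fromℕ-^ x (suc k) = R.trans (fromℕ-* x (x ℕ.^ k)) (R.*-congˡ (fromℕ-^ x k))

  zeros-count : length (T.zeros ι-hom F̄) ≡ M ℕ.* (N ∸ 1)
  zeros-count = ≡.sym (m/n*n≡m (T.length-zeros ι-hom F̄ F̄-hom))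

  image-traces : j (φ^ i₀ (D ^ᴿ suc n R.* traces)) S.≈ fromℕ S (length (T.zeros ι-hom F̄))
  image-traces = S.trans (jφ.*-homo (D ^ᴿ suc n) traces) (S.trans
    (S.*-cong
      (S.trans (^-homo Rᶜ S (C.jφ^-hom i₀) D (suc n)) (Sˣ.^-congˡ (suc n) (fromℕ-homo Rᶜ S (C.jφ^-hom i₀) (N ∸ 1))))
      (S.trans (sum-homo Rᶜ S (C.jφ^-hom i₀) Σₛ _) (Sums.sum-cong S Σₛ λ s → S.trans (jφ.*-homo _ _)
        (S.*-congʳ (fromℤ-homo Rᶜ S (C.jφ^-hom i₀) (α l τ s))))))
    (S.sym (C.count-in-S F̄ F F-lifts F-hom τ 1≤τ l≤)))

  image-E : j (φ^ i₀ (E R.* D)) S.≈ S.0#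
  image-E = S.trans (jφ.⟦⟧-cong expand) (S.trans (jφ.+-homo _ _) (S.trans
    (S.+-cong (S.trans (fromℕ-homo Rᶜ S (C.jφ^-hom i₀) (M ℕ.* (N ∸ 1)))
        (S.reflexive (≡.cong (fromℕ S) (≡.sym zeros-count))))
      (S.trans (jφ.-‿homo _) (S.-‿cong image-traces)))
    (S.-‿inverseʳ (fromℕ S (length (T.zeros ι-hom F̄))))))
    where
    open FromInteger.Solver Rᶜ using (solve; _:=_; _:*_; _:-_)
    expand : E R.* D R.≈ fromℕ Rᶜ (M ℕ.* (N ∸ 1)) R.- D ^ᴿ suc n R.* traces
    expand = R.trans (R.*-congʳ (R.+-congˡ (R.-‿cong (R.*-congʳ (fromℕ-^ (N ∸ 1) n)))))
      (R.trans (solve 4 (λ x y z d → (x :- y :* z) :* d := x :* d :- (d :* y) :* z) R.refl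
                 (fromℕ Rᶜ M) (D ^ᴿ n) traces D)
        (R.+-congʳ (R.sym (fromℕ-* M (N ∸ 1)))))

  φ^D : φ^ i₀ D R.≈ D
  φ^D = fromℕ-homo Rᶜ Rᶜ (φ^-hom i₀) (N ∸ 1)

  divisible : pᴿ ^ᴿ l ∣ᴿ φ^ i₀ E
  divisible = ∼0⇒∣ (ρ-unit-cancel
    (λ h → N-1≉0 (K.trans (K.sym (fromℕ-homo Rᶜ K.commutativeRing ρ-hom (N ∸ 1))) h))
    (∼-trans (∼-reflexive (R.trans (R.*-congˡ (R.sym φ^D)) (R.sym (φᵢ.*-homo E D))))
      (j-reflects image-E)))

  -- The power of φ is bijective and fixes p, so the cofactor has a preimage and the equation can be
  -- pulled back.
  descend : pᴿ ^ᴿ l ∣ᴿ φ^ i₀ E → pᴿ ^ᴿ l ∣ᴿ E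
  descend (z′ , eq) with z , φz≈ ← φ^-surjective i₀ z′ =
    z , φ^-injective i₀ (R.trans (φᵢ.*-homo z (pᴿ ^ᴿ l)) (R.trans
      (R.*-cong φz≈ (R.trans (^-homo Rᶜ Rᶜ (φ^-hom i₀) pᴿ l)
        (Exp.^-congˡ R.commutativeSemiring l (fromℕ-homo Rᶜ Rᶜ (φ^-hom i₀) p))))
      eq))
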